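{- Let $t$ be a (closed) $\lambda$-term. Every Space KAM run $\rho$ from the initial state for $t$ to some state $q$ is implemented on Turing machines in space $O(|\rho|_{\mathsf{sp}})$.
   Context: **Space KAM.** $\lambda$-terms $t,u::=x\mid\lambda x.t\mid t\,u$. Environments $e::=\epsilon\mid[x{\leftarrow}c]\cdot e$, closures $c=(t,e)$, stacks $\pi::=\epsilon\mid c\cdot\pi$; states are triples $(t,e,\pi)$, with an immutable closed code $t_0$. $e(x)$ is the closure associated to $x$ in $e$; $e|_t$ is the restriction of $e$ to the free variables $\mathsf{fv}(t)$ of $t$. The initial state for closed $t_0$ has code $t_0$ and is $(t_0,\epsilon,\epsilon)$. Transitions: - $(t\,x,e,\pi)\to(t,e|_t,e(x)\cdot\pi)$; - $(t\,u,e,\pi)\to(t,e|_t,(u,e|_u)\cdot\pi)$ if $u$ is not a variable; - $(\lambda x.t,e,c\cdot\pi)\to(t,e,\pi)$ if $x\notin\mathsf{fv}(t)$; - $(\lambda x.t,e,c\cdot\pi)\to(t,[x{\leftarrow}c]\cdot e,\pi)$ if $x\in\mathsf{fv}(t)$; - $(x,e,\pi)\to(u,e',\pi)$ if $e(x)=(u,e')$. **Space.** Every term $u$ in a reachable state is a sub-term (occurrence) of $t_0$ and is represented by its left address, i.e. the index in binary of its root constructor in the in-order enumeration of the constructors of $t_0$ (application: left sub-term, then the application, then right sub-term; abstraction: the abstraction, then the body). A term occurrence costs the bit-length of its left address (the variable of an environment entry is a pointer to its binder, costed likewise); environments, closures and stacks are flat strings, so the space of a state is the sum of the costs of its components (code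 not counted); $|\rho|_{\mathsf{sp}}$ is the maximum space of a state of $\rho$. **Implemented on TMs.** There is a multi-tape Turing machine (with a read-only input tape holding a representation of the code $t$, not counted for space, and work tapes for the active term pointer, the environment, the stack and auxiliary pointers) that goes through representations of the successive states of $\rho$; its space is the number of work cells used. -}

module Defs where

open import Data.Bool.Base using (Bool; true; false)
open import Data.Digit using (Bit; fromDigits; 0b; 1b)
open import Data.Fin.Base using (Fin; zero; suc)
open import Data.List.Base
  using (List; []; _∷_; [_]; _++_; _ʳ++_; map; filter; replicate; length; head; drop)
open import Data.Maybe.Base using (Maybe; just; nothing)
import Data.Maybe.Base as Maybe
open import Data.Nat.Base using (ℕ; zero; suc; pred; _+_; _*_; _⊔_; _⊓_; _≤_)
open import Data.Nat.Properties using (_≟_)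
open import Data.Product.Base using (∃; ∃₂; _×_; _,_)
open import Data.Vec.Base using (Vec; []; _∷_)
import Data.Vec.Base as Vec
open import Function.Bundles using (_↔_)
open import Relation.Binary.Construct.Closure.ReflexiveTransitive using (Star; ε; _◅_)
open import Relation.Binary.PropositionalEquality using (_≡_; _≢_; refl; cong; trans)
open import Relation.Nullary.Decidable using (yes; no; ¬?)
open import Data.List.Membership.DecPropositional _≟_ using (_∈_; _∉_; _∈?_)

------------------------------------------------------------------------
-- λ-terms

Var : Set
Var = ℕ

infixl 7 _·_

data Term : Set where
  var : Var → Term
  ƛ   : Var → Term → Term
  _·_ : Term → Term → Term

fv : Term → List Var
fv (var x) = [ x ]
fv (ƛ x t) = filter (λ y → ¬? (y ≟ x)) (fv t)
fv (t · u) = fv t ++ fv u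

Closed : Term → Set
Closed t = fv t ≡ []

-- The number of constructors.
size : Term → ℕ
size (var x) = 1
size (ƛ x t) = suc (size t)
size (t · u) = size t + suc (size u)

------------------------------------------------------------------------
-- Sub-term occurrences and left addresses

-- Occ t₀ t is the type of occurrences of t as a sub-term of t₀.
data Occ (t₀ : Term) : Term → Set where
  root : Occ t₀ t₀
  body : ∀ {x t} → Occ t₀ (ƛ x t) → Occ t₀ t
  fun  : ∀ {t u} → Occ t₀ (t · u) → Occ t₀ t
  arg  : ∀ {t u} → Occ t₀ (t · u) → Occ t₀ u

-- The constructors of an occurrence form an interval of the in-order
-- enumeration of t₀ (whose indices start from 1); this is the least
-- index in that interval.
first : ∀ {t₀ t} → Occ t₀ t → ℕ
first root            = 1
first (body o)        = suc (first o)
first (fun o)         = first o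
first (arg {t = t} o) = first o + suc (size t)

-- The number of constructors of a term that precede its root
-- constructor in the in-order enumeration.
beforeRoot : Term → ℕ
beforeRoot (var x) = 0
beforeRoot (ƛ x t) = 0
beforeRoot (t · u) = size t

leftAddress : ∀ {t₀ t} → Occ t₀ t → ℕ
leftAddress {t = t} o = first o + beforeRoot t

-- Binary notation, least significant bit first, without superfluous
-- zeros.  Left addresses are positive, so their notation is non-empty.
inc : List Bit → List Bit
inc []              = 1b ∷ []
inc (zero     ∷ bs) = 1b ∷ bs
inc (suc zero ∷ bs) = 0b ∷ inc bs

binary : ℕ → List Bit
binary zero    = []
binary (suc n) = inc (binary n)

fromDigits-inc : ∀ bs → fromDigits (inc bs) ≡ suc (fromDigits bs)
fromDigits-inc []              = refl
fromDigits-inc (zero     ∷ bs) = refl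
fromDigits-inc (suc zero ∷ bs) = cong (_* 2) (fromDigits-inc bs)

fromDigits-binary : ∀ n → fromDigits (binary n) ≡ n
fromDigits-binary zero    = refl
fromDigits-binary (suc n) =
  trans (fromDigits-inc (binary n)) (cong suc (fromDigits-binary n))

------------------------------------------------------------------------
-- The Space KAM on a fixed code t₀

-- All terms in closures and states are occurrences in t₀.  The
-- variable x of an entry [x←c] is given by the occurrence of the
-- abstraction ƛ x t that binds it.
mutual
  data Closure (t₀ : Term) : Set where
    clo : ∀ {t} → Occ t₀ t → List (Entry t₀) → Closure t₀

  data Entry (t₀ : Term) : Set where
    _←_ : ∀ {x t} → Occ t₀ (ƛ x t) → Closure t₀ → Entry t₀

Env Stack : Term → Set
Env   t₀ = List (Entry t₀)
Stack t₀ = List (Closure t₀)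

entryVar : ∀ {t₀} → Entry t₀ → Var
entryVar (_←_ {x = x} _ _) = x

entryClosure : ∀ {t₀} → Entry t₀ → Closure t₀
entryClosure (_ ← c) = c

-- e(x), if defined.
lookup : ∀ {t₀} → Env t₀ → Var → Maybe (Closure t₀)
lookup e x = Maybe.map entryClosure (head (filter (λ n → entryVar n ≟ x) e))

-- e|ₜ
infixl 8 _↾_

_↾_ : ∀ {t₀} → Env t₀ → Term → Env t₀
e ↾ t = filter (λ n → entryVar n ∈? fv t) e

data State (t₀ : Term) : Set where
  ⟨_,_,_⟩ : ∀ {t} → Occ t₀ t → Env t₀ → Stack t₀ → State t₀

initial : ∀ t₀ → State t₀
initial t₀ = ⟨ root , [] , [] ⟩

infix 4 _⟶_ _⟶*_

data _⟶_ {t₀ : Term} : State t₀ → State t₀ → Set where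
  app-var : ∀ {t x e c π} {o : Occ t₀ (t · var x)} →
            lookup e x ≡ just c →
            ⟨ o , e , π ⟩ ⟶ ⟨ fun o , e ↾ t , c ∷ π ⟩
  app     : ∀ {t u e π} {o : Occ t₀ (t · u)} →
            (∀ x → u ≢ var x) →
            ⟨ o , e , π ⟩ ⟶ ⟨ fun o , e ↾ t , clo (arg o) (e ↾ u) ∷ π ⟩
  lam-∉   : ∀ {x t e c π} {o : Occ t₀ (ƛ x t)} →
            x ∉ fv t →
            ⟨ o , e , c ∷ π ⟩ ⟶ ⟨ body o , e , π ⟩
  lam-∈   : ∀ {x t e c π} {o : Occ t₀ (ƛ x t)} →
            x ∈ fv t →
            ⟨ o , e , c ∷ π ⟩ ⟶ ⟨ body o , (o ← c) ∷ e , π ⟩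
  sub     : ∀ {x u e e′ π} {o : Occ t₀ (var x)} {o′ : Occ t₀ u} →
            lookup e x ≡ just (clo o′ e′) →
            ⟨ o , e , π ⟩ ⟶ ⟨ o′ , e′ , π ⟩

_⟶*_ : ∀ {t₀} → State t₀ → State t₀ → Set
_⟶*_ = Star _⟶_

------------------------------------------------------------------------
-- Space of states and runs

occSpace : ∀ {t₀ t} → Occ t₀ t → ℕ
occSpace o = length (binary (leftAddress o))

mutual
  closureSpace : ∀ {t₀} → Closure t₀ → ℕ
  closureSpace (clo o e) = occSpace o + envSpace e

  envSpace : ∀ {t₀} → Env t₀ → ℕ
  envSpace []            = 0
  envSpace ((b ← c) ∷ e) = occSpace b + closureSpace c + envSpace e

stackSpace : ∀ {t₀} → Stack t₀ → ℕ
stackSpace []      = 0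
stackSpace (c ∷ π) = closureSpace c + stackSpace π

stateSpace : ∀ {t₀} → State t₀ → ℕ
stateSpace ⟨ o , e , π ⟩ = occSpace o + envSpace e + stackSpace π

∣_∣sp : ∀ {t₀} {s q : State t₀} → s ⟶* q → ℕ
∣ ε {s} ∣sp         = stateSpace s
∣ _◅_ {i = s} _ ρ ∣sp = stateSpace s ⊔ ∣ ρ ∣sp

------------------------------------------------------------------------
-- Deterministic Turing machines with a read-only input tape over I and
-- k two-way infinite work tapes over Γ; blanks are represented by nothing

data Move : Set where
  left stay right : Move

record TM (k : ℕ) (I Γ : Set) : Set₁ where
  field
    Control : Set
    finite  : ∃ λ n → Control ↔ Fin n
    start   : Control
    δ       : Control → Maybe I → Vec (Maybe Γ) k →
              Maybe (Control × Move × Vec (Maybe Γ × Move) k)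

-- The visited part of a work tape: the cells to the left of the head
-- (nearest first), the scanned cell, and the cells to its right.
record Tape (Γ : Set) : Set where
  constructor tape
  field
    lefts   : List (Maybe Γ)
    scanned : Maybe Γ
    rights  : List (Maybe Γ)

open Tape public

blankTape : ∀ {Γ} → Tape Γ
blankTape = tape [] nothing []

contents : ∀ {Γ} → Tape Γ → List (Maybe Γ)
contents (tape ls a rs) = ls ʳ++ (a ∷ rs)

moveTape : ∀ {Γ} → Move → Tape Γ → Tape Γ
moveTape left  (tape []       a rs)       = tape [] nothing (a ∷ rs)
moveTape left  (tape (l ∷ ls) a rs)       = tape ls l (a ∷ rs)
moveTape stay  τ                          = τ
moveTape right (tape ls       a [])       = tape (a ∷ ls) nothing []
moveTape right (tape ls       a (r ∷ rs)) = tape (a ∷ ls) r rs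

updateTape : ∀ {Γ} → Tape Γ → Maybe Γ × Move → Tape Γ
updateTape τ (a , m) = moveTape m (record τ { scanned = a })

-- The input head ranges over positions 0 to n + 1, where n is the
-- length of the input; the input word is at positions 1 to n, and the
-- two ends read as blanks.
readInput : ∀ {I : Set} → List I → ℕ → Maybe I
readInput w zero    = nothing
readInput w (suc p) = head (drop p w)

moveInput : ∀ {I : Set} → List I → Move → ℕ → ℕ
moveInput w left  p = pred p
moveInput w stay  p = p
moveInput w right p = suc p ⊓ suc (length w)

module _ {k : ℕ} {I Γ : Set} (M : TM k I Γ) where
  open TM M

  record Config : Set where
    constructor config
    field
      control  : Control
      inputPos : ℕ
      work     : Vec (Tape Γ) k

  startConfig : Config
  startConfig = config start 1 (Vec.replicate k blankTape)

  step : List I → Config → Maybe Config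
  step w (config s p τs) =
    Maybe.map
      (λ { (s′ , m , acts) →
           config s′ (moveInput w m p) (Vec.zipWith updateTape τs acts) })
      (δ s (readInput w p) (Vec.map scanned τs))

  -- The number of work cells visited up to now: along a computation the
  -- visited part of a tape never shrinks.
  cellsUsed : Config → ℕ
  cellsUsed c = Vec.sum (Vec.map (λ τ → length (contents τ)) (Config.work c))

  -- c′ is the first configuration strictly after c whose control state
  -- satisfies ready.
  data NextReady (ready : Control → Bool) (w : List I) (c c′ : Config) : Set where
    now   : step w c ≡ just c′ → ready (Config.control c′) ≡ true →
            NextReady ready w c c′
    later : ∀ {c″} → step w c ≡ just c″ → ready (Config.control c″) ≡ false →
            NextReady ready w c″ c′ → NextReady ready w c c′

------------------------------------------------------------------------
-- Representation of codes and states on tapes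

data CodeSymbol : Set where
  lamˢ openˢ appˢ varˢ : CodeSymbol
  bitˢ                 : Bit → CodeSymbol

_[_↦_] : (Var → ℕ) → Var → ℕ → Var → ℕ
(σ [ x ↦ n ]) y with y ≟ x
... | yes _ = n
... | no  _ = σ y

-- In-order notation for the term t whose first constructor has index n:
-- t · u is written ( t @ u, and a variable is written as the left
-- address of its binder, which σ provides.
encode : (Var → ℕ) → ℕ → Term → List CodeSymbol
encode σ n (var x) = varˢ ∷ map bitˢ (binary (σ x))
encode σ n (ƛ x t) = lamˢ ∷ encode (σ [ x ↦ n ]) (suc n) t
encode σ n (t · u) =
  openˢ ∷ encode σ n t ++ appˢ ∷ encode σ (n + suc (size t)) u

-- The initial value of σ is irrelevant on closed terms.
codeString : Term → List CodeSymbol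
codeString = encode (λ _ → 0) 1

data WorkSymbol : Set where
  bitʷ                  : Bit → WorkSymbol
  ⟦ʷ ←ʷ ⟧ʷ endʷ         : WorkSymbol

occString : ∀ {t₀ t} → Occ t₀ t → List WorkSymbol
occString o = map bitʷ (binary (leftAddress o))

mutual
  closureString : ∀ {t₀} → Closure t₀ → List WorkSymbol
  closureString (clo o e) = occString o ++ envString e

  envString : ∀ {t₀} → Env t₀ → List WorkSymbol
  envString []            = []
  envString ((b ← c) ∷ e) =
    ⟦ʷ ∷ occString b ++ ←ʷ ∷ closureString c ++ ⟧ʷ ∷ envString e

stackString : ∀ {t₀} → Stack t₀ → List WorkSymbol
stackString []      = []
stackString (c ∷ π) = closureString c ++ endʷ ∷ stackString π

-- Up to surrounding blanks, the tape contains w; the head may be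
-- anywhere.
Holds : ∀ {Γ} → Tape Γ → List Γ → Set
Holds τ w = ∃₂ λ i j →
  contents τ ≡ replicate i nothing ++ map just w ++ replicate j nothing

------------------------------------------------------------------------
-- Implementation of runs

-- The first three work tapes are for the active term, the environment
-- and the stack; the k others are auxiliary.
KAMachine : ℕ → Set₁
KAMachine k = TM (3 + k) CodeSymbol WorkSymbol

Represents : ∀ {k t₀} (M : KAMachine k) → Config M → State t₀ → Set
Represents M (config _ _ (τ₁ ∷ τ₂ ∷ τ₃ ∷ _)) ⟨ o , e , π ⟩ =
  Holds τ₁ (occString o) × Holds τ₂ (envString e) × Holds τ₃ (stackString π)

module _ {k : ℕ} (M : KAMachine k) (ready : TM.Control M → Bool) {t₀ : Term} where

  -- From c, with code t₀ on the input tape, the ready configurations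
  -- that M successively reaches represent the successive states of ρ,
  -- and at most b work cells are used until the last of them.
  data GoesThrough (b : ℕ) (c : Config M) : ∀ {s q : State t₀} → s ⟶* q → Set where
    last : ∀ {s c′} →
           NextReady M ready (codeString t₀) c c′ →
           Represents M c′ s →
           cellsUsed M c′ ≤ b →
           GoesThrough b c (ε {x = s})
    next : ∀ {s s′ q c′} {r : s ⟶ s′} {ρ : s′ ⟶* q} →
           NextReady M ready (codeString t₀) c c′ →
           Represents M c′ s →
           cellsUsed M c′ ≤ b →
           GoesThrough b c′ ρ →
           GoesThrough b c (r ◅ ρ)

  ImplementsInSpace : ∀ {q : State t₀} → ℕ → initial t₀ ⟶* q → Set
  ImplementsInSpace b ρ = GoesThrough b (startConfig M) ρ

{-# OPTIONS --safe #-}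

-- The work tapes are used as stacks, so that a program on stacks and a
-- two-way input has to be given, together with a bound on the heights
-- of its stacks.  Terms are located by counting constructors from the
-- beginning of the code, matching parentheses with a binary counter.
--
-- The size of the code may be exponential in the space of the run, or
-- larger, so that the counters must be kept short.  Left addresses of the
-- new state, and of the function part of the active application, are
-- harmless.  The problem is to restrict the environment to an argument
-- u: the end of u in the code has to be found, but u may be much larger
-- than all the addresses in the current state.  However, unless u
-- extends to the end of the code, it is followed by the application
-- symbol of a term which has been active before.  Hence its number of
-- applications is bounded by a number as long as the longest address
-- seen so far; when a counter starting from that number is exhausted,
-- u extends to the end of the code and no counter is needed any more.

module Submission where

open import Defs
open import Data.Bool.Base using (Bool; true; false; if_then_else_; _∨_; _∧_; not)
open import Data.Bool.Properties using (∨-assoc)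
open import Data.Digit using (Bit; 0b; 1b; fromDigits)
open import Data.Fin using (#_)
open import Data.Fin.Base using (Fin; zero; suc)
open import Data.Fin.Properties using (+↔⊎; 1↔⊤) renaming (_≟_ to _≟ᶠ_)
open import Data.List.Base
  using (List; []; _∷_; _++_; _ʳ++_; map; replicate; length; head; drop; filterᵇ)
open import Data.List.Membership.Propositional using (_∈_; _∉_)
open import Data.List.Membership.Propositional.Properties
  using (∈-++⁺ˡ; ∈-++⁺ʳ; ∈-++⁻; ∈-filter⁺; ∈-filter⁻)
open import Data.List.Properties
  using (length-ʳ++; length-++; length-map; length-replicate; ++-identityʳ; map-++; map-id;
         map-replicate; ʳ++-ʳ++; ++-ʳ++; ++-assoc; ʳ++-defn; filter-all; filter-none;
         filter-accept; filter-reject)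
import Data.List.Relation.Unary.All as All
open import Data.List.Relation.Unary.All using (All; []; _∷_)
open import Data.List.Relation.Unary.All.Properties using (replicate⁺; filter⁺; ++⁺)
open import Data.List.Relation.Unary.Any using (here; there)
import Data.Maybe.Base as Maybe
open import Data.Maybe.Base using (Maybe; just; nothing)
open import Data.Nat.Base
  using (ℕ; zero; suc; _+_; _*_; _⊓_; _≤_; _<_; z≤n; s≤s; _≤′_; ≤′-refl; ≤′-step; _∸_)
open import Data.Nat.Properties
open import Data.Nat.Solver using (module +-*-Solver)
open import Data.Product.Base using (Σ; ∃; ∃₂; _×_; _,_; proj₁; proj₂; map₁)
open import Data.Sum.Base using (_⊎_; inj₁; inj₂; [_,_]′)
open import Data.Sum.Function.Propositional using (_⊎-↔_)
open import Data.Unit.Base using (⊤; tt)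
import Data.Vec.Base as Vec
open import Data.Vec.Base using (Vec; []; _∷_; _[_]≔_)
open import Data.Vec.Properties
  using (lookup-map; lookup-zipWith; lookup-replicate; []≔-lookup; []≔-idempotent; []≔-commutes;
         lookup∘update; lookup∘update′)
open import Function.Base using (_∘_; id)
open import Function.Bundles using (_↔_; mk↔ₛ′)
open import Function.Properties.Inverse using (↔-sym; ↔-trans)
open import Relation.Binary.Construct.Closure.ReflexiveTransitive using (Star; ε; _◅_; _◅◅_)
open import Relation.Binary.PropositionalEquality
open import Relation.Nullary.Decidable using (yes; no; ¬?)
open import Relation.Nullary.Negation using (contradiction)
open import Relation.Nullary.Reflects using (Reflects; ofʸ; ofⁿ)
open import Data.List.Membership.DecPropositional _≟_ using (_∈?_)

-- Stack programs

-- The machine does not know the space of the run: `P` occurs only in the analysis, where all stacks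
-- are shown to stay within height `4 * P`. Time is free, so the code is read again for every entry
-- of an environment. What follows an occurrence in the code is what follows the nearest enclosing
-- function part of an application, if there is one. The KAM enters such a part only through its
-- application, whose left address is at least the size of the part. Closures may be resumed much
-- later, so this history has to be an invariant (`Seen`) of every occurrence in the state. Two
-- further invariants (`GoodEnv`) spare the machine all variable names. The binder of an entry is
-- the one that the code itself records for that variable, so that free variables are recognised by
-- comparing addresses. The names in an environment are distinct free variables of its term, so that
-- at a variable the environment consists of just the entry that is looked up, and no search is
-- made.

data Input : Set where
  edge : List CodeSymbol → Input
  _▹_  : List CodeSymbol → List CodeSymbol → Input

infix 4.5 _▹_

read : Input → Maybe CodeSymbol
read (edge w)  = nothing
read (ls ▹ rs) = head rs

-- The blank after the code is `ls ▹ []`, so that only the blank before it needs the constructor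
-- `edge`. The head is held back at both ends, in agreement with `moveInput`.
shift : Move → Input → Input
shift left  (edge w)        = edge w
shift left  ([] ▹ rs)       = edge rs
shift left  (x ∷ ls ▹ rs)   = ls ▹ x ∷ rs
shift stay  h               = h
shift right (edge w)        = [] ▹ w
shift right (ls ▹ [])       = ls ▹ []
shift right (ls ▹ x ∷ rs)   = x ∷ ls ▹ rs

Stacks : ℕ → Set
Stacks K = Vec (List WorkSymbol) K

Memory : ℕ → Set
Memory K = Input × Stacks K

top : ∀ {K} → Stacks K → Fin K → Maybe WorkSymbol
top σ i = head (Vec.lookup σ i)

record Test (K : ℕ) : Set where
  constructor test
  field
    stack : Fin K
    holds : Maybe CodeSymbol → Maybe WorkSymbol → Bool

⟦_⟧ : ∀ {K} → Test K → Memory K → Bool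
⟦ test i f ⟧ (h , σ) = f (read h) (top σ i)

infixr 4 _⨾_

-- In `push i j g` the new symbol is computed from the top of stack `j`; this is the only way in
-- which symbols travel between stacks.
data Cmd (K : ℕ) : Set where
  push    : Fin K → Fin K → (Maybe WorkSymbol → WorkSymbol) → Cmd K
  pop     : Fin K → Cmd K
  moveIn  : Move → Cmd K
  _⨾_     : Cmd K → Cmd K → Cmd K
  cond    : Test K → Cmd K → Cmd K → Cmd K
  while   : Test K → Cmd K → Cmd K

-- c ⊢[ H ] s ⇓ s′: from s, the program c ends in s′ without any stack
-- growing beyond height H.
infix 3 _⊢[_]_⇓_

data _⊢[_]_⇓_ {K : ℕ} : Cmd K → ℕ → Memory K → Memory K → Set where
  push   : ∀ {H i j g h σ} → length (Vec.lookup σ i) < H →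
           push i j g ⊢[ H ] h , σ ⇓ h , σ [ i ]≔ (g (top σ j) ∷ Vec.lookup σ i)
  pop    : ∀ {H i h σ x xs} → Vec.lookup σ i ≡ x ∷ xs →
           pop i ⊢[ H ] h , σ ⇓ h , σ [ i ]≔ xs
  moveIn : ∀ {H m h σ} → moveIn m ⊢[ H ] h , σ ⇓ shift m h , σ
  _⨾_    : ∀ {H c d s s′ s″} → c ⊢[ H ] s ⇓ s′ → d ⊢[ H ] s′ ⇓ s″ → c ⨾ d ⊢[ H ] s ⇓ s″
  ifYes  : ∀ {H t c d s s′} → ⟦ t ⟧ s ≡ true → c ⊢[ H ] s ⇓ s′ → cond t c d ⊢[ H ] s ⇓ s′
  ifNo   : ∀ {H t c d s s′} → ⟦ t ⟧ s ≡ false → d ⊢[ H ] s ⇓ s′ → cond t c d ⊢[ H ] s ⇓ s′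
  done   : ∀ {H t c s} → ⟦ t ⟧ s ≡ false → while t c ⊢[ H ] s ⇓ s
  loop   : ∀ {H t c s s′ s″} → ⟦ t ⟧ s ≡ true → c ⊢[ H ] s ⇓ s′ →
           while t c ⊢[ H ] s′ ⇓ s″ → while t c ⊢[ H ] s ⇓ s″

-- Compilation to Turing machines

-- A push takes two machine steps, because the head has to move left before it writes. The symbol to
-- be written depends on the cells scanned before that move and is kept in the control, whence
-- `⊤ ⊎ WorkSymbol`.
Pos : ∀ {K} → Cmd K → Set
Pos (push i j g) = ⊤ ⊎ WorkSymbol
Pos (pop i)      = ⊤
Pos (moveIn m)   = ⊤
Pos (c ⨾ d)      = Pos c ⊎ Pos d
Pos (cond t c d) = ⊤ ⊎ (Pos c ⊎ Pos d)
Pos (while t c)  = ⊤ ⊎ Pos c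

-- Finiteness of the control and the transition function.

workSymbol↔Fin : WorkSymbol ↔ Fin 6
workSymbol↔Fin = mk↔ₛ′ to from to∘from from∘to
  where
  to : WorkSymbol → Fin 6
  to (bitʷ zero)       = zero
  to (bitʷ (suc zero)) = suc zero
  to ⟦ʷ                = suc (suc zero)
  to ←ʷ                = suc (suc (suc zero))
  to ⟧ʷ                = suc (suc (suc (suc zero)))
  to endʷ              = suc (suc (suc (suc (suc zero))))

  from : Fin 6 → WorkSymbol
  from zero                                     = bitʷ zero
  from (suc zero)                               = bitʷ (suc zero)
  from (suc (suc zero))                         = ⟦ʷ
  from (suc (suc (suc zero)))                   = ←ʷ
  from (suc (suc (suc (suc zero))))             = ⟧ʷ
  from (suc (suc (suc (suc (suc zero)))))       = endʷ

  to∘from : ∀ i → to (from i) ≡ i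
  to∘from zero                               = refl
  to∘from (suc zero)                         = refl
  to∘from (suc (suc zero))                   = refl
  to∘from (suc (suc (suc zero)))             = refl
  to∘from (suc (suc (suc (suc zero))))       = refl
  to∘from (suc (suc (suc (suc (suc zero))))) = refl

  from∘to : ∀ x → from (to x) ≡ x
  from∘to (bitʷ zero)       = refl
  from∘to (bitʷ (suc zero)) = refl
  from∘to ⟦ʷ                = refl
  from∘to ←ʷ                = refl
  from∘to ⟧ʷ                = refl
  from∘to endʷ              = refl

Finite : Set → Set
Finite A = ∃ λ n → A ↔ Fin n

finite-⊤ : Finite ⊤
finite-⊤ = 1 , ↔-sym 1↔⊤

finite-⊎ : ∀ {A B} → Finite A → Finite B → Finite (A ⊎ B)
finite-⊎ (m , f) (n , g) = m + n , ↔-trans (f ⊎-↔ g) (↔-sym +↔⊎)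

finite-Pos : ∀ {K} (c : Cmd K) → Finite (Pos c)
finite-Pos (push i j g) = finite-⊎ finite-⊤ (6 , workSymbol↔Fin)
finite-Pos (pop i)      = finite-⊤
finite-Pos (moveIn m)   = finite-⊤
finite-Pos (c ⨾ d)      = finite-⊎ (finite-Pos c) (finite-Pos d)
finite-Pos (cond t c d) = finite-⊎ finite-⊤ (finite-⊎ (finite-Pos c) (finite-Pos d))
finite-Pos (while t c)  = finite-⊎ finite-⊤ (finite-Pos c)

entry : ∀ {K} (c : Cmd K) → Pos c
entry (push i j g) = inj₁ tt
entry (pop i)      = tt
entry (moveIn m)   = tt
entry (c ⨾ d)      = inj₁ (entry c)
entry (cond t c d) = inj₁ tt
entry (while t c)  = inj₁ tt

Heads : ℕ → Set
Heads K = Vec (Maybe WorkSymbol) K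

Actions : ℕ → Set
Actions K = Vec (Maybe WorkSymbol × Move) K

idle : ∀ {K} → Heads K → Actions K
idle = Vec.map (_, stay)

onStack : ∀ {K} → Fin K → Maybe WorkSymbol × Move → Heads K → Actions K
onStack i a v = idle v [ i ]≔ a

thenGoTo : ∀ {A B : Set} → (A → B) → Maybe B → Maybe A → Maybe B
thenGoTo f q = Maybe.maybe (just ∘ f) q

-- nothing is the exit of the program.
advance : ∀ {K} (c : Cmd K) → Pos c → Maybe CodeSymbol → Heads K →
       Maybe (Pos c) × Move × Actions K
advance (push i j g) (inj₁ tt) a v =
  just (inj₂ (g (Vec.lookup v j))) , stay , onStack i (Vec.lookup v i , left) v
advance (push i j g) (inj₂ x)  a v = nothing , stay , onStack i (just x , stay) v
advance (pop i)      tt        a v = nothing , stay , onStack i (nothing , right) v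
advance (moveIn m)   tt        a v = nothing , m , idle v
advance (c ⨾ d) (inj₁ p) a v = map₁ (thenGoTo inj₁ (just (inj₂ (entry d)))) (advance c p a v)
advance (c ⨾ d) (inj₂ p) a v = map₁ (thenGoTo inj₂ nothing) (advance d p a v)
advance (cond (test i f) c d) (inj₁ tt) a v =
  just (inj₂ (if f a (Vec.lookup v i) then inj₁ (entry c) else inj₂ (entry d))) , stay , idle v
advance (cond t c d) (inj₂ (inj₁ p)) a v = map₁ (thenGoTo (inj₂ ∘ inj₁) nothing) (advance c p a v)
advance (cond t c d) (inj₂ (inj₂ p)) a v = map₁ (thenGoTo (inj₂ ∘ inj₂) nothing) (advance d p a v)
advance (while (test i f) c) (inj₁ tt) a v =
  (if f a (Vec.lookup v i) then just (inj₂ (entry c)) else nothing) , stay , idle v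
advance (while t c) (inj₂ p) a v = map₁ (thenGoTo inj₂ (just (inj₁ tt))) (advance c p a v)

forever : ∀ {K} → Fin K → Cmd K → Cmd K
forever i c = while (test i λ _ _ → true) c

machine : ∀ {K} → Cmd K → TM K CodeSymbol WorkSymbol
machine c = record
  { Control = Pos c
  ; finite  = finite-Pos c
  ; start   = entry c
  ; δ       = λ p a v → Maybe.map (_, proj₂ (advance c p a v)) (proj₁ (advance c p a v))
  }

-- The head is on the top of the stack, below which one blank cell is kept; the
-- blanks on the left are the cells visited when the stack was higher.

stackTape : ℕ → List WorkSymbol → Tape WorkSymbol
stackTape n []       = tape (replicate n nothing) nothing []
stackTape n (x ∷ xs) = tape (replicate n nothing) (just x) (map just xs ++ nothing ∷ [])

scanned-stackTape : ∀ n xs → scanned (stackTape n xs) ≡ head xs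
scanned-stackTape n []       = refl
scanned-stackTape n (x ∷ xs) = refl

rest-stackTape : ∀ n xs → scanned (stackTape n xs) ∷ rights (stackTape n xs) ≡ map just xs ++
    nothing ∷ []
rest-stackTape n []       = refl
rest-stackTape n (x ∷ xs) = refl

lefts-stackTape : ∀ n xs → lefts (stackTape n xs) ≡ replicate n nothing
lefts-stackTape n []       = refl
lefts-stackTape n (x ∷ xs) = refl

replicate-ʳ++ : ∀ {A : Set} n (a : A) xs → replicate n a ʳ++ xs ≡ replicate n a ++ xs
replicate-ʳ++ zero    a xs = refl
replicate-ʳ++ (suc n) a xs = trans (replicate-ʳ++ n a (a ∷ xs)) (shuffle n)
  where
  shuffle : ∀ m → replicate m a ++ a ∷ xs ≡ a ∷ replicate m a ++ xs
  shuffle zero    = refl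
  shuffle (suc m) = cong (a ∷_) (shuffle m)

contents-stackTape : ∀ n xs → contents (stackTape n xs) ≡ replicate n nothing ++ map just xs ++
    nothing ∷ []
contents-stackTape n xs = trans
  (cong₂ _ʳ++_ (lefts-stackTape n xs) (rest-stackTape n xs))
  (replicate-ʳ++ n nothing _)

-- The sum `blanks + length xs` is the greatest height reached so far: a pop turns a symbol into a
-- blank, and a push uses up a blank when there is one. Bounding this sum therefore bounds the
-- visited cells, whose number never decreases.
record Holdsᴴ (H : ℕ) (τ : Tape WorkSymbol) (xs : List WorkSymbol) : Set where
  constructor mkHolds
  field
    blanks  : ℕ
    isStack : τ ≡ stackTape blanks xs
    bounded : blanks + length xs ≤ H

holdsᴴ⇒holds : ∀ {H τ xs} → Holdsᴴ H τ xs → Holds τ xs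
holdsᴴ⇒holds {xs = xs} (mkHolds n refl _) = n , 1 , contents-stackTape n xs

holdsᴴ-cells : ∀ {H τ xs} → Holdsᴴ H τ xs → length (contents τ) ≤ suc H
holdsᴴ-cells {H} {τ} {xs} (mkHolds n refl n+xs≤H) = begin
  length (contents (stackTape n xs))
    ≡⟨ cong length (contents-stackTape n xs) ⟩
  length (replicate n nothing ++ map just xs ++ nothing ∷ [])
    ≡⟨ length-++ (replicate n nothing) ⟩
  length (replicate n nothing) + length (map just xs ++ nothing ∷ [])
    ≡⟨ cong₂ _+_ (length-replicate n) (length-++ (map just xs)) ⟩
  n + (length (map just xs) + 1)
    ≡⟨ cong (λ l → n + (l + 1)) (length-map just xs) ⟩
  n + (length xs + 1)
    ≡⟨ +-assoc n _ 1 ⟨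
  n + length xs + 1
    ≡⟨ +-comm _ 1 ⟩
  suc (n + length xs)
    ≤⟨ s≤s n+xs≤H ⟩
  suc H ∎
  where open ≤-Reasoning

holdsᴴ-scanned : ∀ {H τ xs} → Holdsᴴ H τ xs → scanned τ ≡ head xs
holdsᴴ-scanned {xs = xs} (mkHolds n refl _) = scanned-stackTape n xs

holdsᴴ-blank : ∀ {H} → Holdsᴴ H blankTape []
holdsᴴ-blank = mkHolds 0 refl z≤n

holdsᴴ-pop : ∀ {H τ x xs} → Holdsᴴ H τ (x ∷ xs) → Holdsᴴ H (updateTape τ (nothing , right)) xs
holdsᴴ-pop {H} {x = x} {xs} (mkHolds n refl b) =
  mkHolds (suc n) (popped xs) (subst (_≤ H) (+-suc n (length xs)) b)
  where
  popped : ∀ xs → updateTape (stackTape n (x ∷ xs)) (nothing , right) ≡ stackTape (suc n) xs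
  popped []       = refl
  popped (_ ∷ _)  = refl

holdsᴴ-push : ∀ {H τ xs} x → Holdsᴴ H τ xs → length xs < H →
              Holdsᴴ H (updateTape (updateTape τ (scanned τ , left)) (just x , stay)) (x ∷ xs)
-- No blank is left, so a new cell is visited. Only here does the greatest height increase, and the
-- bound has to come from `xs<H`; in the other case it is inherited from `b`.
holdsᴴ-push {H} {xs = xs} x (mkHolds zero refl b) xs<H = mkHolds 0 (pushed xs) xs<H
  where
  pushed : ∀ xs → updateTape (updateTape (stackTape 0 xs) (scanned (stackTape 0 xs) , left))
      (just x , stay)
                  ≡ stackTape 0 (x ∷ xs)
  pushed []       = refl
  pushed (_ ∷ _)  = refl
holdsᴴ-push {H} {xs = xs} x (mkHolds (suc n) refl b) xs<H =
  mkHolds n (pushed xs) (subst (_≤ H) (sym (+-suc n (length xs))) b)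
  where
  pushed : ∀ xs → updateTape
      (updateTape (stackTape (suc n) xs) (scanned (stackTape (suc n) xs) , left)) (just x , stay)
                  ≡ stackTape n (x ∷ xs)
  pushed []       = refl
  pushed (_ ∷ _)  = refl

-- The input head

position : Input → ℕ
position (edge w)  = 0
position (ls ▹ rs) = suc (length ls)

word : Input → List CodeSymbol
word (edge w)  = w
word (ls ▹ rs) = ls ʳ++ rs

word-shift : ∀ m h → word (shift m h) ≡ word h
word-shift left  (edge w)        = refl
word-shift left  ([] ▹ rs)       = refl
word-shift left  (x ∷ ls ▹ rs)   = refl
word-shift stay  h               = refl
word-shift right (edge w)        = refl
word-shift right (ls ▹ [])       = refl
word-shift right (ls ▹ x ∷ rs)   = refl

position-shift : ∀ m h → moveInput (word h) m (position h) ≡ position (shift m h)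
position-shift left  (edge w)        = refl
position-shift left  ([] ▹ rs)       = refl
position-shift left  (x ∷ ls ▹ rs)   = refl
position-shift stay  h               = refl
position-shift right (edge w)        = refl
position-shift right (ls ▹ [])       = cong suc (begin
  suc (length ls) ⊓ length (ls ʳ++ [])  ≡⟨ cong (suc (length ls) ⊓_)
      (trans (length-ʳ++ ls) (+-identityʳ _)) ⟩
  suc (length ls) ⊓ length ls           ≡⟨ m≥n⇒m⊓n≡n (n≤1+n _) ⟩
  length ls                             ∎)
  where open ≡-Reasoning
position-shift right (ls ▹ x ∷ rs)   = cong suc (m≤n⇒m⊓n≡m (begin
  suc (length ls)              ≤⟨ m≤m+n _ _ ⟩
  suc (length ls) + length rs  ≡⟨ +-suc _ _ ⟨
  length ls + suc (length rs)  ≡⟨ length-ʳ++ ls ⟨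
  length (ls ʳ++ x ∷ rs)       ∎))
  where open ≤-Reasoning

read-position : ∀ h → readInput (word h) (position h) ≡ read h
read-position (edge w)  = refl
read-position (ls ▹ rs) = cong head
    (trans (cong (λ n → drop n (ls ʳ++ rs)) (sym (+-identityʳ (length ls)))) (drop-ʳ++ ls rs 0))
  where
  drop-ʳ++ : ∀ (xs ys : List CodeSymbol) n → drop (length xs + n) (xs ʳ++ ys) ≡ drop n ys
  drop-ʳ++ []       ys n = refl
  drop-ʳ++ (x ∷ xs) ys n = begin
    drop (suc (length xs + n)) (xs ʳ++ x ∷ ys) ≡⟨ cong (λ m → drop m (xs ʳ++ x ∷ ys))
        (+-suc (length xs) n) ⟨
    drop (length xs + suc n) (xs ʳ++ x ∷ ys)   ≡⟨ drop-ʳ++ xs (x ∷ ys) (suc n) ⟩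
    drop n ys                                  ∎
    where open ≡-Reasoning

-- Correctness of the compilation

module Simulation {K : ℕ} (M : TM K CodeSymbol WorkSymbol) (ready : TM.Control M → Bool)
                  (w : List CodeSymbol) (H : ℕ) where

  record Simulates (p : ℕ) (τs : Vec (Tape WorkSymbol) K) (s : Memory K) : Set where
    constructor mkSimulates
    field
      head-at : p ≡ position (proj₁ s)
      code    : w ≡ word (proj₁ s)
      tapes   : ∀ i → Holdsᴴ H (Vec.lookup τs i) (Vec.lookup (proj₂ s) i)

  open Simulates public

  -- Since every source of a step is required not to be ready, paths can be concatenated without
  -- passing a ready configuration. The start of a whole round may itself be ready, which is why
  -- `nextReady` takes its first step separately.
  _↦_ : Config M → Config M → Set
  c ↦ c′ = step M w c ≡ just c′ × ready (Config.control c) ≡ false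

  nextReady : ∀ {c c₁ c′} → step M w c ≡ just c₁ → Star _↦_ c₁ c′ →
              ready (Config.control c′) ≡ true → NextReady M ready w c c′
  nextReady st ε                r = now st r
  nextReady st ((st₁ , nr) ◅ p) r = later st nr (nextReady st₁ p r)

  nextReady⁺ : ∀ {c c′} → ready (Config.control c) ≡ false → Star _↦_ c c′ →
               ready (Config.control c′) ≡ true → NextReady M ready w c c′
  nextReady⁺ nr ε              r = contradiction (trans (sym r) nr) λ ()
  nextReady⁺ nr ((st , _) ◅ p) r = nextReady st p r

  Reaches : Config M → TM.Control M → Memory K → Set
  Reaches c q s = ∃₂ λ p τs → Simulates p τs s × Star _↦_ c (config q p τs)

  -- The map `κ` places the positions of a subprogram in the control of the fixed machine `M`, and
  -- `κ nothing` is where control goes on its exit. Induction on programs then varies `κ` only, and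
  -- never the machine.
  Embedding : (c : Cmd K) → (Maybe (Pos c) → TM.Control M) → Set
  Embedding c κ = ∀ q →
    ready (κ (just q)) ≡ false ×
    (∀ a v → TM.δ M (κ (just q)) a v ≡ just (κ (proj₁ (advance c q a v)) , proj₂ (advance c q a v)))

  scanned-simulates : ∀ {p τs h σ} → Simulates p τs (h , σ) →
                      ∀ i → Vec.lookup (Vec.map scanned τs) i ≡ top σ i
  scanned-simulates {τs = τs} S i = trans (lookup-map i scanned τs) (holdsᴴ-scanned (tapes S i))

  lookup-update : ∀ (τs : Vec (Tape WorkSymbol) K) as i →
    Vec.lookup (Vec.zipWith updateTape τs as) i ≡ updateTape (Vec.lookup τs i) (Vec.lookup as i)
  lookup-update τs as i = lookup-zipWith updateTape i τs as

  idle-tape : ∀ (τs : Vec (Tape WorkSymbol) K) i →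
    Vec.lookup (Vec.zipWith updateTape τs (idle (Vec.map scanned τs))) i ≡ Vec.lookup τs i
  idle-tape τs i = begin
    Vec.lookup (Vec.zipWith updateTape τs (idle (Vec.map scanned τs))) i
      ≡⟨ lookup-update τs _ i ⟩
    updateTape (Vec.lookup τs i) (Vec.lookup (idle (Vec.map scanned τs)) i)
      ≡⟨ cong (updateTape (Vec.lookup τs i)) {y = scanned (Vec.lookup τs i) , stay}
          (trans (lookup-map i (_, stay) (Vec.map scanned τs))
          (cong (_, stay) (lookup-map i scanned τs))) ⟩
    Vec.lookup τs i ∎
    where open ≡-Reasoning

  onStack-same : ∀ (τs : Vec (Tape WorkSymbol) K) i a v →
    Vec.lookup (Vec.zipWith updateTape τs (onStack i a v)) i ≡ updateTape (Vec.lookup τs i) a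
  onStack-same τs i a v = trans (lookup-update τs _ i)
      (cong (updateTape (Vec.lookup τs i)) (lookup∘update i (idle v) a))

  onStack-other : ∀ (τs : Vec (Tape WorkSymbol) K) i a j → j ≢ i →
    Vec.lookup (Vec.zipWith updateTape τs (onStack i a (Vec.map scanned τs))) j ≡ Vec.lookup τs j
  onStack-other τs i a j j≢i = trans (lookup-update τs _ j)
    (trans (cong (updateTape (Vec.lookup τs j)) (lookup∘update′ j≢i (idle (Vec.map scanned τs)) a))
    (trans (sym (lookup-update τs _ j)) (idle-tape τs j)))

  step-simulates : ∀ c κ → Embedding c κ → ∀ q {p τs q′ m as} →
    advance c q (readInput w p) (Vec.map scanned τs) ≡ (q′ , m , as) →
    config (κ (just q)) p τs ↦ config (κ q′) (moveInput w m p) (Vec.zipWith updateTape τs as)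
  step-simulates c κ emb q {p} {τs} eq with emb q
  ... | nr , δ≡ rewrite δ≡ (readInput w p) (Vec.map scanned τs) | eq = refl , nr

  read-simulates : ∀ {p τs h σ} → Simulates p τs (h , σ) → readInput w p ≡ read h
  read-simulates {h = h} (mkSimulates refl refl _) = read-position h

  move-simulates : ∀ {p τs τs′ h σ σ′} m → Simulates p τs (h , σ) →
    (∀ i → Holdsᴴ H (Vec.lookup τs′ i) (Vec.lookup σ′ i)) →
    Simulates (moveInput w m p) τs′ (shift m h , σ′)
  move-simulates {h = h} m (mkSimulates refl refl _) ts =
    mkSimulates (position-shift m h) (sym (word-shift m h)) ts

  idle-simulates : ∀ {p τs h σ} m → Simulates p τs (h , σ) →
    Simulates (moveInput w m p) (Vec.zipWith updateTape τs (idle (Vec.map scanned τs)))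
        (shift m h , σ)
  idle-simulates {τs = τs} m S =
    move-simulates m S λ i → subst (λ τ → Holdsᴴ H τ _) (sym (idle-tape τs i)) (tapes S i)

  reaches-trans : ∀ {c q q′ s s′} → Reaches c q s →
    (∀ {p τs} → Simulates p τs s → Reaches (config q p τs) q′ s′) → Reaches c q′ s′
  reaches-trans (p , τs , S , steps) k with k S
  ... | p′ , τs′ , S′ , steps′ = p′ , τs′ , S′ , steps ◅◅ steps′

  reaches-step : ∀ {c c′ q s} → c ↦ c′ → Reaches c′ q s → Reaches c q s
  reaches-step st (p , τs , S , steps) = p , τs , S , st ◅ steps

  reaches-here : ∀ {q p τs s} → Simulates p τs s → Reaches (config q p τs) q s
  reaches-here S = _ , _ , S , ε

  stackwise : ∀ (τs : Vec (Tape WorkSymbol) K) σ i xs →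
    Holdsᴴ H (Vec.lookup τs i) xs →
    (∀ j → j ≢ i → Holdsᴴ H (Vec.lookup τs j) (Vec.lookup σ j)) →
    ∀ j → Holdsᴴ H (Vec.lookup τs j) (Vec.lookup (σ [ i ]≔ xs) j)
  stackwise τs σ i xs hi hj j with j ≟ᶠ i
  ... | yes refl = subst (Holdsᴴ H _) (sym (lookup∘update i σ xs)) hi
  ... | no  j≢i  = subst (Holdsᴴ H _) (sym (lookup∘update′ j≢i σ xs)) (hj j j≢i)

  cond-simulates : ∀ (t : Test K) c d {b p τs s} → ⟦ t ⟧ s ≡ b → Simulates p τs s →
    advance (cond t c d) (inj₁ tt) (readInput w p) (Vec.map scanned τs)
    ≡ (just (inj₂ (if b then inj₁ (entry c) else inj₂ (entry d))) , stay , idle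
        (Vec.map scanned τs))
  cond-simulates (test i f) c d refl S rewrite read-simulates S | scanned-simulates S i = refl

  while-simulates : ∀ (t : Test K) c {b p τs s} → ⟦ t ⟧ s ≡ b → Simulates p τs s →
    advance (while t c) (inj₁ tt) (readInput w p) (Vec.map scanned τs)
    ≡ ((if b then just (inj₂ (entry c)) else nothing) , stay , idle (Vec.map scanned τs))
  while-simulates (test i f) c refl S rewrite read-simulates S | scanned-simulates S i = refl

  -- By induction on the evaluation rather than on the program: after an iteration of a loop,
  -- control is back at the test, and the remaining evaluation of the same loop is a smaller
  -- derivation.
  simulate : ∀ (c : Cmd K) (κ : Maybe (Pos c) → TM.Control M) → Embedding c κ →
    ∀ {s s′} → c ⊢[ H ] s ⇓ s′ → ∀ {p τs} → Simulates p τs s →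
    Reaches (config (κ (just (entry c))) p τs) (κ nothing) s′
  simulate (push i j g) κ emb {h , σ} (push {i = i} {j} {g} bound) {p} {τs} S =
    reaches-step (step-simulates (push i j g) κ emb (inj₁ tt) refl)
      (reaches-step (step-simulates (push i j g) κ emb (inj₂ x) refl) (reaches-here
        (mkSimulates (head-at S) (code S)
          (stackwise τs₂ σ i _ pushed λ l l≢i →
              subst (λ τ → Holdsᴴ H τ _) (sym (other l l≢i)) (tapes S l)))))
    where
    v   = Vec.map scanned τs
    τs₁ = Vec.zipWith updateTape τs (onStack i (Vec.lookup v i , left) v)
    v₁  = Vec.map scanned τs₁
    x   = g (Vec.lookup v j)
    τs₂ = Vec.zipWith updateTape τs₁ (onStack i (just x , stay) v₁)

    other : ∀ l → l ≢ i → Vec.lookup τs₂ l ≡ Vec.lookup τs l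
    other l l≢i = trans (onStack-other τs₁ i _ l l≢i) (onStack-other τs i _ l l≢i)

    pushed-tape : Vec.lookup τs₂ i ≡
           updateTape (updateTape (Vec.lookup τs i) (scanned (Vec.lookup τs i) , left))
                      (just (g (top σ j)) , stay)
    pushed-tape = trans (onStack-same τs₁ i _ v₁) (cong₂ (λ τ y → updateTape τ (just y , stay))
      (trans (onStack-same τs i _ v)
          (cong (λ a → updateTape (Vec.lookup τs i) (a , left)) (lookup-map i scanned τs)))
      (cong g (scanned-simulates S j)))

    pushed : Holdsᴴ H (Vec.lookup τs₂ i) (g (top σ j) ∷ Vec.lookup σ i)
    pushed = subst (λ τ → Holdsᴴ H τ _) (sym pushed-tape) (holdsᴴ-push _ (tapes S i) bound)
  simulate (pop i) κ emb {h , σ} (pop {xs = xs} eq) {p} {τs} S =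
    reaches-step (step-simulates (pop i) κ emb tt refl) (reaches-here
      (mkSimulates (head-at S) (code S)
        (stackwise (Vec.zipWith updateTape τs (onStack i (nothing , right) (Vec.map scanned τs))) σ
            i xs
          (subst (λ τ → Holdsᴴ H τ xs) (sym (onStack-same τs i _ (Vec.map scanned τs)))
            (holdsᴴ-pop (subst (Holdsᴴ H _) eq (tapes S i))))
          λ l l≢i → subst (λ τ → Holdsᴴ H τ _) (sym (onStack-other τs i _ l l≢i)) (tapes S l))))
  simulate (moveIn m) κ emb {h , σ} moveIn {p} {τs} S =
    reaches-step (step-simulates (moveIn m) κ emb tt refl) (reaches-here (idle-simulates m S))
  simulate (c ⨾ d) κ emb (ec ⨾ ed) S =
    reaches-trans (simulate c (κ ∘ thenGoTo inj₁ (just (inj₂ (entry d)))) (emb ∘ inj₁) ec S)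
                  (simulate d (κ ∘ thenGoTo inj₂ nothing) (emb ∘ inj₂) ed)
  simulate (cond t c d) κ emb (ifYes t≡ ec) S =
    reaches-step (step-simulates (cond t c d) κ emb (inj₁ tt) (cond-simulates t c d t≡ S))
      (simulate c (κ ∘ thenGoTo (inj₂ ∘ inj₁) nothing) (emb ∘ inj₂ ∘ inj₁) ec
          (idle-simulates stay S))
  simulate (cond t c d) κ emb (ifNo t≡ ed) S =
    reaches-step (step-simulates (cond t c d) κ emb (inj₁ tt) (cond-simulates t c d t≡ S))
      (simulate d (κ ∘ thenGoTo (inj₂ ∘ inj₂) nothing) (emb ∘ inj₂ ∘ inj₂) ed
          (idle-simulates stay S))
  simulate (while t c) κ emb (done t≡) S =
    reaches-step (step-simulates (while t c) κ emb (inj₁ tt) (while-simulates t c t≡ S))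
        (reaches-here (idle-simulates stay S))
  simulate (while t c) κ emb (loop t≡ ec ew) S =
    reaches-step (step-simulates (while t c) κ emb (inj₁ tt) (while-simulates t c t≡ S))
      (reaches-trans (simulate c (κ ∘ thenGoTo inj₂ (just (inj₁ tt))) (emb ∘ inj₂) ec
          (idle-simulates stay S))
                     (simulate (while t c) κ emb ew))

-- Moving and copying stacks

Pred : Set
Pred = Maybe WorkSymbol → Bool

present isBit notEnd isZero isOne : Pred
present nothing  = false
present (just _) = true
isBit (just (bitʷ _)) = true
isBit _               = false
notEnd nothing     = false
notEnd (just endʷ) = false
notEnd (just _)    = true
isZero (just (bitʷ zero)) = true
isZero _                  = false
isOne (just (bitʷ (suc zero))) = true
isOne _                        = false

All′ : Pred → List WorkSymbol → Set
All′ p = All (λ x → p (just x) ≡ true)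

onTop : ∀ {K} → Fin K → Pred → Test K
onTop i p = test i λ _ → p

skip : ∀ {K} → Cmd K
skip = moveIn stay

put : ∀ {K} → Fin K → WorkSymbol → Cmd K
put i x = push i i λ _ → x

topOf : (WorkSymbol → WorkSymbol) → Maybe WorkSymbol → WorkSymbol
topOf g = Maybe.maybe g endʷ

clear : ∀ {K} → Pred → Fin K → Cmd K
clear p i = while (onTop i p) (pop i)

moveBy : ∀ {K} → (WorkSymbol → WorkSymbol) → Pred → Fin K → Fin K → Cmd K
moveBy g p i j = while (onTop i p) (push j i (topOf g) ⨾ pop i)

move : ∀ {K} → Pred → Fin K → Fin K → Cmd K
move = moveBy id

-- Moving a stack reverses it, so a copy is made by moving the symbols to an auxiliary stack and
-- then back; the second move restores the order and writes to the source and the target at once.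
copyBack : ∀ {K} → Fin K → Fin K → Fin K → Cmd K
copyBack i j l = while (onTop j present) (push i j (topOf id) ⨾ push l j (topOf id) ⨾ pop j)

copy : ∀ {K} → Pred → Fin K → Fin K → Fin K → Cmd K
copy p j i l = move p i j ⨾ copyBack i j l

conv : ∀ {K H h h′} {c : Cmd K} {σ σ′ τ τ′} → σ ≡ σ′ → τ ≡ τ′ →
       c ⊢[ H ] h , σ ⇓ h′ , τ → c ⊢[ H ] h , σ′ ⇓ h′ , τ′
conv refl refl e = e

clear-spec : ∀ {K H h} {σ : Stacks K} {p i} xs {ys} → Vec.lookup σ i ≡ xs ++ ys →
  All′ p xs → p (head ys) ≡ false → clear p i ⊢[ H ] h , σ ⇓ h , σ [ i ]≔ ys
clear-spec {σ = σ} {p} {i} [] {ys} eq [] ¬p =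
  conv refl (trans (sym ([]≔-lookup σ i)) (cong (σ [ i ]≔_) eq))
      (done (trans (cong (p ∘ head) eq) ¬p))
clear-spec {σ = σ} {p} {i} (x ∷ xs) {ys} eq (px ∷ pxs) ¬p =
  loop (trans (cong (p ∘ head) eq) px) (pop eq)
    (conv refl ([]≔-idempotent σ i) (clear-spec xs (lookup∘update i σ _) pxs ¬p))

-- For variable indices, lookups and updates do not reduce. Loops that affect two stacks only are
-- analysed in the normal form `two xs ys`, so that the chain of updates does not grow with the
-- iterations.
module Two {K : ℕ} (σ : Stacks K) {i j : Fin K} (i≢j : i ≢ j) where

  two : List WorkSymbol → List WorkSymbol → Stacks K
  two xs ys = (σ [ i ]≔ xs) [ j ]≔ ys

  get₁ : ∀ xs ys → Vec.lookup (two xs ys) i ≡ xs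
  get₁ xs ys = trans (lookup∘update′ i≢j (σ [ i ]≔ xs) ys) (lookup∘update i σ xs)

  get₂ : ∀ xs ys → Vec.lookup (two xs ys) j ≡ ys
  get₂ xs ys = lookup∘update j (σ [ i ]≔ xs) ys

  set₁ : ∀ xs ys xs′ → two xs ys [ i ]≔ xs′ ≡ two xs′ ys
  set₁ xs ys xs′ = trans (cong (_[ i ]≔ xs′) (sym ([]≔-commutes σ j i (i≢j ∘ sym))))
    (trans ([]≔-idempotent _ i) ([]≔-commutes σ j i (i≢j ∘ sym)))

  set₂ : ∀ xs ys ys′ → two xs ys [ j ]≔ ys′ ≡ two xs ys′
  set₂ xs ys ys′ = []≔-idempotent _ j

  two-lookup : ∀ {xs ys} → Vec.lookup σ i ≡ xs → Vec.lookup σ j ≡ ys → two xs ys ≡ σ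
  two-lookup refl refl =
    trans (cong (_[ j ]≔ Vec.lookup σ j) ([]≔-lookup σ i)) ([]≔-lookup σ j)

  two-drop : ∀ {xs ys} → Vec.lookup σ j ≡ ys → two xs ys ≡ σ [ i ]≔ xs
  two-drop {xs} refl = trans (cong (_ [ j ]≔_) (sym (lookup∘update′ (i≢j ∘ sym) σ xs)))
      ([]≔-lookup _ j)

  test₁ : ∀ (p : Pred) {xs ys} → p (top (two xs ys) i) ≡ p (head xs)
  test₁ p {xs} {ys} = cong (p ∘ head) (get₁ xs ys)

  module _ {H : ℕ} {h : Input} where

    put₁ : ∀ {xs ys} x → length xs < H → put i x ⊢[ H ] h , two xs ys ⇓ h , two (x ∷ xs) ys
    put₁ {xs} {ys} x bound =
      conv refl (trans (cong (λ zs → two xs ys [ i ]≔ (x ∷ zs)) (get₁ xs ys)) (set₁ xs ys _))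
        (push (subst (λ zs → length zs < H) (sym (get₁ xs ys)) bound))

    pop₁ : ∀ {x xs ys} → pop i ⊢[ H ] h , two (x ∷ xs) ys ⇓ h , two xs ys
    pop₁ {x} {xs} {ys} = conv refl (set₁ _ ys xs) (pop (get₁ (x ∷ xs) ys))

    moveBy-two : ∀ {g p} xs {ys zs} → All′ p xs → p (head ys) ≡ false →
      length (map g xs ʳ++ zs) ≤ H →
      moveBy g p i j ⊢[ H ] h , two (xs ++ ys) zs ⇓ h , two ys (map g xs ʳ++ zs)
    moveBy-two {p = p} [] [] ¬p _ = done (trans (test₁ p) ¬p)
    moveBy-two {g} {p} (x ∷ xs) {ys} {zs} (px ∷ pxs) ¬p bound =
      loop (trans (test₁ p) px)
        (conv refl eq (push (subst (λ ws → length ws < H) (sym (get₂ _ zs)) zs<H)) ⨾ pop₁)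
        (moveBy-two xs pxs ¬p bound)
      where
      eq : two (x ∷ xs ++ ys) zs [ j ]≔
          (topOf g (top (two (x ∷ xs ++ ys) zs) i) ∷ Vec.lookup (two (x ∷ xs ++ ys) zs) j)
           ≡ two (x ∷ xs ++ ys) (g x ∷ zs)
      eq = trans (cong₂ (λ us vs → two (x ∷ xs ++ ys) zs [ j ]≔ (topOf g (head us) ∷ vs))
                        (get₁ _ zs) (get₂ _ zs))
                 (set₂ _ zs _)

      zs<H : suc (length zs) ≤ H
      zs<H = begin
        suc (length zs)                      ≤⟨ m≤n+m _ _ ⟩
        length (map g xs) + suc (length zs)  ≡⟨ length-ʳ++ (map g xs) ⟨
        length (map g (x ∷ xs) ʳ++ zs)       ≤⟨ bound ⟩
        H                                    ∎
        where open ≤-Reasoning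

moveBy-spec : ∀ {K H h} {σ : Stacks K} {g p i j} xs {ys} → i ≢ j → Vec.lookup σ i ≡ xs ++ ys →
  All′ p xs → p (head ys) ≡ false → length (map g xs ʳ++ Vec.lookup σ j) ≤ H →
  moveBy g p i j ⊢[ H ] h , σ ⇓ h , (σ [ i ]≔ ys) [ j ]≔ (map g xs ʳ++ Vec.lookup σ j)
moveBy-spec {σ = σ} xs i≢j eq pxs ¬p bound =
  conv (two-lookup eq refl) refl (moveBy-two xs pxs ¬p bound)
  where open Two σ i≢j

move-spec : ∀ {K H h} {σ : Stacks K} {p i j} xs {ys} → i ≢ j → Vec.lookup σ i ≡ xs ++ ys →
  All′ p xs → p (head ys) ≡ false → length (xs ʳ++ Vec.lookup σ j) ≤ H →
  move p i j ⊢[ H ] h , σ ⇓ h , (σ [ i ]≔ ys) [ j ]≔ (xs ʳ++ Vec.lookup σ j)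
move-spec {H = H} {σ = σ} {i = i} {j} xs {ys} i≢j eq pxs ¬p bound =
  subst (λ zs → move _ i j ⊢[ H ] _ , σ ⇓ _ , (σ [ i ]≔ ys) [ j ]≔ (zs ʳ++ Vec.lookup σ j))
      (map-id xs)
    (moveBy-spec xs i≢j eq pxs ¬p
        (subst (λ zs → length (zs ʳ++ Vec.lookup σ j) ≤ H) (sym (map-id xs)) bound))

present-all : ∀ xs → All′ present xs
present-all []       = []
present-all (x ∷ xs) = refl ∷ present-all xs

copyBack-spec : ∀ {K H h} {σ : Stacks K} {i j l} xs → i ≢ j → i ≢ l → j ≢ l → Vec.lookup σ j ≡ xs →
  length (xs ʳ++ Vec.lookup σ i) ≤ H → length (xs ʳ++ Vec.lookup σ l) ≤ H →
  copyBack i j l ⊢[ H ] h , σ ⇓ h , ((σ [ j ]≔ []) [ i ]≔ (xs ʳ++ Vec.lookup σ i)) [ l ]≔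
      (xs ʳ++ Vec.lookup σ l)
copyBack-spec {σ = σ} {i} {j} {l} [] i≢j i≢l j≢l eq _ _ =
  conv refl (sym (trans (cong (λ τ → (τ [ i ]≔ _) [ l ]≔ _)
      (trans (cong (σ [ j ]≔_) (sym eq)) ([]≔-lookup σ j)))
    (trans (cong (_[ l ]≔ _) ([]≔-lookup σ i)) ([]≔-lookup σ l))))
    (done (cong (present ∘ head) eq))
copyBack-spec {H = H} {σ = σ} {i} {j} {l} (x ∷ xs) i≢j i≢l j≢l eq bᵢ bₗ =
  loop (cong (present ∘ head) eq)
    (conv refl eq₁ (push (shorter xs bᵢ)) ⨾
        (conv refl eq₂ (push (subst (λ zs → length zs < H) (sym lookup₁) (shorter xs bₗ))) ⨾
        pop lookup₂))
    (conv refl eq₃ (copyBack-spec xs i≢j i≢l j≢l (lookup∘update j σ₂ xs)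
      (subst (λ zs → length (xs ʳ++ zs) ≤ H) (sym lookup₃) bᵢ)
      (subst (λ zs → length (xs ʳ++ zs) ≤ H) (sym lookup₄) bₗ)))
  where
  shorter : ∀ xs {zs : List WorkSymbol} → length (xs ʳ++ x ∷ zs) ≤ H → length zs < H
  shorter xs {zs} b = ≤-trans (≤-trans (m≤n+m _ (length xs)) (≤-reflexive (sym (length-ʳ++ xs)))) b

  L = Vec.lookup σ l
  I = Vec.lookup σ i

  σ₁ = σ [ i ]≔ (x ∷ I)
  σ₂ = σ₁ [ l ]≔ (x ∷ L)
  σ₃ = σ₂ [ j ]≔ xs

  eq₁ : σ [ i ]≔ (topOf id (top σ j) ∷ Vec.lookup σ i) ≡ σ₁
  eq₁ = cong (λ us → σ [ i ]≔ (topOf id (head us) ∷ I)) eq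

  lookup₀ : Vec.lookup σ₁ j ≡ x ∷ xs
  lookup₀ = trans (lookup∘update′ (i≢j ∘ sym) σ _) eq

  lookup₁ : Vec.lookup σ₁ l ≡ L
  lookup₁ = lookup∘update′ (i≢l ∘ sym) σ _

  lookup₂ : Vec.lookup σ₂ j ≡ x ∷ xs
  lookup₂ = trans (lookup∘update′ j≢l σ₁ _) lookup₀

  eq₂ : σ₁ [ l ]≔ (topOf id (top σ₁ j) ∷ Vec.lookup σ₁ l) ≡ σ₂
  eq₂ = cong₂ (λ us vs → σ₁ [ l ]≔ (topOf id (head us) ∷ vs)) lookup₀ lookup₁

  lookup₃ : Vec.lookup σ₃ i ≡ x ∷ I
  lookup₃ = trans (lookup∘update′ i≢j σ₂ _) (trans (lookup∘update′ i≢l σ₁ _) (lookup∘update i σ _))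

  lookup₄ : Vec.lookup σ₃ l ≡ x ∷ L
  lookup₄ = trans (lookup∘update′ (j≢l ∘ sym) σ₂ _) (lookup∘update l σ₁ _)

  eq₃ : ((σ₃ [ j ]≔ []) [ i ]≔ (xs ʳ++ Vec.lookup σ₃ i)) [ l ]≔ (xs ʳ++ Vec.lookup σ₃ l)
        ≡ ((σ [ j ]≔ []) [ i ]≔ (xs ʳ++ x ∷ I)) [ l ]≔ (xs ʳ++ x ∷ L)
  eq₃ = begin
    ((σ₃ [ j ]≔ []) [ i ]≔ (xs ʳ++ Vec.lookup σ₃ i)) [ l ]≔ (xs ʳ++ Vec.lookup σ₃ l)
      ≡⟨ cong₂ (λ us vs → ((σ₃ [ j ]≔ []) [ i ]≔ (xs ʳ++ us)) [ l ]≔ (xs ʳ++ vs)) lookup₃ lookup₄ ⟩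
    ((σ₃ [ j ]≔ []) [ i ]≔ I′) [ l ]≔ L′
      ≡⟨ cong (λ τ → (τ [ i ]≔ I′) [ l ]≔ L′) ([]≔-idempotent σ₂ j) ⟩
    (((σ₁ [ l ]≔ _) [ j ]≔ []) [ i ]≔ I′) [ l ]≔ L′
      ≡⟨ cong (λ τ → (τ [ i ]≔ I′) [ l ]≔ L′) ([]≔-commutes σ₁ l j (j≢l ∘ sym)) ⟩
    (((σ₁ [ j ]≔ []) [ l ]≔ _) [ i ]≔ I′) [ l ]≔ L′
      ≡⟨ cong (_[ l ]≔ L′) ([]≔-commutes _ l i (i≢l ∘ sym)) ⟩
    (((σ₁ [ j ]≔ []) [ i ]≔ I′) [ l ]≔ _) [ l ]≔ L′
      ≡⟨ []≔-idempotent _ l ⟩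
    ((σ₁ [ j ]≔ []) [ i ]≔ I′) [ l ]≔ L′
      ≡⟨ cong (λ τ → (τ [ i ]≔ I′) [ l ]≔ L′) ([]≔-commutes σ i j i≢j) ⟩
    (((σ [ j ]≔ []) [ i ]≔ _) [ i ]≔ I′) [ l ]≔ L′
      ≡⟨ cong (_[ l ]≔ L′) ([]≔-idempotent _ i) ⟩
    ((σ [ j ]≔ []) [ i ]≔ I′) [ l ]≔ L′ ∎
    where
    open ≡-Reasoning
    I′ = xs ʳ++ x ∷ I
    L′ = xs ʳ++ x ∷ L

copy-spec : ∀ {K H h} {σ : Stacks K} {p i j l} xs {ys} → i ≢ j → i ≢ l → j ≢ l →
  Vec.lookup σ i ≡ xs ++ ys → Vec.lookup σ j ≡ [] → All′ p xs → p (head ys) ≡ false →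
  length (xs ++ ys) ≤ H → length (xs ++ Vec.lookup σ l) ≤ H →
  copy p j i l ⊢[ H ] h , σ ⇓ h , σ [ l ]≔ (xs ++ Vec.lookup σ l)
copy-spec {H = H} {σ = σ} {p} {i} {j} {l} xs {ys} i≢j i≢l j≢l eqᵢ eqⱼ pxs ¬p bᵢ bₗ =
  subst (λ zs → move p i j ⊢[ H ] _ , σ ⇓ _ , (σ [ i ]≔ ys) [ j ]≔ zs) (cong (xs ʳ++_) eqⱼ)
    (move-spec xs i≢j eqᵢ pxs ¬p
        (≤-trans (≤-reflexive length₁)
        (≤-trans (m≤m+n (length xs) (length ys)) (≤-trans (≤-reflexive (sym (length-++ xs))) bᵢ))))
  ⨾ conv refl eq
    (copyBack-spec (xs ʳ++ []) i≢j i≢l j≢l (lookup∘update j (σ [ i ]≔ ys) (xs ʳ++ []))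
      (subst (λ zs → length zs ≤ H) (sym rev₁) bᵢ)
      (subst (λ zs → length zs ≤ H) (sym rev₂) bₗ))
  where
  σ₁ = (σ [ i ]≔ ys) [ j ]≔ (xs ʳ++ [])

  length₁ : length (xs ʳ++ Vec.lookup σ j) ≡ length xs
  length₁ = trans (cong (λ zs → length (xs ʳ++ zs)) eqⱼ) (trans (length-ʳ++ xs) (+-identityʳ _))

  rev₁ : (xs ʳ++ []) ʳ++ Vec.lookup σ₁ i ≡ xs ++ ys
  rev₁ = trans (ʳ++-ʳ++ xs) (cong (xs ++_)
      (trans (lookup∘update′ i≢j (σ [ i ]≔ ys) _) (lookup∘update i σ ys)))

  rev₂ : (xs ʳ++ []) ʳ++ Vec.lookup σ₁ l ≡ xs ++ Vec.lookup σ l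
  rev₂ = trans (ʳ++-ʳ++ xs) (cong (xs ++_)
      (trans (lookup∘update′ (j≢l ∘ sym) (σ [ i ]≔ ys) _) (lookup∘update′ (i≢l ∘ sym) σ _)))

  eq : ((σ₁ [ j ]≔ []) [ i ]≔ ((xs ʳ++ []) ʳ++ Vec.lookup σ₁ i)) [ l ]≔
      ((xs ʳ++ []) ʳ++ Vec.lookup σ₁ l)
       ≡ σ [ l ]≔ (xs ++ Vec.lookup σ l)
  eq = cong₂ _[ l ]≔_ eq′ rev₂
    where
    eq′ : (σ₁ [ j ]≔ []) [ i ]≔ ((xs ʳ++ []) ʳ++ Vec.lookup σ₁ i) ≡ σ
    eq′ = trans (cong₂ _[ i ]≔_ ([]≔-idempotent _ j) rev₁)
         (trans (Two.set₁ σ i≢j ys [] (xs ++ ys))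
                (Two.two-lookup σ i≢j eqᵢ eqⱼ))

-- Binary counters

-- A record and not an abbreviation, so that `n` can be recovered by unification from the type of a
-- proof.
record Fits (H n : ℕ) : Set where
  constructor mkFits
  field
    fitting : length (binary n) ≤ H

open Fits public

bits : List Bit → List WorkSymbol
bits = map bitʷ

flip : WorkSymbol → WorkSymbol
flip (bitʷ zero)       = bitʷ 1b
flip (bitʷ (suc zero)) = bitʷ 0b
flip x                 = x

-- The bits that are set aside on `j` are all equal once they have been flipped, so it does no harm
-- that they come back in reverse order.
increment : ∀ {K} → Fin K → Fin K → Cmd K
increment j i =
  moveBy flip isOne i j ⨾
  cond (onTop i isZero) (pop i) skip ⨾
  put i (bitʷ 1b) ⨾
  move present j i

decrement : ∀ {K} → Fin K → Fin K → Cmd K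
decrement j i =
  moveBy flip isZero i j ⨾
  pop i ⨾
  cond (onTop i present) (put i (bitʷ 0b)) skip ⨾
  move present j i

-- The shape of consecutive binary notations.
data Carry : List Bit → List Bit → Set where
  ones : ∀ k → Carry (replicate k 1b ++ []) (replicate k 0b ++ 1b ∷ [])
  zero : ∀ k b bs → Carry (replicate k 1b ++ 0b ∷ b ∷ bs) (replicate k 0b ++ 1b ∷ b ∷ bs)

binary-carry : ∀ n → Carry (binary n) (binary (suc n))
binary-carry n = proj₂ (canonical n)
  where
  inc-nonempty : ∀ {bs bs′} → Carry bs bs′ → ∃₂ λ b cs → bs′ ≡ b ∷ cs
  inc-nonempty (ones zero)           = _ , _ , refl
  inc-nonempty (ones (suc k))        = _ , _ , refl
  inc-nonempty (zero zero b bs)      = _ , _ , refl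
  inc-nonempty (zero (suc k) b bs)   = _ , _ , refl

  carry-cons : ∀ {bs bs′} → Carry bs bs′ → Carry (1b ∷ bs) (0b ∷ bs′)
  carry-cons (ones k)      = ones (suc k)
  carry-cons (zero k b bs) = zero (suc k) b bs

  -- Incrementing a notation increments one of its suffixes, so that the
  -- invariant has to hold for all of them.
  data Suffixes : List Bit → Set where
    []  : Suffixes []
    _∷_ : ∀ {b bs} → Carry (b ∷ bs) (inc (b ∷ bs)) → Suffixes bs → Suffixes (b ∷ bs)

  carry-of : ∀ {bs} → Suffixes bs → Carry bs (inc bs)
  carry-of []      = ones 0
  carry-of (c ∷ _) = c

  suffixes-inc : ∀ {bs} → Suffixes bs → Suffixes (inc bs)
  suffixes-inc []                          = ones 1 ∷ []
  suffixes-inc (_∷_ {zero} {bs} c s)       = carry-cons (carry-of s) ∷ s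
  -- The carry leaves a zero in front of the incremented rest. This rest is non-empty and provides
  -- the further bit that `zero 0 b cs` demands after that zero.
  suffixes-inc (_∷_ {suc zero} {bs} c s) with suffixes-inc s | inc-nonempty (carry-of s)
  ... | s′ | b , cs , eq rewrite eq = zero 0 b cs ∷ s′

  canonical : ∀ n → Suffixes (binary n) × Carry (binary n) (binary (suc n))
  canonical zero    = [] , ones 0
  canonical (suc n) with canonical n
  ... | s , _ = suffixes-inc s , carry-of (suffixes-inc s)

module _ {K H : ℕ} {σ : Stacks K} {i j : Fin K} {h : Input} (i≢j : i ≢ j)
    (empty : Vec.lookup σ j ≡ []) where
  open Two σ i≢j

  private
    split : ∀ k b bs → bits (replicate k b ++ bs) ≡ replicate k (bitʷ b) ++ bits bs
    split k b bs = trans (map-++ bitʷ (replicate k b) bs)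
        (cong (_++ bits bs) (map-replicate bitʷ k b))

    move-back : ∀ k b {xs} → length (replicate k (bitʷ b) ++ xs) ≤ H →
      move present j i ⊢[ H ] h , two xs (replicate k (bitʷ b)) ⇓ h , two
          (replicate k (bitʷ b) ++ xs) []
    move-back k b {xs} bound =
      conv refl eq (move-spec (replicate k (bitʷ b)) (i≢j ∘ sym)
          (trans (get₂ xs _) (sym (++-identityʳ _)))
        (present-all _) refl (subst (λ zs → length zs ≤ H) (sym stack) bound))
      where
      stack : replicate k (bitʷ b) ʳ++ Vec.lookup (two xs (replicate k (bitʷ b))) i ≡ replicate k
          (bitʷ b) ++ xs
      stack = trans (cong (replicate k (bitʷ b) ʳ++_) (get₁ xs _)) (replicate-ʳ++ k _ xs)
      eq : (two xs (replicate k (bitʷ b)) [ j ]≔ []) [ i ]≔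
          (replicate k (bitʷ b) ʳ++ Vec.lookup (two xs (replicate k (bitʷ b))) i)
           ≡ two (replicate k (bitʷ b) ++ xs) []
      eq = trans (cong₂ _[ i ]≔_ (set₂ xs _ []) stack) (set₁ xs [] _)

    flip-away : ∀ k b {p ys} → p (just (bitʷ b)) ≡ true → p (head (bits ys)) ≡ false → k ≤ H →
      moveBy flip p i j ⊢[ H ] h , two (bits (replicate k b ++ ys)) [] ⇓ h , two (bits ys)
          (replicate k (flip (bitʷ b)))
    flip-away k b {p} {ys} pb ¬p bound =
      subst₂ (λ us vs → moveBy flip p i j ⊢[ H ] h , two us [] ⇓ h , two (bits ys) vs)
        (sym (split k b ys)) stack
        (moveBy-two (replicate k (bitʷ b)) (replicate⁺ k pb) ¬p
          (subst (λ us → length us ≤ H) (sym stack)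
              (≤-trans (≤-reflexive (length-replicate k)) bound)))
      where
      stack : map flip (replicate k (bitʷ b)) ʳ++ [] ≡ replicate k (flip (bitʷ b))
      stack = trans (cong (_ʳ++ []) (map-replicate flip k (bitʷ b)))
             (trans (replicate-ʳ++ k _ []) (++-identityʳ _))

    start-at : ∀ {c : Cmd K} {xs ys} → Vec.lookup σ i ≡ xs →
      c ⊢[ H ] h , two xs [] ⇓ h , two ys [] → c ⊢[ H ] h , σ ⇓ h , σ [ i ]≔ ys
    start-at eq = conv (two-lookup eq empty) (two-drop empty)

    length-suffix : ∀ k b bs → length (replicate k b ++ bs) ≤ H → length (bits bs) ≤ H × k ≤ H
    length-suffix k b bs bound =
      ≤-trans (≤-reflexive (length-map bitʷ bs)) (≤-trans (m≤n+m _ k) bound′) ,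
      ≤-trans (m≤m+n k _) bound′
      where
      bound′ : k + length bs ≤ H
      bound′ = ≤-trans (≤-reflexive
          (sym (trans (length-++ (replicate k b)) (cong (_+ length bs) (length-replicate k)))))
          bound

    put-back : ∀ k b bs → length (replicate k b ++ bs) ≤ H →
      move present j i ⊢[ H ] h , two (bits bs) (replicate k (bitʷ b)) ⇓ h , two
          (bits (replicate k b ++ bs)) []
    put-back k b bs bound =
      subst (λ us → move present j i ⊢[ H ] h , two (bits bs) (replicate k (bitʷ b))
          ⇓ h , two us [])
        (sym (split k b bs))
        (move-back k b (≤-trans (≤-reflexive (cong length (sym (split k b bs))))
                       (≤-trans (≤-reflexive (length-map bitʷ (replicate k b ++ bs))) bound)))

  increment-carry : ∀ {bs bs′} → Carry bs bs′ → Vec.lookup σ i ≡ bits bs → length bs′ ≤ H →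
    increment j i ⊢[ H ] h , σ ⇓ h , σ [ i ]≔ bits bs′
  increment-carry (ones k) eq bound with length-suffix k 0b (1b ∷ []) bound
  ... | b₁ , k≤H = start-at eq
    (flip-away k 1b {ys = []} refl refl k≤H ⨾
     (ifNo (test₁ isZero) moveIn ⨾
     (put₁ _ b₁ ⨾ put-back k 0b (1b ∷ []) bound)))
  increment-carry (zero k b bs) eq bound with length-suffix k 0b (1b ∷ b ∷ bs) bound
  ... | b₁ , k≤H = start-at eq
    (flip-away k 1b {ys = 0b ∷ b ∷ bs} refl refl k≤H ⨾
     (ifYes (test₁ isZero) pop₁ ⨾
     (put₁ _ b₁ ⨾ put-back k 0b (1b ∷ b ∷ bs) bound)))

  decrement-carry : ∀ {bs bs′} → Carry bs bs′ → Vec.lookup σ i ≡ bits bs′ → length bs′ ≤ H →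
    decrement j i ⊢[ H ] h , σ ⇓ h , σ [ i ]≔ bits bs
  decrement-carry (ones k) eq bound with length-suffix k 0b (1b ∷ []) bound
  ... | b₁ , k≤H = start-at eq
    (flip-away k 0b {ys = 1b ∷ []} refl refl k≤H ⨾
     (pop₁ ⨾
     (ifNo (test₁ present) moveIn ⨾ put-back k 1b [] shrink)))
    where
    shrink : length (replicate k 1b ++ []) ≤ H
    shrink = ≤-trans (≤-reflexive
        (trans (cong length (++-identityʳ (replicate k 1b))) (length-replicate k))) k≤H
  decrement-carry (zero k b bs) eq bound with length-suffix k 0b (1b ∷ b ∷ bs) bound
  ... | b₁ , k≤H = start-at eq
    (flip-away k 0b {ys = 1b ∷ b ∷ bs} refl refl k≤H ⨾
     (pop₁ ⨾
     (ifYes (test₁ present) (put₁ _ b₁) ⨾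
      put-back k 1b (0b ∷ b ∷ bs) (≤-trans (≤-reflexive same-length) bound))))
    where
    same-length : length (replicate k 1b ++ 0b ∷ b ∷ bs) ≡ length (replicate k 0b ++ 1b ∷ b ∷ bs)
    same-length = trans (length-++ (replicate k 1b))
      (trans (cong (_+ _) (trans (length-replicate k) (sym (length-replicate k))))
          (sym (length-++ (replicate k 0b))))

  increment-spec : ∀ n → Vec.lookup σ i ≡ bits (binary n) → Fits H (suc n) →
    increment j i ⊢[ H ] h , σ ⇓ h , σ [ i ]≔ bits (binary (suc n))
  increment-spec n eq fits = increment-carry (binary-carry n) eq (fitting fits)

  decrement-spec : ∀ n → Vec.lookup σ i ≡ bits (binary (suc n)) → Fits H (suc n) →
    decrement j i ⊢[ H ] h , σ ⇓ h , σ [ i ]≔ bits (binary n)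
  decrement-spec n eq fits = decrement-carry (binary-carry n) eq (fitting fits)

clearAll-spec : ∀ {K H h} {σ : Stacks K} {i} → clear present i ⊢[ H ] h , σ ⇓ h , σ [ i ]≔ []
clearAll-spec = clear-spec _ (sym (++-identityʳ _)) (present-all _) refl

moveAll-spec : ∀ {K H h} {σ : Stacks K} {i j} → i ≢ j →
  length (Vec.lookup σ i ʳ++ Vec.lookup σ j) ≤ H →
  move present i j ⊢[ H ] h , σ ⇓ h , (σ [ i ]≔ []) [ j ]≔ (Vec.lookup σ i ʳ++ Vec.lookup σ j)
moveAll-spec i≢j = move-spec _ i≢j (sym (++-identityʳ _)) (present-all _) refl

copyAll-spec : ∀ {K H h} {σ : Stacks K} {i j l} → i ≢ j → i ≢ l → j ≢ l → Vec.lookup σ j ≡ [] →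
  length (Vec.lookup σ i ++ Vec.lookup σ l) ≤ H →
  copy present j i l ⊢[ H ] h , σ ⇓ h , σ [ l ]≔ (Vec.lookup σ i ++ Vec.lookup σ l)
copyAll-spec {H = H} {σ = σ} {i = i} i≢j i≢l j≢l empty bound =
  copy-spec (Vec.lookup σ i) i≢j i≢l j≢l (sym (++-identityʳ _)) empty (present-all _) refl
    (≤-trans (≤-reflexive (cong length (++-identityʳ (Vec.lookup σ i))))
      (≤-trans (m≤m+n _ _) (≤-trans (≤-reflexive (sym (length-++ (Vec.lookup σ i)))) bound)))
    bound

duplicate-spec : ∀ {K H h} {σ : Stacks K} {i j l} → i ≢ j → i ≢ l → j ≢ l → Vec.lookup σ j ≡ [] →
  Vec.lookup σ l ≡ [] → length (Vec.lookup σ i) ≤ H →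
  copy present j i l ⊢[ H ] h , σ ⇓ h , σ [ l ]≔ Vec.lookup σ i
duplicate-spec {H = H} {σ = σ} {i = i} {l = l} i≢j i≢l j≢l emptyⱼ emptyₗ bound =
  conv refl (cong (σ [ l ]≔_) eq)
    (copyAll-spec i≢j i≢l j≢l emptyⱼ (subst (λ zs → length zs ≤ H) (sym eq) bound))
  where
  eq : Vec.lookup σ i ++ Vec.lookup σ l ≡ Vec.lookup σ i
  eq = trans (cong (Vec.lookup σ i ++_) emptyₗ) (++-identityʳ _)

num : ℕ → List WorkSymbol
num n = bits (binary n)

fits-num : ∀ {H n} → Fits H n → length (num n) ≤ H
fits-num {n = n} fits = ≤-trans (≤-reflexive (length-map bitʷ (binary n))) (fitting fits)

length-binary-mono : ∀ {m n} → m ≤ n → length (binary m) ≤ length (binary n)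
length-binary-mono {m} m≤n = go (≤⇒≤′ m≤n)
  where
  length-inc : ∀ bs → length bs ≤ length (inc bs)
  length-inc []              = z≤n
  length-inc (zero     ∷ bs) = ≤-refl
  length-inc (suc zero ∷ bs) = s≤s (length-inc bs)

  go : ∀ {n} → m ≤′ n → length (binary m) ≤ length (binary n)
  go ≤′-refl             = ≤-refl
  go (≤′-step {n} m≤′n)  = ≤-trans (go m≤′n) (length-inc (binary n))

fits-mono : ∀ {H m n} → m ≤ n → Fits H n → Fits H m
fits-mono m≤n (mkFits fits) = mkFits (≤-trans (length-binary-mono m≤n) fits)

present-suc : ∀ n → present (head (num (suc n))) ≡ true
present-suc n with binary n
... | []           = refl
... | zero ∷ _     = refl
... | suc zero ∷ _ = refl

-- The stacks of the machine

-- The stack `key` holds the address of the binder that is sought, and `hit` and `hit′` record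
-- whether it occurs in the function part and in the argument. The stack `depth` counts pending
-- parentheses in the code, or brackets in an environment; `budget` counts down constructors in
-- `seek` and applications in `scan`. The stack `saved` keeps the address of the active application
-- while `active` serves as a counter.
active env stk temp buf₁ buf₂ key depth budget hit hit′ limit saved : Fin 13
active = # 0
env    = # 1
stk    = # 2
temp   = # 3
buf₁   = # 4
buf₂   = # 5
key    = # 6
depth  = # 7
budget = # 8
hit    = # 9
hit′   = # 10
limit  = # 11
saved  = # 12

-- With all stacks listed, lookups and updates at concrete indices reduce, and most side conditions
-- below hold by `refl`.
pattern st a e s b f g q d n r r′ m z =
  a ∷ e ∷ s ∷ b ∷ f ∷ g ∷ q ∷ d ∷ n ∷ r ∷ r′ ∷ m ∷ z ∷ []

private variable
  H : ℕ
  a e s b f g q d n r r′ m z : List WorkSymbol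
  ls rs : List CodeSymbol
  h : Input
  mem : Memory 13

-- Navigation in the code

onInput : (Maybe CodeSymbol → Bool) → Test 13
onInput p = test zero λ x _ → p x

isSymbol isConstructor isOpen isApp isVar isLam isBitᶜ : Maybe CodeSymbol → Bool
isSymbol nothing  = false
isSymbol (just _) = true
isConstructor (just lamˢ) = true
isConstructor (just appˢ) = true
isConstructor (just varˢ) = true
isConstructor _           = false
isOpen (just openˢ) = true
isOpen _            = false
isApp (just appˢ) = true
isApp _           = false
isVar (just varˢ) = true
isVar _           = false
isLam (just lamˢ) = true
isLam _           = false
isBitᶜ (just (bitˢ _)) = true
isBitᶜ _               = false

-- Each constructor of a term contributes exactly one such symbol, at its place in the in-order
-- enumeration. Counted to the left of a root constructor, they are therefore one fewer than its
-- left address.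
constructors : List CodeSymbol → ℕ
constructors []       = 0
constructors (x ∷ xs) = if isConstructor (just x) then suc (constructors xs) else constructors xs

constructors-ʳ++ : ∀ xs ys → constructors (xs ʳ++ ys) ≡ constructors xs + constructors ys
constructors-ʳ++ []       ys = refl
constructors-ʳ++ (x ∷ xs) ys with isConstructor (just x) | constructors-ʳ++ xs (x ∷ ys)
... | true  | eq = trans eq (+-suc (constructors xs) (constructors ys))
... | false | eq = eq

-- The counter is exhausted only after the wanted constructor has been passed, which explains the
-- move to the left at the end of `goto`.
seek : Cmd 13
seek = while (onTop budget present)
  (cond (onInput isConstructor) (decrement temp budget) skip ⨾ moveIn right)

-- The initial move to the left matters when the head is on the blank after the code, where the loop
-- would stop at once.
rewind : Cmd 13
rewind = moveIn left ⨾ while (onInput isSymbol) (moveIn left) ⨾ moveIn right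

-- Puts the head on the constructor whose index is on the stack active.
goto : Cmd 13
goto = rewind ⨾ copy present temp active budget ⨾ seek ⨾ moveIn left

rewind-spec : ∀ h {σ} → rewind ⊢[ H ] h , σ ⇓ [] ▹ word h , σ
rewind-spec (edge w) = moveIn ⨾ (done refl ⨾ moveIn)
rewind-spec {H} (ls ▹ rs) {σ} = moveIn ⨾ (back ls ⨾ moveIn)
  where
  back : ∀ ls {rs} → while (onInput isSymbol) (moveIn left) ⊢[ H ] shift left (ls ▹ rs) , σ ⇓ edge
      (ls ʳ++ rs) , σ
  back []       = done refl
  back (x ∷ ls) = loop refl moveIn (back ls)

seek-spec : ∀ xs {y} → isConstructor (just y) ≡ true → Fits H (suc (constructors xs)) →
  seek ⊢[ H ] ls ▹ xs ++ y ∷ rs , st a e s [] f g q d (num (suc (constructors xs))) r r′ m z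
         ⇓ y ∷ (xs ʳ++ ls) ▹ rs , st a e s [] f g q d [] r r′ m z
seek-spec [] yc fits =
  loop (present-suc 0) (ifYes yc (decrement-spec (λ ()) refl 0 refl fits) ⨾ moveIn) (done refl)
seek-spec (x ∷ xs) yc fits with isConstructor (just x) in eq
... | true  =
  loop (present-suc (suc (constructors xs)))
    (ifYes eq (decrement-spec (λ ()) refl (suc (constructors xs)) refl fits) ⨾ moveIn)
    (seek-spec xs yc (fits-mono (n≤1+n _) fits))
... | false =
  loop (present-suc (constructors xs)) (ifNo eq moveIn ⨾ moveIn) (seek-spec xs yc fits)

goto-spec : ∀ h ls {y rs k} → word h ≡ ls ʳ++ y ∷ rs → isConstructor (just y) ≡ true →
  suc (constructors ls) ≡ k → Fits H k →
  goto ⊢[ H ] h , st (num k) e s [] f g q d [] r r′ m z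
         ⇓ ls ▹ y ∷ rs , st (num k) e s [] f g q d [] r r′ m z
goto-spec {H} {e} {s} {f} {g} {q} {d} {r} {r′} {m} {z} h ls {y} {rs} w≡ yc refl fits =
  rewind-spec h ⨾ (duplicate-spec (λ ()) (λ ()) (λ ()) refl refl
      (fits-num {n = suc (constructors ls)} fits) ⨾ (seeking ⨾ moveIn))
  where
  k = suc (constructors ls)

  count : constructors (ls ʳ++ []) ≡ constructors ls
  count = trans (constructors-ʳ++ ls []) (+-identityʳ _)

  seeking : seek ⊢[ H ] [] ▹ word h , st (num k) e s [] f g q d (num k) r r′ m z
                   ⇓ y ∷ ls ▹ rs , st (num k) e s [] f g q d [] r r′ m z
  seeking = subst₂ (λ w l → seek ⊢[ H ] [] ▹ w , st (num k) e s [] f g q d (num k) r r′ m z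
                                   ⇓ y ∷ l ▹ rs , st (num k) e s [] f g q d [] r r′ m z)
    (trans (trans (cong (_++ y ∷ rs) (ʳ++-defn ls))
        (trans (++-assoc _ [] (y ∷ rs)) (sym (ʳ++-defn ls)))) (sym w≡))
    (trans (ʳ++-ʳ++ ls) (++-identityʳ ls))
    (subst (λ c → seek ⊢[ H ] [] ▹ (ls ʳ++ []) ++ y ∷ rs , st (num k) e s [] f g q d
        (num (suc c)) r r′ m z
                         ⇓ y ∷ ((ls ʳ++ []) ʳ++ []) ▹ rs , st (num k) e s [] f g q d [] r r′ m z)
      count (seek-spec (ls ʳ++ []) yc (subst (λ c → Fits H (suc c)) (sym count) fits)))

-- Is this symbol inside the term being read?  With as many pending left
-- parentheses as the stack depth says, an application symbol ends it
-- exactly when there are none.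
inside : Maybe CodeSymbol → Maybe WorkSymbol → Bool
inside nothing     _ = false
inside (just appˢ) x = present x
inside (just _)    _ = true

rootStep rootLoop toRoot : Cmd 13
rootStep =
  cond (onInput isOpen) (increment temp depth) (cond (onInput isApp) (decrement temp depth) skip) ⨾
  cond (onInput isConstructor) (increment temp active) skip ⨾
  moveIn right
rootLoop = while (test depth inside) rootStep
-- From the first symbol of a term to its root constructor; the stack
-- active holds the index of the next constructor.
toRoot = cond (onInput isOpen) (moveIn right ⨾ rootLoop) skip

encodeBits : List Bit → List CodeSymbol
encodeBits = map bitˢ

rootLoop-bits : ∀ bs →
  rootLoop ⊢[ H ] encodeBits bs ʳ++ ls ▹ rs , st a e s [] f g q d n r r′ m z ⇓ mem →
  rootLoop ⊢[ H ] ls ▹ encodeBits bs ++ rs , st a e s [] f g q d n r r′ m z ⇓ mem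
rootLoop-bits []       k = k
rootLoop-bits (b ∷ bs) k =
  loop refl (ifNo refl (ifNo refl moveIn) ⨾ (ifNo refl moveIn ⨾ moveIn)) (rootLoop-bits bs k)

module AppBounds (j l : ℕ) (t u : Term) where

  j+tu≡ : suc (j + size t) + size u ≡ j + (size t + suc (size u))
  j+tu≡ = trans (cong suc (+-assoc j (size t) (size u)))
         (trans (sym (+-suc j _)) (cong (j +_) (sym (+-suc (size t) (size u)))))

  j+t< : suc (j + size t) ≤ j + (size t + suc (size u))
  j+t< = ≤-trans (m≤m+n _ (size u)) (≤-reflexive j+tu≡)

  j+t≤ : j + size t ≤ j + (size t + suc (size u))
  j+t≤ = ≤-trans (n≤1+n _) j+t<

  l+t≤ : suc l + size t ≤ l + (size t + suc (size u))
  l+t≤ = ≤-trans (≤-reflexive (sym (+-suc l (size t))))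
           (+-monoʳ-≤ l (≤-trans (s≤s (m≤m+n (size t) (size u)))
               (≤-reflexive (sym (+-suc (size t) (size u))))))

  l′≤ : suc l ≤ l + (size t + suc (size u))
  l′≤ = ≤-trans (m≤m+n (suc l) (size t)) l+t≤

  l+u≤ : l + size u ≤ l + (size t + suc (size u))
  l+u≤ = +-monoʳ-≤ l (≤-trans (n≤1+n _) (m≤n+m (suc (size u)) (size t)))

-- The loop need not stop after `t`, so the effect of reading `t` is stated as a reduction to the
-- evaluation of what remains. The depth rises by at most the number of applications of `t`, which
-- is estimated by `size t`; in `toRoot-spec`, where `t` is the function part, this is within the
-- address that is being computed.
rootLoop-term : ∀ t {σ i j j′ l} → j + size t ≡ j′ → Fits H j′ → Fits H (l + size t) →
  rootLoop ⊢[ H ] encode σ i t ʳ++ ls ▹ rs , st (num j′) e s [] f g q (num l) n r r′ m z ⇓ mem →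
  rootLoop ⊢[ H ] ls ▹ encode σ i t ++ rs , st (num j) e s [] f g q (num l) n r r′ m z ⇓ mem
rootLoop-term {H} (var x) {σ} {j = j} j′≡ fits _ k with trans (sym (+-comm j 1)) j′≡
... | refl = loop refl
  (ifNo refl (ifNo refl moveIn) ⨾ (ifYes refl (increment-spec (λ ()) refl j refl fits) ⨾ moveIn))
  (rootLoop-bits (binary (σ x)) k)
rootLoop-term (ƛ x t) {j = j} {l = l} refl fits fits′ k = loop refl
  (ifNo refl (ifNo refl moveIn) ⨾
   (ifYes refl (increment-spec (λ ()) refl j refl
       (fits-mono (≤-trans (s≤s (m≤m+n j (size t))) (≤-reflexive (sym (+-suc j (size t))))) fits)) ⨾
       moveIn))
  (rootLoop-term t (sym (+-suc j (size t))) fits (fits-mono (+-monoʳ-≤ l (n≤1+n (size t))) fits′) k)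
rootLoop-term {H} {ls} {rs} {e} {s} {f} {g} {q} {n} {r} {r′} {m} {z} {mem} (t · u) {σ} {i} {j}
    {l = l} refl fits fits′ k =
  loop refl
    (ifYes refl (increment-spec (λ ()) refl l refl (fits-mono l′≤ fits′)) ⨾
        (ifNo refl moveIn ⨾ moveIn))
    (subst (λ w → rootLoop ⊢[ H ] openˢ ∷ ls ▹ w , st (num j) e s [] f g q
        (num (suc l)) n r r′ m z ⇓ mem)
      (sym (++-assoc (encode σ i t) _ rs))
      (rootLoop-term t refl (fits-mono j+t≤ fits) (fits-mono l+t≤ fits′)
        (loop (present-suc l)
          (ifNo refl (ifYes refl (decrement-spec (λ ()) refl l refl (fits-mono l′≤ fits′))) ⨾
           (ifYes refl (increment-spec (λ ()) refl (j + size t) refl (fits-mono j+t< fits)) ⨾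
               moveIn))
          (rootLoop-term u j+tu≡ fits (fits-mono l+u≤ fits′)
            (subst (λ w → rootLoop ⊢[ H ] w ▹ rs , st (num (j + (size t + suc (size u)))) e s [] f g
                q (num l) n r r′ m z ⇓ mem)
              (++-ʳ++ (encode σ i t)) k)))))
  where open AppBounds j l t u

beforeCode afterCode : (Var → ℕ) → ℕ → Term → List CodeSymbol
beforeCode σ i (var x) = []
beforeCode σ i (ƛ x t) = []
beforeCode σ i (t · u) = openˢ ∷ encode σ i t
afterCode σ i (var x) = encode σ i (var x)
afterCode σ i (ƛ x t) = encode σ i (ƛ x t)
afterCode σ i (t · u) = appˢ ∷ encode σ (i + suc (size t)) u

toRoot-spec : ∀ t {σ i j j′} → j + beforeRoot t ≡ j′ → Fits H j′ →
  toRoot ⊢[ H ] ls ▹ encode σ i t ++ rs , st (num j) e s [] f g q [] n r r′ m z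
           ⇓ beforeCode σ i t ʳ++ ls ▹ afterCode σ i t ++ rs , st (num j′) e s [] f g
               q [] n r r′ m z
toRoot-spec (var x) {j = j} refl fits rewrite +-identityʳ j = ifNo refl moveIn
toRoot-spec (ƛ x t) {j = j} refl fits rewrite +-identityʳ j = ifNo refl moveIn
toRoot-spec {H} {ls} {rs} {e} {s} {f} {g} {q} {n} {r} {r′} {m} {z} (t · u) {σ} {i} {j} refl fits =
    ifYes refl (moveIn ⨾
  subst (λ w → rootLoop ⊢[ H ] openˢ ∷ ls ▹ w , st (num j) e s [] f g q (num 0) n r r′ m z
                 ⇓ (openˢ ∷ encode σ i t) ʳ++ ls ▹ appˢ ∷ encode σ (i + suc (size t)) u ++ rs , st
                     (num (j + size t)) e s [] f g q (num 0) n r r′ m z)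
    (sym (++-assoc (encode σ i t) _ rs))
    (rootLoop-term t refl fits (fits-mono (m≤n+m (size t) j) fits) (done refl)))

openStep openLoop toOpen : Cmd 13
openStep =
  cond (onInput isApp) (increment temp depth) (cond (onInput isOpen) (decrement temp depth) skip) ⨾
  cond (onInput isConstructor) (decrement temp active) skip ⨾
  moveIn left
openLoop = while (test depth unopened) openStep
  where
  unopened : Maybe CodeSymbol → Maybe WorkSymbol → Bool
  unopened nothing      _ = false
  unopened (just openˢ) x = present x
  unopened (just _)     _ = true
-- From the application symbol of t · u back to its parenthesis; the
-- stack active follows.
toOpen = moveIn left ⨾ openLoop

openLoop-bits : ∀ bs →
  openLoop ⊢[ H ] shift left (ls ▹ encodeBits bs ++ rs) , st a e s [] f g q d n r r′ m z ⇓ mem →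
  openLoop ⊢[ H ] shift left (encodeBits bs ʳ++ ls ▹ rs) , st a e s [] f g q d n r r′ m z ⇓ mem
openLoop-bits []       k = k
openLoop-bits (b ∷ bs) k =
  openLoop-bits bs (loop refl (ifNo refl (ifNo refl moveIn) ⨾ (ifNo refl moveIn ⨾ moveIn)) k)

-- Read backwards, application symbols open and parentheses close, so the loop stops at the
-- parenthesis that belongs to the application from which it started. Positions are written with
-- `shift left` because the head enters a string at its last symbol.
openLoop-term : ∀ t {σ i j j′ l} → j + size t ≡ j′ → Fits H j′ → Fits H (l + size t) →
  openLoop ⊢[ H ] shift left (ls ▹ encode σ i t ++ rs) , st (num j) e s [] f g q
      (num l) n r r′ m z ⇓ mem →
  openLoop ⊢[ H ] shift left (encode σ i t ʳ++ ls ▹ rs) , st (num j′) e s [] f g q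
      (num l) n r r′ m z ⇓ mem
openLoop-term {H} (var x) {σ} {j = j} j′≡ fits _ k with trans (sym (+-comm j 1)) j′≡
... | refl = openLoop-bits (binary (σ x)) (loop refl
  (ifNo refl (ifNo refl moveIn) ⨾ (ifYes refl (decrement-spec (λ ()) refl j refl fits) ⨾ moveIn))
  k)
openLoop-term (ƛ x t) {j = j} {l = l} refl fits fits′ k =
  openLoop-term t (sym (+-suc j (size t))) fits (fits-mono (+-monoʳ-≤ l (n≤1+n (size t))) fits′)
    (loop refl
      (ifNo refl (ifNo refl moveIn) ⨾
       (ifYes refl (decrement-spec (λ ()) refl j refl
           (fits-mono (≤-trans (s≤s (m≤m+n j (size t))) (≤-reflexive (sym (+-suc j (size t)))))
           fits)) ⨾ moveIn))
      k)
openLoop-term {H} {ls} {rs} {e} {s} {f} {g} {q} {n} {r} {r′} {m} {z} {mem} (t · u) {σ} {i} {j}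
    {l = l} refl fits fits′ k =
  subst (λ w → openLoop ⊢[ H ] shift left (w ▹ rs) , st (num (j + (size t + suc (size u)))) e s [] f
      g q (num l) n r r′ m z ⇓ mem)
    (sym (++-ʳ++ (encode σ i t)))
    (openLoop-term u j+tu≡ fits (fits-mono l+u≤ fits′)
      (loop refl
        (ifYes refl (increment-spec (λ ()) refl l refl (fits-mono l′≤ fits′)) ⨾
         (ifYes refl (decrement-spec (λ ()) refl (j + size t) refl (fits-mono j+t< fits)) ⨾ moveIn))
        (openLoop-term t refl (fits-mono j+t≤ fits) (fits-mono l+t≤ fits′)
          (loop (present-suc l)
            (ifNo refl (ifYes refl (decrement-spec (λ ()) refl l refl (fits-mono l′≤ fits′))) ⨾
                (ifNo refl moveIn ⨾ moveIn))
            (subst (λ w → openLoop ⊢[ H ] shift left (ls ▹ openˢ ∷ w) , st (num j) e s [] f g q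
                (num l) n r r′ m z ⇓ mem)
              (++-assoc (encode σ i t) _ rs) k)))))
  where open AppBounds j l t u

toOpen-spec : ∀ t {σ i j j′} → j + size t ≡ j′ → Fits H j′ →
  toOpen ⊢[ H ] encode σ i t ʳ++ openˢ ∷ ls ▹ rs , st (num j′) e s [] f g q [] n r r′ m z
           ⇓ ls ▹ openˢ ∷ encode σ i t ++ rs , st (num j) e s [] f g q [] n r r′ m z
toOpen-spec t {j = j} refl fits =
  moveIn ⨾ openLoop-term t {l = 0} refl fits (fits-mono (m≤n+m (size t) j) fits) (done refl)

-- Free variables

infix 4 _==_

_==_ : List Bit → List Bit → Bool
[]            == []            = true
(zero ∷ bs)     == (zero ∷ cs)     = bs == cs
(suc zero ∷ bs) == (suc zero ∷ cs) = bs == cs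
_             == _             = false

flag : Bool → List WorkSymbol
flag true  = bitʷ 1b ∷ []
flag false = []

sameBit matched : Maybe CodeSymbol → Maybe WorkSymbol → Bool
sameBit (just (bitˢ zero))       (just (bitʷ zero))       = true
sameBit (just (bitˢ (suc zero))) (just (bitʷ (suc zero))) = true
sameBit _                        _                        = false
matched x y = not (isBitᶜ x) ∧ not (present y)

compareLoop compare : Cmd 13
compareLoop = while (test key sameBit) (push temp key (topOf id) ⨾ pop key ⨾ moveIn right)
-- On a variable of the code, raises the flag hit if its binder is the one
-- on the stack key, and moves past it.
compare =
  moveIn right ⨾ compareLoop ⨾
  cond (test key matched) (cond (onTop hit present) skip (put hit (bitʷ 1b))) skip ⨾
  move present temp key ⨾ while (onInput isBitᶜ) (moveIn right)

-- The loop consumes the longest common prefix `bs₁`, and the addresses agree if and only if nothing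
-- remains of either. That `rs` does not begin with a bit makes the end of the address in the code
-- recognisable.
compareLoop-spec : ∀ bs cs ds → isBitᶜ (head rs) ≡ false → length (bits cs ʳ++ ds) ≤ H →
  ∃₂ λ bs₁ bs₂ → ∃ λ cs₂ → bs ≡ bs₁ ++ bs₂ × cs ≡ bs₁ ++ cs₂ ×
  matched (head (encodeBits bs₂ ++ rs)) (head (bits cs₂)) ≡ (bs == cs) ×
  compareLoop ⊢[ H ] ls ▹ encodeBits bs ++ rs , st a e s ds f g (bits cs) d n r r′ m z
                   ⇓ encodeBits bs₁ ʳ++ ls ▹ encodeBits bs₂ ++ rs , st a e s (bits bs₁ ʳ++ ds) f g
                       (bits cs₂) d n r r′ m z
compareLoop-spec {rs = rs} [] [] ds nonbit bound =
  [] , [] , [] , refl , refl , cong (λ x → not x ∧ true) nonbit , done (unmatched (head rs))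
  where
  unmatched : ∀ x → sameBit x nothing ≡ false
  unmatched nothing                     = refl
  unmatched (just (bitˢ zero))          = refl
  unmatched (just (bitˢ (suc zero)))    = refl
  unmatched (just lamˢ)                 = refl
  unmatched (just openˢ)                = refl
  unmatched (just appˢ)                 = refl
  unmatched (just varˢ)                 = refl
compareLoop-spec {rs = rs} [] (c ∷ cs) ds nonbit bound =
  [] , [] , c ∷ cs , refl , refl , cong (λ x → not x ∧ false) nonbit , done
      (unmatched (head rs) nonbit)
  where
  unmatched : ∀ x → isBitᶜ x ≡ false → sameBit x (just (bitʷ c)) ≡ false
  unmatched nothing      _ = refl
  unmatched (just lamˢ)  _ = refl
  unmatched (just openˢ) _ = refl
  unmatched (just appˢ)  _ = refl
  unmatched (just varˢ)  _ = refl
compareLoop-spec (zero ∷ bs)     []              ds nonbit bound = [] , zero ∷ bs , [] , refl , refl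
    , refl , done refl
compareLoop-spec (suc zero ∷ bs) []              ds nonbit bound = [] , suc zero ∷ bs , [] , refl ,
    refl , refl , done refl
compareLoop-spec (zero ∷ bs)     (suc zero ∷ cs) ds nonbit bound = [] , zero ∷ bs , suc zero ∷ cs ,
    refl , refl , refl , done refl
compareLoop-spec (suc zero ∷ bs) (zero ∷ cs)     ds nonbit bound = [] , suc zero ∷ bs , zero ∷ cs ,
    refl , refl , refl , done refl
compareLoop-spec (zero ∷ bs)     (zero ∷ cs)     ds nonbit bound with compareLoop-spec bs cs
    (bitʷ 0b ∷ ds) nonbit bound
... | bs₁ , bs₂ , cs₂ , eq₁ , eq₂ , eq , k =
  0b ∷ bs₁ , bs₂ , cs₂ , cong (0b ∷_) eq₁ , cong (0b ∷_) eq₂ , eq ,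
  loop refl (push (≤-trans (m≤n+m _ (length (bits cs)))
      (≤-trans (≤-reflexive (sym (length-ʳ++ (bits cs)))) bound)) ⨾ (pop refl ⨾ moveIn)) k
compareLoop-spec (suc zero ∷ bs) (suc zero ∷ cs) ds nonbit bound with compareLoop-spec bs cs
    (bitʷ 1b ∷ ds) nonbit bound
... | bs₁ , bs₂ , cs₂ , eq₁ , eq₂ , eq , k =
  1b ∷ bs₁ , bs₂ , cs₂ , cong (1b ∷_) eq₁ , cong (1b ∷_) eq₂ , eq ,
  loop refl (push (≤-trans (m≤n+m _ (length (bits cs)))
      (≤-trans (≤-reflexive (sym (length-ʳ++ (bits cs)))) bound)) ⨾ (pop refl ⨾ moveIn)) k

compare-spec : ∀ bs cs {i} → isBitᶜ (head rs) ≡ false → length cs ≤ H → 1 ≤ H →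
  compare ⊢[ H ] ls ▹ varˢ ∷ encodeBits bs ++ rs , st a e s [] f g (bits cs) d n (flag i) r′ m z
             ⇓ encodeBits bs ʳ++ varˢ ∷ ls ▹ rs , st a e s [] f g (bits cs) d n
                 (flag (i ∨ (bs == cs))) r′ m z
compare-spec {rs} {H} {ls} {a} {e} {s} {f} {g} {d} {n} {r′} {m} {z} bs cs {i} nonbit bound 1≤H
  with compareLoop-spec {rs = rs} {H = H} {ls = varˢ ∷ ls} {a = a} {e} {s} {f} {g} {d} {n} {flag i}
      {r′} {m} {z} bs cs [] nonbit
         (≤-trans (≤-reflexive (trans (length-ʳ++ (bits cs))
             (trans (+-identityʳ _) (length-map bitʷ cs)))) bound)
... | bs₁ , bs₂ , cs₂ , refl , refl , eq , k =
  moveIn ⨾ (k ⨾ (raise i (encodeBits bs₁ ʳ++ varˢ ∷ ls ▹ encodeBits bs₂ ++ rs) eq ⨾ (restore ⨾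
    subst (λ l → while (onInput isBitᶜ) (moveIn right) ⊢[ H ] encodeBits bs₁ ʳ++ varˢ ∷ ls ▹
        encodeBits bs₂ ++ rs , σ
                   ⇓ l ▹ rs , σ)
      (trans (sym (++-ʳ++ (encodeBits bs₁))) (cong (_ʳ++ varˢ ∷ ls) (sym (map-++ bitˢ bs₁ bs₂))))
      (skipBits bs₂))))
  where
  σ = st a e s [] f g (bits (bs₁ ++ cs₂)) d n (flag (i ∨ ((bs₁ ++ bs₂) == (bs₁ ++ cs₂)))) r′ m z

  raise : ∀ {b q j} i h → matched (read h) (head q) ≡ j →
    cond (test key matched) (cond (onTop hit present) skip (put hit (bitʷ 1b))) skip
      ⊢[ H ] h , st a e s b f g q d n (flag i) r′ m z ⇓ h , st a e s b f g q d n
          (flag (i ∨ j)) r′ m z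
  raise {j = false} true  h eq = ifNo eq moveIn
  raise {j = false} false h eq = ifNo eq moveIn
  raise {j = true}  true  h eq = ifYes eq (ifYes refl moveIn)
  raise {j = true}  false h eq = ifYes eq (ifNo refl (push 1≤H))

  key≡ : (bits bs₁ ʳ++ []) ʳ++ bits cs₂ ≡ bits (bs₁ ++ cs₂)
  key≡ = trans (ʳ++-ʳ++ (bits bs₁)) (sym (map-++ bitʷ bs₁ cs₂))

  restore : ∀ {h r} → move present temp key
    ⊢[ H ] h , st a e s (bits bs₁ ʳ++ []) f g (bits cs₂) d n r r′ m z
         ⇓ h , st a e s [] f g (bits (bs₁ ++ cs₂)) d n r r′ m z
  restore {h} {r} = subst (λ q → move present temp key
    ⊢[ H ] h , st a e s (bits bs₁ ʳ++ []) f g (bits cs₂) d n r r′ m z ⇓ h , st a e s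
        [] f g q d n r r′ m z)
    key≡ (moveAll-spec (λ ()) (≤-trans
        (≤-reflexive (trans (cong length key≡) (length-map bitʷ (bs₁ ++ cs₂)))) bound))

  skipBits : ∀ bs {ls σ} → while (onInput isBitᶜ) (moveIn right)
    ⊢[ H ] ls ▹ encodeBits bs ++ rs , σ ⇓ encodeBits bs ʳ++ ls ▹ rs , σ
  skipBits []       = done nonbit
  skipBits (b ∷ bs) = loop refl moveIn (skipBits bs)

scanRest scanLoop scan : Cmd 13
scanRest = while (onInput isSymbol) (cond (onInput isVar) compare (moveIn right))
scanLoop = while (test depth inside) (
  cond (onInput isVar) compare (
  cond (onInput isOpen)
    (cond (onTop budget present)
      (decrement temp budget ⨾ increment temp depth ⨾ moveIn right)
      scanRest)
    (cond (onInput isApp) (decrement temp depth) skip ⨾ moveIn right)))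
-- From the first symbol of a term to its end, raises the flag hit if
-- the binder on the stack key binds a variable of that term.  A term
-- with more applications than the stack limit says extends to the end
-- of the code.
scan = copy present temp limit budget ⨾ scanLoop ⨾ clear present budget ⨾ clear present depth

-- This is membership in the free variables as the code shows it. Variables are addresses of
-- binders, so that nothing has to be excluded under an abstraction: a rebound name is written as a
-- different address.
occurs : List Bit → (Var → ℕ) → ℕ → Term → Bool
occurs k σ i (var x) = binary (σ x) == k
occurs k σ i (ƛ x t) = occurs k (σ [ x ↦ i ]) (suc i) t
occurs k σ i (t · u) = occurs k σ i t ∨ occurs k σ (i + suc (size t)) u

applications : Term → ℕ
applications (var x) = 0
applications (ƛ x t) = applications t
applications (t · u) = suc (applications t + applications u)

applications≤size : ∀ t → applications t ≤ size t
applications≤size (var x) = z≤n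
applications≤size (ƛ x t) = ≤-trans (applications≤size t) (n≤1+n _)
applications≤size (t · u) = ≤-trans (s≤s (+-mono-≤ (applications≤size t) (applications≤size u)))
                                    (≤-reflexive (sym (+-suc (size t) (size u))))

module _ {H : ℕ} {a e s f g r′ m z : List WorkSymbol} (k : List Bit) (k≤H : length k ≤ H)
    (1≤H : 1 ≤ H) where

  private
    stacks : List WorkSymbol → List WorkSymbol → Bool → Stacks 13
    stacks d n j = st a e s [] f g (bits k) d n (flag j) r′ m z

  scanRest-term : ∀ t {σ i j ls rs d n mem} → isBitᶜ (head rs) ≡ false →
    scanRest ⊢[ H ] encode σ i t ʳ++ ls ▹ rs , stacks d n (j ∨ occurs k σ i t) ⇓ mem →
    scanRest ⊢[ H ] ls ▹ encode σ i t ++ rs , stacks d n j ⇓ mem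
  scanRest-term (var x) {σ} nonbit c =
    loop refl (ifYes refl (compare-spec (binary (σ x)) k nonbit k≤H 1≤H)) c
  scanRest-term (ƛ x t) nonbit c = loop refl (ifNo refl moveIn) (scanRest-term t nonbit c)
  scanRest-term (t · u) {σ} {i} {j} {ls} {rs} {d} {n} {mem} nonbit c =
    loop refl (ifNo refl moveIn)
      (subst (λ w → scanRest ⊢[ H ] openˢ ∷ ls ▹ w , stacks d n j ⇓ mem)
          (sym (++-assoc (encode σ i t) _ rs))
      (scanRest-term t refl (loop refl (ifNo refl moveIn) (scanRest-term u nonbit
      (subst₂ (λ w o → scanRest ⊢[ H ] w ▹ rs , stacks d n o ⇓ mem)
        (++-ʳ++ (encode σ i t)) (sym (∨-assoc j _ _)) c)))))

  -- A parenthesis transfers one unit from the budget to the depth, and an application symbol only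
  -- lowers the depth. The sum of the two counters never increases, so one bound on it keeps both of
  -- them short.
  scanLoop-term : ∀ t {σ i j ls rs l p mem} → isBitᶜ (head rs) ≡ false →
    Fits H (l + (applications t + p)) →
    scanLoop ⊢[ H ] encode σ i t ʳ++ ls ▹ rs , stacks (num l) (num p) (j ∨ occurs k σ i t) ⇓ mem →
    scanLoop ⊢[ H ] ls ▹ encode σ i t ++ rs , stacks (num l) (num (applications t + p)) j ⇓ mem
  scanLoop-term (var x) {σ} nonbit fits c =
    loop refl (ifYes refl (compare-spec (binary (σ x)) k nonbit k≤H 1≤H)) c
  scanLoop-term (ƛ x t) {l = l} nonbit fits c =
    loop refl (ifNo refl (ifNo refl (ifNo refl moveIn ⨾ moveIn)))
        (scanLoop-term t {l = l} nonbit fits c)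
  scanLoop-term (t · u) {σ} {i} {j} {ls} {rs} {l} {p} {mem} nonbit fits c =
    loop refl (ifNo refl (ifYes refl (ifYes (present-suc (applications t + applications u + p))
        (decrement-spec (λ ()) refl (applications t + applications u + p) refl
            (fits-mono (m≤n+m _ l) fits) ⨾
        (increment-spec (λ ()) refl l refl (fits-mono l< fits) ⨾ moveIn)))))
      (subst₂ (λ w o → scanLoop ⊢[ H ] openˢ ∷ ls ▹ w , stacks (num (suc l)) (num o) j ⇓ mem)
        (sym (++-assoc (encode σ i t) _ rs)) (sym (+-assoc (applications t) _ p))
      (scanLoop-term t {l = suc l} refl (subst (Fits H) l≡ fits)
      (loop (present-suc l)
        (ifNo refl (ifNo refl (ifYes refl
            (decrement-spec (λ ()) refl l refl (fits-mono l< fits)) ⨾ moveIn)))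
      (scanLoop-term u {l = l} nonbit (fits-mono l≥ fits)
      (subst₂ (λ w o → scanLoop ⊢[ H ] w ▹ rs , stacks (num l) (num p) o ⇓ mem)
        (++-ʳ++ (encode σ i t)) (sym (∨-assoc j _ _)) c)))))
    where
    l< : suc l ≤ l + suc (applications t + applications u + p)
    l< = ≤-trans (s≤s (m≤m+n l _)) (≤-reflexive (sym (+-suc l _)))
    l≡ : l + suc (applications t + applications u + p) ≡ suc l +
        (applications t + (applications u + p))
    l≡ = trans (+-suc l _) (cong (λ n → suc (l + n)) (+-assoc (applications t) _ p))
    l≥ : l + (applications u + p) ≤ l + suc (applications t + applications u + p)
    l≥ = +-monoʳ-≤ l (≤-trans (+-monoˡ-≤ p (m≤n+m (applications u) (applications t))) (n≤1+n _))

  module Exhausted (t u : Term) (σ : Var → ℕ) (i : ℕ) (j : Bool) (ls rs : List CodeSymbol) (l p : ℕ)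
                           (fin : List CodeSymbol) (o : Bool) (fits : Fits H (l + suc p)) where

    fits′ : Fits H (suc l + p)
    fits′ = subst (Fits H) (+-suc l p) fits

    begin-loop : ∀ {d} →
      scanLoop ⊢[ H ] openˢ ∷ ls ▹ encode σ i t ++ appˢ ∷ encode σ (i + suc (size t)) u ++ rs ,
          stacks (num (suc l)) (num p) j
                  ⇓ fin ▹ [] , stacks d [] o →
      scanLoop ⊢[ H ] ls ▹ encode σ i (t · u) ++ rs , stacks (num l) (num (suc p)) j ⇓ fin ▹ [] ,
          stacks d [] o
    begin-loop {d} run =
      loop refl (ifNo refl (ifYes refl (ifYes (present-suc p)
          (decrement-spec (λ ()) refl p refl (fits-mono (s≤s (m≤n+m p l)) fits′) ⨾
          (increment-spec (λ ()) refl l refl (fits-mono (s≤s (m≤m+n l p)) fits′) ⨾ moveIn)))))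
        (subst (λ w → scanLoop ⊢[ H ] openˢ ∷ ls ▹ w , stacks (num (suc l)) (num p) j ⇓ fin ▹ [] ,
            stacks d [] o)
          (sym (++-assoc (encode σ i t) _ rs)) run)

  -- At a parenthesis with an empty budget, `scanRest` takes over and reads to the end of the code,
  -- where the outer loop stops on the blank whatever the depth is. The depth at that moment is of
  -- no interest; hence the assumption for all `d` and the existential in the conclusion. In an
  -- application, either the budget runs out in `t`, or `t` is read normally and the remaining
  -- `p ∸ applications t` runs out in `u`.
  scanLoop-exhausted : ∀ t {σ i j ls rs l p o fin} → isBitᶜ (head rs) ≡ false → p < applications t →
    Fits H (l + p) →
    (∀ d → scanRest ⊢[ H ] encode σ i t ʳ++ ls ▹ rs , stacks d [] (j ∨ occurs k σ i t) ⇓ fin ▹ [] ,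
        stacks d [] o) →
    ∃ λ d → scanLoop ⊢[ H ] ls ▹ encode σ i t ++ rs , stacks (num l) (num p) j ⇓ fin ▹
        [] , stacks d [] o
  scanLoop-exhausted (ƛ x t) nonbit p< fits c with scanLoop-exhausted t nonbit p< fits c
  ... | d , run = d , loop refl (ifNo refl (ifNo refl (ifNo refl moveIn ⨾ moveIn))) run
  scanLoop-exhausted (t · u) {l = l} {zero} nonbit p< fits c = num l ,
    loop refl (ifNo refl (ifYes refl (ifNo refl (scanRest-term (t · u) nonbit (c (num l))))))
        (done refl)
  scanLoop-exhausted (t · u) {σ} {i} {j} {ls} {rs} {l} {suc p} {o} {fin} nonbit (s≤s p<) fits c with
      p <? applications t
  ... | yes p<t = proj₁ rest , begin-loop (proj₂ rest)
    where
    open Exhausted t u σ i j ls rs l p fin o fits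
    rest = scanLoop-exhausted t refl p<t fits′
      λ d → loop refl (ifNo refl moveIn) (scanRest-term u nonbit (
        subst₂ (λ w v → scanRest ⊢[ H ] w ▹ rs , stacks d [] v ⇓ fin ▹ [] , stacks d [] o)
          (++-ʳ++ (encode σ i t)) (sym (∨-assoc j _ _)) (c d)))
  ... | no p≮t = proj₁ rest , begin-loop
    (subst (λ v → scanLoop ⊢[ H ] openˢ ∷ ls ▹ encode σ i t ++ appˢ ∷ encode σ (i + suc (size t)) u
        ++ rs , stacks (num (suc l)) (num v) j ⇓ fin ▹ [] , stacks (proj₁ rest) [] o)
      p≡
      (scanLoop-term t {l = suc l} refl (subst (λ v → Fits H (suc (l + v))) (sym p≡) fits′)
      (loop (present-suc l)
        (ifNo refl (ifNo refl (ifYes refl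
            (decrement-spec (λ ()) refl l refl (fits-mono (s≤s (m≤m+n l p)) fits′)) ⨾ moveIn)))
        (proj₂ rest))))
    where
    open Exhausted t u σ i j ls rs l p fin o fits
    p≡ : applications t + (p ∸ applications t) ≡ p
    p≡ = m+[n∸m]≡n (≮⇒≥ p≮t)
    rest = scanLoop-exhausted u {l = l} {p = p ∸ applications t} {o = o} {fin = fin} nonbit
      (+-cancelˡ-< (applications t) _ _ (subst (_< applications t + applications u) (sym p≡) p<))
      (fits-mono (≤-trans (+-monoʳ-≤ l (m∸n≤m p (applications t))) (n≤1+n _)) fits′)
      λ d → subst₂ (λ w v → scanRest ⊢[ H ] w ▹ rs , stacks d [] v ⇓ fin ▹ [] , stacks d [] o)
          (++-ʳ++ (encode σ i t)) (sym (∨-assoc j _ _)) (c d)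

-- What follows a term in the code, when the number of its applications
-- is at most p if that term is not the end of the code.
data Continuation (p : ℕ) (t : Term) : List CodeSymbol → Set where
  end   : Continuation p t []
  apply : ∀ {rs} → applications t ≤ p → Continuation p t (appˢ ∷ rs)

-- If the budget suffices, the scan stops exactly at the end of `t`. If it does not, the
-- continuation cannot be `apply`, so `t` ends the code, and reading on to the end of the code reads
-- nothing but `t`.
scan-spec : ∀ k t {σ i p} → length k ≤ H → 1 ≤ H → Fits H p → Continuation p t rs →
  scan ⊢[ H ] ls ▹ encode σ i t ++ rs , st a e s [] f g (bits k) [] [] [] r′ (num p) z
         ⇓ encode σ i t ʳ++ ls ▹ rs , st a e s [] f g (bits k) [] []
             (flag (occurs k σ i t)) r′ (num p) z
scan-spec {H} {rs} {ls} {a} {e} {s} {f} {g} {r′} {z} k t {σ} {i} {p} k≤H 1≤H fits c =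
  duplicate-spec (λ ()) (λ ()) (λ ()) refl refl (fits-num fits) ⨾
      (proj₂ (proj₂ (looped c)) ⨾ (clearAll-spec ⨾ clearAll-spec))
  where
  nonbit : ∀ {rs} → Continuation p t rs → isBitᶜ (head rs) ≡ false
  nonbit end       = refl
  nonbit (apply _) = refl

  within : Continuation p t rs → applications t ≤ p →
    ∃₂ λ d n → scanLoop ⊢[ H ] ls ▹ encode σ i t ++ rs , st a e s [] f g (bits k) []
        (num p) [] r′ (num p) z
      ⇓ encode σ i t ʳ++ ls ▹ rs , st a e s [] f g (bits k) d n (flag (occurs k σ i t)) r′ (num p) z
  within c ≤p = [] , num (p ∸ applications t) ,
    subst (λ v → scanLoop ⊢[ H ] ls ▹ encode σ i t ++ rs , st a e s [] f g (bits k) []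
        (num v) [] r′ (num p) z
      ⇓ encode σ i t ʳ++ ls ▹ rs , st a e s [] f g (bits k) [] (num (p ∸ applications t))
          (flag (occurs k σ i t)) r′ (num p) z)
      (m+[n∸m]≡n ≤p)
      (scanLoop-term k k≤H 1≤H t {l = 0} (nonbit c) (subst (Fits H) (sym (m+[n∸m]≡n ≤p)) fits)
          (done (stop c)))
    where
    stop : ∀ {rs} → Continuation p t rs → inside (head rs) nothing ≡ false
    stop end       = refl
    stop (apply _) = refl

  looped : Continuation p t rs → ∃₂ λ d n → scanLoop ⊢[ H ] ls ▹ encode σ i t ++ rs , st a e s [] f
      g (bits k) [] (num p) [] r′ (num p) z
      ⇓ encode σ i t ʳ++ ls ▹ rs , st a e s [] f g (bits k) d n (flag (occurs k σ i t)) r′ (num p) z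
  looped c with applications t ≤? p
  looped c         | yes ≤p = within c ≤p
  looped (apply ≤p) | no ≰p = contradiction ≤p ≰p
  looped end        | no ≰p
    with scanLoop-exhausted k k≤H 1≤H t {σ} {i} {false} {ls} {l = 0} {p} refl (≰⇒> ≰p) fits
        (λ d → done refl)
  ... | d , run = d , [] , run

-- Environments on stacks

isOpenʷ isCloseʷ : Pred
isOpenʷ (just ⟦ʷ) = true
isOpenʷ _         = false
isCloseʷ (just ⟧ʷ) = true
isCloseʷ _         = false

-- The closures in entries contain environments in turn, so that an entry ends at its matching
-- bracket and not at the next closing one.
data Balanced : List WorkSymbol → Set where
  []   : Balanced []
  flat : ∀ {x w} → isOpenʷ (just x) ≡ false → isCloseʷ (just x) ≡ false → Balanced w →
      Balanced (x ∷ w)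
  nest : ∀ {v w} → Balanced v → Balanced w → Balanced (⟦ʷ ∷ v ++ ⟧ʷ ∷ w)

balanced-bits : ∀ bs {w} → Balanced w → Balanced (bits bs ++ w)
balanced-bits []       bal = bal
balanced-bits (b ∷ bs) bal = flat refl refl (balanced-bits bs bal)

module _ {t₀ : Term} where

  entryBody : Entry t₀ → List WorkSymbol
  entryBody (b ← c) = occString b ++ ←ʷ ∷ closureString c

  envString-∷ : ∀ x (e : Env t₀) → envString (x ∷ e) ≡ ⟦ʷ ∷ entryBody x ++ ⟧ʷ ∷ envString e
  envString-∷ (b ← c) e = cong (⟦ʷ ∷_) (sym (++-assoc (occString b) _ _))

  mutual
    balanced-closure : (c : Closure t₀) → Balanced (closureString c)
    balanced-closure (clo o e) = balanced-bits (binary (leftAddress o)) (balanced-env e)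

    balanced-env : (e : Env t₀) → Balanced (envString e)
    balanced-env []            = []
    balanced-env ((b ← c) ∷ e) = subst Balanced (sym (envString-∷ (b ← c) e))
      (nest (balanced-bits (binary (leftAddress b)) (flat refl refl (balanced-closure c)))
          (balanced-env e))

  balanced-entryBody : ∀ (x : Entry t₀) → Balanced (entryBody x)
  balanced-entryBody (b ← c) = balanced-bits (binary (leftAddress b))
      (flat refl refl (balanced-closure c))

keep : Bool → List WorkSymbol → List WorkSymbol → List WorkSymbol
keep true  w f = w ʳ++ f
keep false w f = f

keep-++ : ∀ j v w f → keep j (v ++ w) f ≡ keep j w (keep j v f)
keep-++ true  v w f = ++-ʳ++ v
keep-++ false v w f = refl

length-keep : ∀ j w f → length (keep j w f) ≤ length w + length f
length-keep true  w f = ≤-reflexive (length-ʳ++ w)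
length-keep false w f = m≤n+m _ (length w)

keep-bound : ∀ j v w f → length (v ++ w) + length f ≤ H → length w + length (keep j v f) ≤ H
keep-bound {H} j v w f bound = begin
  length w + length (keep j v f)        ≤⟨ +-monoʳ-≤ (length w) (length-keep j v f) ⟩
  length w + (length v + length f)      ≡⟨ +-assoc (length w) _ _ ⟨
  length w + length v + length f        ≡⟨ cong (_+ length f) (+-comm (length w) _) ⟩
  length v + length w + length f        ≡⟨ cong (_+ length f) (length-++ v) ⟨
  length (v ++ w) + length f            ≤⟨ bound ⟩
  H                                     ∎
  where open ≤-Reasoning

moveSymbol bracketStep moveEntry : Cmd 13
moveSymbol =
  cond (onTop hit present) (push buf₁ env (topOf id)) skip ⨾
  cond (onTop hit′ present) (push buf₂ env (topOf id)) skip ⨾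
  pop env
bracketStep =
  cond (onTop env isOpenʷ) (put depth ⟧ʷ) (cond (onTop env isCloseʷ) (pop depth) skip) ⨾ moveSymbol
-- Removes an entry from the stack env, and puts it in reverse order on
-- buf₁ and buf₂ if the flag hit, respectively hit′, is raised.
moveEntry = put depth ⟧ʷ ⨾ moveSymbol ⨾ while (onTop depth present) bracketStep

moveSymbol-spec : ∀ j j′ x → length f < H → length g < H →
  moveSymbol ⊢[ H ] h , st a (x ∷ e) s b f g q d n (flag j) (flag j′) m z
               ⇓ h , st a e s b (keep j (x ∷ []) f) (keep j′ (x ∷ []) g) q d n
                   (flag j) (flag j′) m z
moveSymbol-spec true  true  x f< g< = ifYes refl (push f<) ⨾ (ifYes refl (push g<) ⨾ pop refl)
moveSymbol-spec true  false x f< g< = ifYes refl (push f<) ⨾ (ifNo refl moveIn ⨾ pop refl)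
moveSymbol-spec false true  x f< g< = ifNo refl moveIn ⨾ (ifYes refl (push g<) ⨾ pop refl)
moveSymbol-spec false false x f< g< = ifNo refl moveIn ⨾ (ifNo refl moveIn ⨾ pop refl)

head-fits : ∀ (x : WorkSymbol) w f → length (x ∷ w) + length f ≤ H → length {A = WorkSymbol} f < H
head-fits x w f = ≤-trans (s≤s (m≤n+m (length f) (length w)))

module _ {H : ℕ} {h : Input} {a s b q n m z : List WorkSymbol} (j j′ : Bool) where

  private
    stacks : List WorkSymbol → List WorkSymbol → List WorkSymbol → List WorkSymbol → Stacks 13
    stacks e d f g = st a e s b f g q d n (flag j) (flag j′) m z

    brackets : Cmd 13
    brackets = while (onTop depth present) bracketStep

  -- The bracket depth is kept in unary, one symbol for each open bracket. This is affordable
  -- because all these brackets belong to the environment string itself. The stack `y ∷ d` is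
  -- non-empty, so that the loop cannot end inside `w`.
  moveBalanced : ∀ {w e y d f g mem} → Balanced w →
    length w + length (y ∷ d) ≤ H → length w + length f ≤ H → length w + length g ≤ H →
    brackets ⊢[ H ] h , stacks e (y ∷ d) (keep j w f) (keep j′ w g) ⇓ mem →
    brackets ⊢[ H ] h , stacks (w ++ e) (y ∷ d) f g ⇓ mem
  moveBalanced {e = e} {y} {d} {f} {g} {mem} [] d≤ f≤ g≤ k =
    subst₂ (λ f g → brackets ⊢[ H ] h , stacks e (y ∷ d) f g ⇓ mem) (keep-[] j f) (keep-[] j′ g) k
    where
    keep-[] : ∀ j f → keep j [] f ≡ f
    keep-[] true  f = refl
    keep-[] false f = refl
  moveBalanced {e = e} {y} {d} {f} {g} {mem} (flat {x} {w} op cl bal) d≤ f≤ g≤ k =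
    loop refl (ifNo op (ifNo cl moveIn) ⨾ moveSymbol-spec j j′ x (head-fits x w f f≤)
        (head-fits x w g g≤))
      (moveBalanced bal (≤-trans (n≤1+n _) d≤) (keep-bound j (x ∷ []) w f f≤)
          (keep-bound j′ (x ∷ []) w g g≤)
        (subst₂ (λ f g → brackets ⊢[ H ] h , stacks e (y ∷ d) f g ⇓ mem) (keep-++ j (x ∷ []) w f)
            (keep-++ j′ (x ∷ []) w g) k))
  moveBalanced {e = e} {y} {d} {f} {g} {mem} (nest {v} {w} bal bal′) d≤ f≤ g≤ k =
    subst (λ e′ → brackets ⊢[ H ] h , stacks (⟦ʷ ∷ e′) (y ∷ d) f g ⇓ mem)
        (sym (++-assoc v (⟧ʷ ∷ w) e))
    (loop refl (ifYes refl (push (≤-trans (s≤s (m≤n+m _ (length (v ++ ⟧ʷ ∷ w)))) d≤)) ⨾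
        moveSymbol-spec j j′ ⟦ʷ (head-fits ⟦ʷ (v ++ ⟧ʷ ∷ w) f f≤) (head-fits ⟦ʷ (v ++ ⟧ʷ ∷ w) g g≤))
    (moveBalanced bal (nested-depth d≤) (prefix f₁ f₁≤) (prefix g₁ g₁≤)
    (loop refl (ifNo refl (ifYes refl (pop refl)) ⨾
        moveSymbol-spec j j′ ⟧ʷ (head-fits ⟧ʷ w f₂ f₂≤) (head-fits ⟧ʷ w g₂ g₂≤))
    (moveBalanced bal′ (≤-trans (+-monoˡ-≤ _ w≤) d≤) (keep-bound j (⟧ʷ ∷ []) w f₂ f₂≤)
        (keep-bound j′ (⟧ʷ ∷ []) w g₂ g₂≤)
      (subst₂ (λ f g → brackets ⊢[ H ] h , stacks e (y ∷ d) f g ⇓ mem) (keeps j f)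
          (keeps j′ g) k)))))
    where
    f₁ = keep j (⟦ʷ ∷ []) f
    g₁ = keep j′ (⟦ʷ ∷ []) g
    f₂ = keep j v f₁
    g₂ = keep j′ v g₁
    f₁≤ = keep-bound j (⟦ʷ ∷ []) (v ++ ⟧ʷ ∷ w) f f≤
    g₁≤ = keep-bound j′ (⟦ʷ ∷ []) (v ++ ⟧ʷ ∷ w) g g≤
    f₂≤ = keep-bound j v (⟧ʷ ∷ w) f₁ f₁≤
    g₂≤ = keep-bound j′ v (⟧ʷ ∷ w) g₁ g₁≤

    v≤ : length v ≤ length (v ++ ⟧ʷ ∷ w)
    v≤ = ≤-trans (m≤m+n _ _) (≤-reflexive (sym (length-++ v)))

    w≤ : length w ≤ suc (length (v ++ ⟧ʷ ∷ w))
    w≤ = ≤-trans (n≤1+n _) (≤-trans (m≤n+m _ (length v))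
        (≤-trans (≤-reflexive (sym (length-++ v))) (n≤1+n _)))

    prefix : ∀ f → length (v ++ ⟧ʷ ∷ w) + length f ≤ H → length v + length {A = WorkSymbol} f ≤ H
    prefix f = ≤-trans (+-monoˡ-≤ (length f) v≤)

    nested-depth : suc (length (v ++ ⟧ʷ ∷ w)) + length (y ∷ d) ≤ H →
        length v + suc (length (y ∷ d)) ≤ H
    nested-depth = ≤-trans (≤-trans (≤-reflexive (+-suc (length v) _)) (s≤s (+-monoˡ-≤ _ v≤)))

    keeps : ∀ j f → keep j (⟦ʷ ∷ v ++ ⟧ʷ ∷ w) f ≡ keep j w
        (keep j (⟧ʷ ∷ []) (keep j v (keep j (⟦ʷ ∷ []) f)))
    keeps j f = trans (keep-++ j (⟦ʷ ∷ []) _ f) (trans (keep-++ j v _ _) (keep-++ j (⟧ʷ ∷ []) w _))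

  moveEntry-spec : ∀ {w e f g} → Balanced w → let v = ⟦ʷ ∷ w ++ ⟧ʷ ∷ [] in
    length v + length f ≤ H → length v + length g ≤ H →
    moveEntry ⊢[ H ] h , stacks (⟦ʷ ∷ w ++ ⟧ʷ ∷ e) [] f g ⇓ h , stacks e [] (keep j v f)
        (keep j′ v g)
  moveEntry-spec {w} {e} {f} {g} bal f≤ g≤ =
    push 1≤H ⨾ (moveSymbol-spec j j′ ⟦ʷ (head-fits ⟦ʷ (w ++ ⟧ʷ ∷ []) f f≤)
        (head-fits ⟦ʷ (w ++ ⟧ʷ ∷ []) g g≤) ⨾
    moveBalanced bal w+1≤ (prefix f₁ f₁≤) (prefix g₁ g₁≤)
      (loop refl (ifNo refl (ifYes refl (pop refl)) ⨾
          moveSymbol-spec j j′ ⟧ʷ (head-fits ⟧ʷ [] f₂ f₂≤) (head-fits ⟧ʷ [] g₂ g₂≤))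
        (conv refl (cong₂ (stacks e []) (sym (keeps j f)) (sym (keeps j′ g))) (done refl))))
    where
    f₁ = keep j (⟦ʷ ∷ []) f
    g₁ = keep j′ (⟦ʷ ∷ []) g
    f₂ = keep j w f₁
    g₂ = keep j′ w g₁
    f₁≤ = keep-bound j (⟦ʷ ∷ []) (w ++ ⟧ʷ ∷ []) f f≤
    g₁≤ = keep-bound j′ (⟦ʷ ∷ []) (w ++ ⟧ʷ ∷ []) g g≤
    f₂≤ = keep-bound j w (⟧ʷ ∷ []) f₁ f₁≤
    g₂≤ = keep-bound j′ w (⟧ʷ ∷ []) g₁ g₁≤

    1≤H : 1 ≤ H
    1≤H = ≤-trans (s≤s z≤n) f≤

    w+1≡ : length (w ++ ⟧ʷ ∷ []) ≡ length w + 1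
    w+1≡ = length-++ w

    w+1≤ : length w + 1 ≤ H
    w+1≤ = ≤-trans (≤-reflexive (sym w+1≡)) (≤-trans (≤-trans (n≤1+n _) (m≤m+n _ (length f))) f≤)

    prefix : ∀ f → length (w ++ ⟧ʷ ∷ []) + length f ≤ H → length w + length {A = WorkSymbol} f ≤ H
    prefix f = ≤-trans (+-monoˡ-≤ (length f) (≤-trans (m≤m+n _ 1) (≤-reflexive (sym w+1≡))))

    keeps : ∀ j f → keep j (⟦ʷ ∷ w ++ ⟧ʷ ∷ []) f ≡ keep j (⟧ʷ ∷ []) (keep j w (keep j (⟦ʷ ∷ []) f))
    keeps j f = trans (keep-++ j (⟦ʷ ∷ []) _ f) (keep-++ j w _ _)

home entryStep filterEnv : Cmd 13
home = clear present active ⨾ copy present temp saved active ⨾ goto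
-- The opening bracket is lifted for a moment to reach the address of the binder. The head is on the
-- application symbol, so the argument is scanned before the function part; its flag goes to `hit′`
-- because `scan` needs `hit` empty. As `toOpen` counts `active` down, `home` is needed again at the
-- end.
entryStep =
  pop env ⨾ copy isBit temp env key ⨾ put env ⟦ʷ ⨾
  moveIn right ⨾ scan ⨾ move present hit hit′ ⨾
  home ⨾ toOpen ⨾ moveIn right ⨾ scan ⨾
  moveEntry ⨾ clear present hit ⨾ clear present hit′ ⨾ clear present key ⨾ home
-- On an application t · u, distributes the entries of the environment to
-- the free variables of t, in buf₁, and to those of u, in buf₂.
filterEnv = while (onTop env present) entryStep

isBit-bits : ∀ bs → All′ isBit (bits bs)
isBit-bits []       = []
isBit-bits (b ∷ bs) = refl ∷ isBit-bits bs

binds : ∀ {t₀} → Term → (Var → ℕ) → ℕ → Entry t₀ → Bool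
binds t σ i (b ← c) = occurs (binary (leftAddress b)) σ i t

module _ {H : ℕ} {t₀ : Term} (t u : Term) {σ : Var → ℕ} {i p : ℕ} {ls rs : List CodeSymbol}
  (index : suc (constructors (encode σ i t ʳ++ openˢ ∷ ls)) ≡ i + size t)
  (fits : Fits H (i + size t)) (fits-p : Fits H p) (t≤p : applications t ≤ p)
      (cont : Continuation p u rs) where

  private
    i′ = i + suc (size t)
    lsₐ = encode σ i t ʳ++ openˢ ∷ ls

    atApp : Input
    atApp = lsₐ ▹ appˢ ∷ encode σ i′ u ++ rs

    stacks : List WorkSymbol → List WorkSymbol → List WorkSymbol → List WorkSymbol → Stacks 13
    stacks s e f g = st (num (i + size t)) e s [] f g [] [] [] [] [] (num p) (num (i + size t))

  home-spec : ∀ h {a e s f g q d r r′ m} → word h ≡ word atApp →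
    home ⊢[ H ] h , st a e s [] f g q d [] r r′ m (num (i + size t))
             ⇓ atApp , st (num (i + size t)) e s [] f g q d [] r r′ m (num (i + size t))
  home-spec h w≡ =
    clearAll-spec ⨾ (duplicate-spec (λ ()) (λ ()) (λ ()) refl refl (fits-num fits) ⨾
    goto-spec h lsₐ w≡ refl index fits)

  entryStep-spec : ∀ (x : Entry t₀) {s e f g} → let v = ⟦ʷ ∷ entryBody x ++ ⟧ʷ ∷ [] in
    length (⟦ʷ ∷ entryBody x ++ ⟧ʷ ∷ e) ≤ H → length v + length f ≤ H → length v + length g ≤ H →
    entryStep ⊢[ H ] atApp , stacks s (⟦ʷ ∷ entryBody x ++ ⟧ʷ ∷ e) f g
                  ⇓ atApp , stacks s e (keep (binds t σ i x) v f) (keep (binds u σ i′ x) v g)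
  entryStep-spec x@(b ← c) {s} {e} {f} {g} e≤ f≤ g≤ =
    pop refl ⨾ (getKey ⨾ (push e≤ ⨾
        (moveIn ⨾ (scan-spec k u k≤H 1≤H fits-p cont ⨾ (keepFlag (occurs k σ i′ u) ⨾
    (home-spec (encode σ i′ u ʳ++ appˢ ∷ lsₐ ▹ rs) (ʳ++-ʳ++ (encode σ i′ u)) ⨾
    (toOpen-spec t refl fits ⨾ (moveIn ⨾ (scan-spec k t k≤H 1≤H fits-p (apply t≤p) ⨾
    (moveEntry-spec (occurs k σ i t) (occurs k σ i′ u) (balanced-entryBody x) f≤ g≤ ⨾
    (clearAll-spec ⨾ (clearAll-spec ⨾ (clearAll-spec ⨾
    home-spec (encode σ i t ʳ++ openˢ ∷ ls ▹ appˢ ∷ encode σ i′ u ++ rs) refl)))))))))))))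
    where
    k = binary (leftAddress b)

    length-key : length (bits k) + length (←ʷ ∷ closureString c ++ ⟧ʷ ∷ e) ≤ H
    length-key = ≤-trans (≤-reflexive (trans (sym (length-++ (bits k)))
                   (cong length (sym (++-assoc (bits k) (←ʷ ∷ closureString c) (⟧ʷ ∷ e))))))
                 (≤-trans (n≤1+n _) e≤)

    bits≤ : length (bits k) ≤ H
    bits≤ = ≤-trans (m≤m+n _ _) length-key

    k≤H : length k ≤ H
    k≤H = ≤-trans (≤-reflexive (sym (length-map bitʷ k))) bits≤

    1≤H : 1 ≤ H
    1≤H = ≤-trans (s≤s z≤n) e≤

    getKey : ∀ {h a s f g d n r r′ m z} → copy isBit temp env key
      ⊢[ H ] h , st a (entryBody x ++ ⟧ʷ ∷ e) s [] f g [] d n r r′ m z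
           ⇓ h , st a (entryBody x ++ ⟧ʷ ∷ e) s [] f g (bits k) d n r r′ m z
    getKey {a = a} {s} {f} {g} {d} {n} {r} {r′} {m} {z} =
      conv refl (cong (λ q → st a (entryBody x ++ ⟧ʷ ∷ e) s [] f g q d n r r′ m z)
          (++-identityʳ (bits k)))
      (copy-spec (bits k) (λ ()) (λ ()) (λ ())
        (++-assoc (bits k) (←ʷ ∷ closureString c) (⟧ʷ ∷ e)) refl (isBit-bits k) refl
        (≤-trans (≤-reflexive (length-++ (bits k))) length-key)
        (≤-trans (≤-reflexive (cong length (++-identityʳ (bits k)))) bits≤))

    keepFlag : ∀ j {h a e s b f g q d n m z} → move present hit hit′
      ⊢[ H ] h , st a e s b f g q d n (flag j) [] m z ⇓ h , st a e s b f g q d n [] (flag j) m z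
    keepFlag true  = moveAll-spec (λ ()) 1≤H
    keepFlag false = moveAll-spec (λ ()) z≤n

  filterEnv-spec : ∀ (e : Env t₀) {s f g} → length (envString e) + length f ≤ H →
      length (envString e) + length g ≤ H →
    filterEnv ⊢[ H ] atApp , stacks s (envString e) f g
                  ⇓ atApp , stacks s [] (envString (filterᵇ (binds t σ i) e) ʳ++ f)
                      (envString (filterᵇ (binds u σ i′) e) ʳ++ g)
  filterEnv-spec []       f≤ g≤ = done refl
  filterEnv-spec (x ∷ e) {s} {f} {g} f≤ g≤ =
    conv (cong (λ e → stacks s e f g) (sym (envString-∷ x e)))
        (cong₂ (stacks s []) (kept (binds t σ i) f) (kept (binds u σ i′) g))
    (loop refl
      (entryStep-spec x (≤-trans (≤-reflexive (cong length (sym (envString-∷ x e))))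
          (≤-trans (m≤m+n _ (length f)) f≤))
        (≤-trans (+-monoˡ-≤ (length f) v≤) f≤) (≤-trans (+-monoˡ-≤ (length g) v≤) g≤))
      (filterEnv-spec e (keep-bound (binds t σ i x) v (envString e) f
          (≤-trans (≤-reflexive (cong (λ w → length w + length f) (sym env≡))) f≤))
                        (keep-bound (binds u σ i′ x) v (envString e) g
                            (≤-trans (≤-reflexive (cong (λ w → length w + length g) (sym env≡)))
                            g≤))))
    where
    v = ⟦ʷ ∷ entryBody x ++ ⟧ʷ ∷ []

    env≡ : envString (x ∷ e) ≡ v ++ envString e
    env≡ = trans (envString-∷ x e) (cong (⟦ʷ ∷_) (sym (++-assoc (entryBody x) (⟧ʷ ∷ []) _)))

    v≤ : length v ≤ length (envString (x ∷ e))
    v≤ = ≤-trans (m≤m+n _ _) (≤-reflexive (trans (sym (length-++ v)) (cong length (sym env≡))))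

    kept : ∀ φ f → envString (filterᵇ φ e) ʳ++ keep (φ x) v f ≡ envString (filterᵇ φ (x ∷ e)) ʳ++ f
    kept φ f with φ x
    ... | false = refl
    ... | true  = trans (sym (++-ʳ++ v)) (cong (_ʳ++ f) (trans
      (cong (⟦ʷ ∷_) (++-assoc (entryBody x) (⟧ʷ ∷ []) _)) (sym (envString-∷ x (filterᵇ φ e)))))

-- The machine

-- As a binary notation, this is the greatest number of length `L`. The limit can thus be updated by
-- comparing lengths alone, and copied to a counter as it stands.
unary : ℕ → List WorkSymbol
unary L = bits (replicate L 1b)

raiseLimit : Cmd 13
-- Makes the stack limit, of ones only, at least as high as the stack active.
raiseLimit =
  while (onTop active present)
    (push temp active (topOf id) ⨾ pop active ⨾ cond (onTop limit present) (pop limit) skip) ⨾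
  while (onTop temp present)
    (push active temp (topOf id) ⨾ put limit (bitʷ 1b) ⨾ pop temp)

lamCase strip pushArg appCase subCase transition initialise : Cmd 13
-- If the variable occurs, the new entry is built from its end, since stacks grow at the front:
-- closing bracket, closure, arrow, address, opening bracket. The binder is the active abstraction
-- itself, so its address is copied from `active`.
lamCase =
  copy present temp active key ⨾ moveIn right ⨾ scan ⨾ clear present key ⨾
  cond (onTop hit present)
    (pop hit ⨾ put env ⟧ʷ ⨾ move notEnd stk buf₁ ⨾ pop stk ⨾ move present buf₁ env ⨾
     put env ←ʷ ⨾ copy present temp active env ⨾ put env ⟦ʷ)
    (clear notEnd stk ⨾ pop stk) ⨾
  goto ⨾ moveIn right ⨾ increment temp active ⨾ toRoot

strip =
  pop stk ⨾ clear isBit stk ⨾ pop stk ⨾ move notEnd stk buf₁ ⨾ pop buf₁ ⨾ move present buf₁ stk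
pushArg = increment temp active ⨾ toRoot ⨾ copy present temp active stk
-- The environment of the argument is put on the stack also if the
-- argument is a variable x; it then has a single entry [x←c], which is
-- stripped to c.
appCase =
  copy present temp active saved ⨾ filterEnv ⨾ move present buf₁ env ⨾ put stk endʷ ⨾
  move present buf₂ stk ⨾ moveIn right ⨾ cond (onInput isVar) strip pushArg ⨾
  home ⨾ toOpen ⨾ moveIn right ⨾ toRoot ⨾ clear present saved

-- Here as well, the environment has a single entry.
subCase =
  pop env ⨾ clear isBit env ⨾ pop env ⨾ clear present active ⨾
  move isBit env temp ⨾ move present temp active ⨾
  move present env buf₁ ⨾ pop buf₁ ⨾ move present buf₁ env ⨾ goto

transition = raiseLimit ⨾ cond (onInput isLam) lamCase (cond (onInput isVar) subCase appCase)

initialise = put active (bitʷ 1b) ⨾ toRoot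

-- Correctness of the programs for the transitions.

length-++-≤ʳ : ∀ {A : Set} (xs : List A) {ys} → length ys ≤ length (xs ++ ys)
length-++-≤ʳ xs = ≤-trans (m≤n+m _ (length xs)) (≤-reflexive (sym (length-++ xs)))

length-++-≤ˡ : ∀ {A : Set} (xs : List A) {ys} → length xs ≤ length (xs ++ ys)
length-++-≤ˡ xs = ≤-trans (m≤m+n (length xs) _) (≤-reflexive (sym (length-++ xs)))

length-rev : ∀ {A : Set} (xs : List A) → length (xs ʳ++ []) ≡ length xs
length-rev xs = trans (length-ʳ++ xs) (+-identityʳ _)

rev-rev : ∀ {A : Set} (xs : List A) {ys} → (xs ʳ++ []) ʳ++ ys ≡ xs ++ ys
rev-rev xs = ʳ++-ʳ++ xs

-- The length `length a + (L ∸ length a)` is the maximum of `length a` and `L`: one loop removes as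
-- many ones as it can while unloading `a`, and the other adds a one for each symbol of `a`.
raiseLimit-spec : ∀ a L → length a ≤ H → L ≤ H →
  raiseLimit ⊢[ H ] h , st a e s [] f g q d n r r′ (unary L) z
               ⇓ h , st a e s [] f g q d n r r′ (unary (length a + (L ∸ length a))) z
raiseLimit-spec {H} {h} {e} {s} {f} {g} {q} {d} {n} {r} {r′} {z} a L a≤H L≤H =
  down a [] L (subst (_≤ H) (sym (+-identityʳ _)) a≤H) ⨾
  subst₂ (λ a′ l → loop₂ ⊢[ H ] h , st [] e s (a ʳ++ []) f g q d n r r′ (unary (L ∸ length a)) z
                       ⇓ h , st a′ e s [] f g q d n r r′ (unary l) z)
    (trans (rev-rev a) (++-identityʳ a)) (cong (_+ (L ∸ length a)) (length-rev a))
    (up (a ʳ++ []) [] (L ∸ length a) (subst (_≤ H) (sym (trans (+-identityʳ _) (length-rev a))) a≤H)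
      (subst (_≤ H) (sym (cong (_+ (L ∸ length a)) (length-rev a))) total))
  where
  loop₁ = while (onTop active present)
    (push temp active (topOf id) ⨾ pop active ⨾ cond (onTop limit present) (pop limit) skip)
  loop₂ = while (onTop temp present)
    (push active temp (topOf id) ⨾ put limit (bitʷ 1b) ⨾ pop temp)

  total : length a + (L ∸ length a) ≤ H
  total with ≤-total (length a) L
  ... | inj₁ a≤L = ≤-trans (≤-reflexive (m+[n∸m]≡n a≤L)) L≤H
  ... | inj₂ L≤a = ≤-trans (≤-reflexive
      (trans (cong (length a +_) (m≤n⇒m∸n≡0 L≤a)) (+-identityʳ _))) a≤H

  down : ∀ a b L → length a + length b ≤ H →
    loop₁ ⊢[ H ] h , st a e s b f g q d n r r′ (unary L) z
             ⇓ h , st [] e s (a ʳ++ b) f g q d n r r′ (unary (L ∸ length a)) z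
  down []      b L       bound = done refl
  down (x ∷ a) b zero    bound =
    loop refl (push (≤-trans (s≤s (m≤n+m _ (length a))) bound) ⨾ (pop refl ⨾ ifNo refl moveIn))
      (subst (λ l → loop₁ ⊢[ H ] h , st a e s (x ∷ b) f g q d n r r′ [] z
                             ⇓ h , st [] e s (a ʳ++ x ∷ b) f g q d n r r′ (unary l) z)
        (0∸n≡0 (length a)) (down a (x ∷ b) 0 (≤-trans (≤-reflexive (+-suc _ _)) bound)))
  down (x ∷ a) b (suc L) bound =
    loop refl (push (≤-trans (s≤s (m≤n+m _ (length a))) bound) ⨾ (pop refl ⨾ ifYes refl (pop refl)))
      (down a (x ∷ b) L (≤-trans (≤-reflexive (+-suc _ _)) bound))

  up : ∀ b a L → length b + length a ≤ H → length b + L ≤ H →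
    loop₂ ⊢[ H ] h , st a e s b f g q d n r r′ (unary L) z
             ⇓ h , st (b ʳ++ a) e s [] f g q d n r r′ (unary (length b + L)) z
  up []      a L bound bound′ = done refl
  up (x ∷ b) a L bound bound′ =
    loop refl (push (≤-trans (s≤s (m≤n+m _ (length b))) bound) ⨾
              (push (≤-trans (s≤s (≤-reflexive
                  (trans (length-map bitʷ (replicate L 1b)) (length-replicate L))))
                  (≤-trans (s≤s (m≤n+m L (length b))) bound′)) ⨾ pop refl))
      (subst (λ l → loop₂ ⊢[ H ] h , st (x ∷ a) e s b f g q d n r r′ (unary (suc L)) z
                             ⇓ h , st (b ʳ++ x ∷ a) e s [] f g q d n r r′ (unary l) z)
        (+-suc (length b) L)
        (up b (x ∷ a) (suc L) (≤-trans (≤-reflexive (+-suc _ _)) bound)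
            (≤-trans (≤-reflexive (+-suc _ _)) bound′)))

rootHead : List CodeSymbol → (Var → ℕ) → ℕ → Term → List CodeSymbol → Input
rootHead ls σ i t rs = beforeCode σ i t ʳ++ ls ▹ afterCode σ i t ++ rs

resting : List WorkSymbol → List WorkSymbol → List WorkSymbol → List WorkSymbol → Stacks 13
resting a e s m = st a e s [] [] [] [] [] [] [] [] m []

lamCase-spec : ∀ x t {σ i p c} → suc (constructors ls) ≡ i → Fits H i → Fits H p →
  Continuation p t rs → All′ notEnd c →
  Fits H (suc i + beforeRoot t) → length (c ++ endʷ ∷ s) ≤ H → 1 ≤ H →
  let j = occurs (binary i) (σ [ x ↦ i ]) (suc i) t
      e′ = if j then ⟦ʷ ∷ num i ++ ←ʷ ∷ c ++ ⟧ʷ ∷ e else e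
  in length e′ ≤ H →
  lamCase ⊢[ H ] rootHead ls σ i (ƛ x t) rs , resting (num i) e (c ++ endʷ ∷ s) (num p)
            ⇓ rootHead (lamˢ ∷ ls) (σ [ x ↦ i ]) (suc i) t rs , resting (num (suc i + beforeRoot t))
                e′ s (num p)
lamCase-spec {ls} {H} {rs} {s} {e} x t {σ} {i} {p} {c} index fits fits-p cont ended
    fits′ cs≤ 1≤H e′≤ =
  duplicate-spec (λ ()) (λ ()) (λ ()) refl refl (fits-num fits) ⨾ (moveIn ⨾
  (scan-spec (binary i) t (fitting fits) 1≤H fits-p cont ⨾ (clearAll-spec ⨾
  (bind (occurs (binary i) (σ [ x ↦ i ]) (suc i) t) e′≤ ⨾
  (goto-spec (et ʳ++ lamˢ ∷ ls ▹ rs) ls (ʳ++-ʳ++ et) refl index fits ⨾ (moveIn ⨾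
  (increment-spec (λ ()) refl i refl (fits-mono (s≤s (m≤m+n i (beforeRoot t))) fits′) ⨾
  toRoot-spec t refl fits′)))))))
  where
  et = encode (σ [ x ↦ i ]) (suc i) t

  bind : ∀ j {h} → length (if j then ⟦ʷ ∷ num i ++ ←ʷ ∷ c ++ ⟧ʷ ∷ e else e) ≤ H →
    cond (onTop hit present)
      (pop hit ⨾ put env ⟧ʷ ⨾ move notEnd stk buf₁ ⨾ pop stk ⨾ move present buf₁ env ⨾
       put env ←ʷ ⨾ copy present temp active env ⨾ put env ⟦ʷ)
      (clear notEnd stk ⨾ pop stk)
    ⊢[ H ] h , st (num i) e (c ++ endʷ ∷ s) [] [] [] [] [] [] (flag j) [] (num p) []
         ⇓ h , resting (num i) (if j then ⟦ʷ ∷ num i ++ ←ʷ ∷ c ++ ⟧ʷ ∷ e else e) s (num p)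
  bind false e′≤ = ifNo refl (clear-spec c refl ended refl ⨾ pop refl)
  bind true {h} e′≤ = ifYes refl (pop refl ⨾ (push (≤-trans (length-++-≤ʳ c) c⟧e≤) ⨾
    (move-spec c (λ ()) refl ended refl
        (≤-trans (≤-reflexive (length-rev c)) (≤-trans (length-++-≤ˡ c) cs≤)) ⨾
    (pop refl ⨾
    (conv refl (cong (λ e → st (num i) e s [] [] [] [] [] [] [] [] (num p) []) (rev-rev c))
      (moveAll-spec (λ ()) (≤-trans (≤-reflexive (cong length (rev-rev c))) c⟧e≤)) ⨾
    (push (≤-trans (length-++-≤ʳ (num i)) num≤) ⨾
    (copyAll-spec (λ ()) (λ ()) (λ ()) refl num≤ ⨾ push e′≤)))))))
    where
    num≤ : length (num i ++ ←ʷ ∷ c ++ ⟧ʷ ∷ e) ≤ H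
    num≤ = ≤-trans (n≤1+n _) e′≤
    c⟧e≤ : length (c ++ ⟧ʷ ∷ e) ≤ H
    c⟧e≤ = ≤-trans (≤-trans (n≤1+n _) (length-++-≤ʳ (num i))) num≤

-- No marker separates the address of a closure from its environment; the address ends at the next
-- symbol that is not a bit, whence the condition on the head of `e ++ ⟧ʷ ∷ []`.
subCase-spec : ∀ h ls k {j y rs} → word h ≡ ls ʳ++ y ∷ rs → isConstructor (just y) ≡ true →
  suc (constructors ls) ≡ j → Fits H j → isBit (head (e ++ ⟧ʷ ∷ [])) ≡ false →
  length (e ++ ⟧ʷ ∷ []) ≤ H →
  subCase ⊢[ H ] h , resting a (⟦ʷ ∷ bits k ++ ←ʷ ∷ (num j ++ e) ++ ⟧ʷ ∷ []) s m
            ⇓ ls ▹ y ∷ rs , resting (num j) e s m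
subCase-spec {H} {e} {a} {s} {m} h ls k {j} w≡ yc index fits nonbit e≤ =
  pop refl ⨾ (clear-spec (bits k) refl (isBit-bits k) refl ⨾ (pop refl ⨾ (clearAll-spec ⨾
  (move-spec (num j) (λ ()) (++-assoc (num j) e (⟧ʷ ∷ [])) (isBit-bits (binary j)) nonbit
    (≤-trans (≤-reflexive (length-rev (num j))) (fits-num fits)) ⨾
  (conv refl (cong (λ a → st a (e ++ ⟧ʷ ∷ []) s [] [] [] [] [] [] [] [] m [])
      (trans (rev-rev (num j)) (++-identityʳ _)))
    (moveAll-spec (λ ()) (≤-trans
        (≤-reflexive (trans (length-rev (num j ʳ++ [])) (length-rev (num j)))) (fits-num fits))) ⨾
  (conv refl (cong (λ f → st (num j) [] s [] f [] [] [] [] [] [] m []) (++-ʳ++ e))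
    (moveAll-spec (λ ()) (≤-trans (≤-reflexive (length-rev (e ++ ⟧ʷ ∷ []))) e≤)) ⨾
  (pop refl ⨾
  (conv refl (cong (λ e → st (num j) e s [] [] [] [] [] [] [] [] m [])
      (trans (rev-rev e) (++-identityʳ e)))
    (moveAll-spec (λ ()) (≤-trans (≤-reflexive (trans (length-rev (e ʳ++ [])) (length-rev e)))
        (≤-trans (length-++-≤ˡ e) e≤))) ⨾
  goto-spec h ls w≡ yc index fits))))))))

strip-spec : ∀ k c {s} → All′ notEnd c → length (c ++ ⟧ʷ ∷ endʷ ∷ s) ≤ H →
  strip ⊢[ H ] h , st a e (⟦ʷ ∷ bits k ++ ←ʷ ∷ c ++ ⟧ʷ ∷ endʷ ∷ s) b [] g q d n r r′ m z
          ⇓ h , st a e (c ++ endʷ ∷ s) b [] g q d n r r′ m z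
strip-spec {H} {h} {a} {e} {b} {g} {q} {d} {n} {r} {r′} {m} {z} k c {s} ended bound =
  pop refl ⨾ (clear-spec (bits k) refl (isBit-bits k) refl ⨾ (pop refl ⨾
  (conv refl (cong (λ f → st a e (endʷ ∷ s) b f g q d n r r′ m z) (++-ʳ++ c))
    (move-spec (c ++ ⟧ʷ ∷ []) (λ ()) (sym (++-assoc c (⟧ʷ ∷ []) _)) (ended-++ ended) refl
      (≤-trans (≤-reflexive (length-rev (c ++ ⟧ʷ ∷ [])))
          (≤-trans (≤-trans (length-++-≤ˡ (c ++ ⟧ʷ ∷ []))
          (≤-reflexive (cong length (++-assoc c (⟧ʷ ∷ []) _)))) bound))) ⨾
  (pop refl ⨾
  conv refl (cong (λ s → st a e s b [] g q d n r r′ m z) (rev-rev c))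
    (moveAll-spec (λ ()) (≤-trans (≤-reflexive (cong length (rev-rev c)))
        (≤-trans shorter bound)))))))
  where
  ended-++ : ∀ {c} → All′ notEnd c → All′ notEnd (c ++ ⟧ʷ ∷ [])
  ended-++ []       = refl ∷ []
  ended-++ (p ∷ ps) = p ∷ ended-++ ps

  shorter : length (c ++ endʷ ∷ s) ≤ length (c ++ ⟧ʷ ∷ endʷ ∷ s)
  shorter = subst₂ _≤_ (sym (length-++ c)) (sym (length-++ c)) (+-monoʳ-≤ (length c) (n≤1+n _))

NotVar : Term → Set
NotVar t = ∀ x → t ≢ var x

module _ {H : ℕ} {t₀ : Term} (t u : Term) {σ : Var → ℕ} {i p : ℕ} {ls rs : List CodeSymbol}
  (index : suc (constructors (encode σ i t ʳ++ openˢ ∷ ls)) ≡ i + size t)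
  (fits : Fits H (i + size t)) (fits-p : Fits H p) (t≤p : applications t ≤ p)
      (cont : Continuation p u rs) where

  private
    i′ = i + suc (size t)
    w = word (rootHead ls σ i (t · u) rs)
    φ ψ : Entry t₀ → Bool
    φ = binds t σ i
    ψ = binds u σ i′

    lsᵤ : List CodeSymbol
    lsᵤ = appˢ ∷ (encode σ i t ʳ++ openˢ ∷ ls)

    working : List WorkSymbol → List WorkSymbol → List WorkSymbol → Stacks 13
    working a e s = st a e s [] [] [] [] [] [] [] [] (num p) (num (i + size t))

  -- The treatment of the argument is a hypothesis, since variables are stripped and other terms are
  -- pushed. It may leave the head anywhere in the code and any string on `active`, because `home`
  -- restores both.
  appCase-spec : ∀ (e : Env t₀) {s s′ a} h →
    length (envString e) ≤ H →
    length (envString (filterᵇ φ e)) ≤ H → length (envString (filterᵇ ψ e) ++ endʷ ∷ s) ≤ H →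
    Fits H (i + beforeRoot t) → word h ≡ w →
    cond (onInput isVar) strip pushArg
      ⊢[ H ] lsᵤ ▹ encode σ i′ u ++ rs , working (num (i + size t)) (envString (filterᵇ φ e))
          (envString (filterᵇ ψ e) ++ endʷ ∷ s)
           ⇓ h , working a (envString (filterᵇ φ e)) s′ →
    appCase ⊢[ H ] rootHead ls σ i (t · u) rs , resting (num (i + size t)) (envString e) s (num p)
              ⇓ rootHead (openˢ ∷ ls) σ i t (appˢ ∷ encode σ i′ u ++ rs) , resting
                  (num (i + beforeRoot t)) (envString (filterᵇ φ e)) s′ (num p)
  appCase-spec e {s} {s′} {a} h e≤ e₁≤ e₂≤ fits′ w≡ argument =
    duplicate-spec (λ ()) (λ ()) (λ ()) refl refl (fits-num fits) ⨾
    (filterEnv-spec t u index fits fits-p t≤p cont e (≤-trans (≤-reflexive (+-identityʳ _)) e≤)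
        (≤-trans (≤-reflexive (+-identityʳ _)) e≤) ⨾
    (conv refl (cong (λ e′ → st (num (i + size t)) e′ s [] [] (envString (filterᵇ ψ e) ʳ++ []) [] []
        [] [] [] (num p) (num (i + size t)))
                     (trans (rev-rev (envString (filterᵇ φ e))) (++-identityʳ _)))
      (moveAll-spec (λ ()) (≤-trans
          (≤-reflexive (trans (length-rev (envString (filterᵇ φ e) ʳ++ []))
          (length-rev (envString (filterᵇ φ e))))) e₁≤)) ⨾
    (push (≤-trans (length-++-≤ʳ (envString (filterᵇ ψ e))) e₂≤) ⨾
    (conv refl (cong (working (num (i + size t)) (envString (filterᵇ φ e)))
        (rev-rev (envString (filterᵇ ψ e))))
      (moveAll-spec (λ ()) (≤-trans
          (≤-reflexive (cong length (rev-rev (envString (filterᵇ ψ e))))) e₂≤)) ⨾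
    (moveIn ⨾ (argument ⨾
    (home-spec {t₀ = t₀} t u index fits fits-p t≤p cont h w≡ ⨾
    (toOpen-spec t refl fits ⨾ (moveIn ⨾ (toRoot-spec t refl fits′ ⨾ clearAll-spec))))))))))

  pushArg-spec : NotVar u → ∀ {e s} → Fits H (i′ + beforeRoot u) →
      length (num (i′ + beforeRoot u) ++ s) ≤ H →
    cond (onInput isVar) strip pushArg
      ⊢[ H ] lsᵤ ▹ encode σ i′ u ++ rs , working (num (i + size t)) e s
           ⇓ rootHead lsᵤ σ i′ u rs , working (num (i′ + beforeRoot u)) e
               (num (i′ + beforeRoot u) ++ s)
  pushArg-spec notVar {e} {s} fits′ bound =
    ifNo (unequal u notVar)
      (increment-spec (λ ()) refl (i + size t) refl
          (fits-mono (≤-trans (≤-reflexive (sym (+-suc i (size t)))) (m≤m+n i′ (beforeRoot u)))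
          fits′) ⨾
      (toRoot-spec u (cong (_+ beforeRoot u) (sym (+-suc i (size t)))) fits′ ⨾
      copyAll-spec (λ ()) (λ ()) (λ ()) refl bound))
    where
    unequal : ∀ u → NotVar u → isVar (head (encode σ i′ u ++ rs)) ≡ false
    unequal (var x) notVar = contradiction refl (notVar x)
    unequal (ƛ x u) notVar = refl
    unequal (u · v) notVar = refl

-- Occurrences in the code

scope : ∀ {t₀ t} → Occ t₀ t → Var → ℕ
scope root         = λ _ → 0
scope (body {x} o) = scope o [ x ↦ first o ]
scope (fun o)      = scope o
scope (arg o)      = scope o

-- The code before an occurrence, in reverse order.
before : ∀ {t₀ t} → Occ t₀ t → List CodeSymbol
before root          = []
before (body o)      = lamˢ ∷ before o
before (fun o)       = openˢ ∷ before o
before (arg {t = t} o) = appˢ ∷ (encode (scope o) (first o) t ʳ++ openˢ ∷ before o)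

after : ∀ {t₀ t} → Occ t₀ t → List CodeSymbol
after root                  = []
after (body o)              = after o
after (fun {t = t} {u} o)   = appˢ ∷ encode (scope o) (first o + suc (size t)) u ++ after o
after (arg o)               = after o

code-at : ∀ {t₀ t} (o : Occ t₀ t) → before o ʳ++ encode (scope o) (first o) t ++ after o ≡
    codeString t₀
code-at root                = ++-identityʳ _
code-at (body o)            = code-at o
code-at (fun {t = t} o)     =
  trans (cong (λ w → before o ʳ++ openˢ ∷ w)
      (sym (++-assoc (encode (scope o) (first o) t) _ (after o)))) (code-at o)
code-at (arg {t = t} o)     = trans (ʳ++-ʳ++ (encode (scope o) (first o) t))
  (trans (cong (λ w → before o ʳ++ openˢ ∷ w)
      (sym (++-assoc (encode (scope o) (first o) t) _ (after o)))) (code-at o))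

constructors-++ : ∀ xs ys → constructors (xs ++ ys) ≡ constructors xs + constructors ys
constructors-++ []       ys = refl
constructors-++ (x ∷ xs) ys with isConstructor (just x)
... | true  = cong suc (constructors-++ xs ys)
... | false = constructors-++ xs ys

constructors-encode : ∀ t {σ i} → constructors (encode σ i t) ≡ size t
constructors-encode (var x) {σ} = cong suc (constructors-bits (binary (σ x)))
  where
  constructors-bits : ∀ bs → constructors (encodeBits bs) ≡ 0
  constructors-bits []       = refl
  constructors-bits (b ∷ bs) = constructors-bits bs
constructors-encode (ƛ x t) = cong suc (constructors-encode t)
constructors-encode (t · u) {σ} {i} = trans (constructors-++ (encode σ i t) _)
  (cong₂ (λ m n → m + suc n) (constructors-encode t) (constructors-encode u))

constructors-opened : ∀ t {σ i ls} →
  constructors (encode σ i t ʳ++ openˢ ∷ ls) ≡ size t + constructors ls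
constructors-opened t {σ} {i} {ls} =
  trans (constructors-ʳ++ (encode σ i t) (openˢ ∷ ls))
      (cong (_+ constructors ls) (constructors-encode t))

index-first : ∀ {t₀ t} (o : Occ t₀ t) → suc (constructors (before o)) ≡ first o
index-first root            = refl
index-first (body o)        = cong suc (index-first o)
index-first (fun o)         = index-first o
index-first (arg {t = t} o) = begin
  suc (suc (constructors (encode (scope o) (first o) t ʳ++ openˢ ∷ before o)))
    ≡⟨ cong (λ n → suc (suc n)) (constructors-opened t) ⟩
  suc (suc (size t + constructors (before o)))
    ≡⟨ cong suc (+-comm (suc (size t)) _) ⟩
  suc (constructors (before o)) + suc (size t)
    ≡⟨ cong (_+ suc (size t)) (index-first o) ⟩
  first o + suc (size t) ∎
  where open ≡-Reasoning

index-app : ∀ {t₀ t u} (o : Occ t₀ (t · u)) →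
  suc (constructors (encode (scope o) (first o) t ʳ++ openˢ ∷ before o)) ≡ first o + size t
index-app {t = t} o = begin
  suc (constructors (encode (scope o) (first o) t ʳ++ openˢ ∷ before o))
    ≡⟨ cong suc (trans (constructors-opened t) (+-comm (size t) _)) ⟩
  suc (constructors (before o)) + size t
    ≡⟨ cong (_+ size t) (index-first o) ⟩
  first o + size t ∎
  where open ≡-Reasoning

rootOf : ∀ {t₀ t} → Occ t₀ t → Input
rootOf {t = t} o = rootHead (before o) (scope o) (first o) t (after o)

word-rootOf : ∀ {t₀ t} (o : Occ t₀ t) → word (rootOf o) ≡ codeString t₀
word-rootOf {t = var x} o = code-at o
word-rootOf {t = ƛ x t} o = code-at o
word-rootOf {t = t · u} o = trans (ʳ++-ʳ++ (encode (scope o) (first o) t)) (code-at (fun o))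

-- In a substitution step the next active term has an unknown shape. This hides the case distinction
-- in `rootOf` and keeps just what `goto-spec` asks for.
record AtConstructor (h : Input) (k : ℕ) : Set where
  constructor atConstructor
  field
    {left-of} : List CodeSymbol
    {symbol}  : CodeSymbol
    {right-of} : List CodeSymbol
    head≡     : h ≡ (left-of ▹ symbol ∷ right-of)
    is        : isConstructor (just symbol) ≡ true
    index     : suc (constructors left-of) ≡ k

root-at : ∀ {t₀ t} (o : Occ t₀ t) → AtConstructor (rootOf o) (leftAddress o)
root-at {t = var x} o = atConstructor refl refl (trans (index-first o) (sym (+-identityʳ _)))
root-at {t = ƛ x t} o = atConstructor refl refl (trans (index-first o) (sym (+-identityʳ _)))
root-at {t = t · u} o = atConstructor refl refl (index-app o)

first-positive : ∀ {t₀ t} (o : Occ t₀ t) → 1 ≤ first o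
first-positive o = ≤-trans (s≤s z≤n) (≤-reflexive (index-first o))

address-positive : ∀ {t₀ t} (o : Occ t₀ t) → 1 ≤ leftAddress o
address-positive o = ≤-trans (first-positive o) (m≤m+n _ _)

-- Binders

binary-injective : ∀ {m n} → binary m ≡ binary n → m ≡ n
binary-injective {m} {n} eq = trans (sym (fromDigits-binary m))
    (trans (cong fromDigits eq) (fromDigits-binary n))

==-reflects : ∀ bs cs → Reflects (bs ≡ cs) (bs == cs)
==-reflects []              []              = ofʸ refl
==-reflects []              (c ∷ cs)        = ofⁿ λ ()
==-reflects (zero ∷ bs)     []              = ofⁿ λ ()
==-reflects (suc zero ∷ bs) []              = ofⁿ λ ()
==-reflects (zero ∷ bs)     (suc zero ∷ cs) = ofⁿ λ ()
==-reflects (suc zero ∷ bs) (zero ∷ cs)     = ofⁿ λ ()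
==-reflects (zero ∷ bs)     (zero ∷ cs)     with bs == cs | ==-reflects bs cs
... | true  | ofʸ refl = ofʸ refl
... | false | ofⁿ ≢    = ofⁿ λ { refl → ≢ refl }
==-reflects (suc zero ∷ bs) (suc zero ∷ cs) with bs == cs | ==-reflects bs cs
... | true  | ofʸ refl = ofʸ refl
... | false | ofⁿ ≢    = ofⁿ λ { refl → ≢ refl }

reflects-⇔ : ∀ {P Q : Set} {b} → (P → Q) → (Q → P) → Reflects P b → Reflects Q b
reflects-⇔ f g (ofʸ p)  = ofʸ (f p)
reflects-⇔ f g (ofⁿ ¬p) = ofⁿ (¬p ∘ g)

reflects-∨ : ∀ {P Q R : Set} {b c} → (P → R) → (Q → R) → (R → P ⊎ Q) →
  Reflects P b → Reflects Q c → Reflects R (b ∨ c)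
reflects-∨ f g k (ofʸ p)  _        = ofʸ (f p)
reflects-∨ f g k (ofⁿ ¬p) (ofʸ q)  = ofʸ (g q)
reflects-∨ f g k (ofⁿ ¬p) (ofⁿ ¬q) = ofⁿ λ r → [ ¬p , ¬q ]′ (k r)

update-same : ∀ (σ : Var → ℕ) x n → (σ [ x ↦ n ]) x ≡ n
update-same σ x n with x ≟ x
... | yes _  = refl
... | no x≢x = contradiction refl x≢x

update-other : ∀ (σ : Var → ℕ) x n {y} → y ≢ x → (σ [ x ↦ n ]) y ≡ σ y
update-other σ x n {y} y≢x with y ≟ x
... | yes y≡x = contradiction y≡x y≢x
... | no _    = refl

Below : (Var → ℕ) → ℕ → Set
Below σ i = ∀ y → σ y < i

below-update : ∀ {σ i} x → Below σ i → Below (σ [ x ↦ i ]) (suc i)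
below-update x below y with y ≟ x
... | yes _ = ≤-refl
... | no _  = m≤n⇒m≤1+n (below y)

-- The binders inside `t` are numbered from `i` upwards, beyond `k`, so that the index `k` could
-- come only from `σ`.
occurs-absent : ∀ t {σ i k} → k < i → (∀ y → σ y ≢ k) → occurs (binary k) σ i t ≡ false
occurs-absent (var x) {σ} {k = k} k<i absent with binary (σ x) == binary k | ==-reflects
    (binary (σ x)) (binary k)
... | true  | ofʸ eq = contradiction (binary-injective eq) (absent x)
... | false | _      = refl
occurs-absent (ƛ x t) {σ} {i} {k} k<i absent = occurs-absent t (m≤n⇒m≤1+n k<i) absent′
  where
  absent′ : ∀ y → (σ [ x ↦ i ]) y ≢ k
  absent′ y with y ≟ x
  ... | yes _ = λ i≡k → <⇒≢ k<i (sym i≡k)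
  ... | no _  = absent y
occurs-absent (t · u) {i = i} k<i absent =
  cong₂ _∨_ (occurs-absent t k<i absent) (occurs-absent u (≤-trans k<i (m≤m+n i _)) absent)

-- Injectivity is asked for at `x` only, because all names that are free at the root share the value
-- 0. Under an abstraction over `x` itself, the old index of `x` is no longer in the range of the
-- updated map, and `occurs-absent` applies.
occurs-reflects : ∀ t {σ i} x → Below σ i → (∀ y → σ y ≡ σ x → y ≡ x) →
  Reflects (x ∈ fv t) (occurs (binary (σ x)) σ i t)
occurs-reflects (var y) {σ} x below injective =
  reflects-⇔ (λ eq → here (sym (injective y (binary-injective eq)))) (λ { (here refl) → refl })
    (==-reflects (binary (σ y)) (binary (σ x)))
occurs-reflects (ƛ y t) {σ} {i} x below injective with x ≟ y
... | yes refl = subst (Reflects _) (sym (occurs-absent t (m≤n⇒m≤1+n (below x)) absent))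
                   (ofⁿ λ x∈ → proj₂ (∈-filter⁻ (λ z → ¬? (z ≟ x)) {xs = fv t} x∈) refl)
  where
  absent : ∀ z → (σ [ x ↦ i ]) z ≢ σ x
  absent z with z ≟ x
  ... | yes _  = λ i≡ → <⇒≢ (below x) (sym i≡)
  ... | no z≢x = λ eq → z≢x (injective z eq)
... | no x≢y = reflects-⇔ (λ x∈ → ∈-filter⁺ (λ z → ¬? (z ≟ y)) x∈ x≢y)
    (proj₁ ∘ ∈-filter⁻ (λ z → ¬? (z ≟ y)))
  (subst (λ k → Reflects (x ∈ fv t) (occurs (binary k) (σ [ y ↦ i ]) (suc i) t))
      (update-other σ y i x≢y)
    (occurs-reflects t x (below-update y below) injective′))
  where
  injective′ : ∀ z → (σ [ y ↦ i ]) z ≡ (σ [ y ↦ i ]) x → z ≡ x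
  injective′ z eq with z ≟ y
  ... | yes _ = contradiction (trans eq (update-other σ y i x≢y)) (λ i≡ → <⇒≢ (below x) (sym i≡))
  ... | no _  = injective z (trans eq (update-other σ y i x≢y))
occurs-reflects (t · u) {σ} {i} x below injective =
  reflects-∨ ∈-++⁺ˡ (∈-++⁺ʳ (fv t)) (∈-++⁻ (fv t))
    (occurs-reflects t x below injective)
    (occurs-reflects u x (λ y → ≤-trans (below y) (m≤m+n i _)) injective)

scope-below : ∀ {t₀ t} (o : Occ t₀ t) → Below (scope o) (first o)
scope-below root         y = s≤s z≤n
scope-below (body {x} o) y = below-update x (scope-below o) y
scope-below (fun o)      y = scope-below o y
scope-below (arg o)      y = ≤-trans (scope-below o y) (m≤m+n (first o) _)

-- By `scope-below`, an inner binder has a greater index than everything in scope outside, so two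
-- names never share a binder. The value 0, which is no left address, stands for the absence of a
-- binder.
scope-injective : ∀ {t₀ t} (o : Occ t₀ t) {x} → scope o x ≢ 0 → ∀ y → scope o y ≡ scope o x → y ≡ x
scope-injective root         ≢0 y eq = contradiction refl ≢0
scope-injective (body {z} o) {x} ≢0 y eq with x ≟ z | y ≟ z
... | yes refl | yes refl = refl
... | yes refl | no _     = contradiction eq (<⇒≢ (scope-below o y))
... | no _     | yes refl = contradiction (sym eq) (<⇒≢ (scope-below o x))
... | no _     | no _     = scope-injective o ≢0 y eq
scope-injective (fun o) = scope-injective o
scope-injective (arg o) = scope-injective o

-- The limit on the number of applications

mersenne : ℕ → ℕ
mersenne zero    = 0
mersenne (suc L) = suc (mersenne L + mersenne L)

binary-odd : ∀ n → binary (suc (n + n)) ≡ 1b ∷ binary n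
binary-odd zero    = refl
binary-odd (suc n) = cong (inc ∘ inc) (trans (cong binary (+-suc n n)) (binary-odd n))

binary-mersenne : ∀ L → binary (mersenne L) ≡ replicate L 1b
binary-mersenne zero    = refl
binary-mersenne (suc L) = trans (binary-odd (mersenne L)) (cong (1b ∷_) (binary-mersenne L))

num-mersenne : ∀ L → num (mersenne L) ≡ unary L
num-mersenne L = cong bits (binary-mersenne L)

length-mersenne : ∀ L → length (binary (mersenne L)) ≡ L
length-mersenne L = trans (cong length (binary-mersenne L)) (length-replicate L)

-- The successor of a string of `L` ones has length `suc L`, and lengths are monotone, so that a
-- greater `n` would be too long.
≤-mersenne : ∀ {n L} → length (binary n) ≤ L → n ≤ mersenne L
≤-mersenne {n} {L} short = ≮⇒≥ λ L<n → <⇒≱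
    (≤-trans (≤-reflexive (sym long)) (length-binary-mono L<n)) short
  where
  length-inc-ones : ∀ L → length (inc (replicate L 1b)) ≡ suc L
  length-inc-ones zero    = refl
  length-inc-ones (suc L) = cong suc (length-inc-ones L)

  long : length (binary (suc (mersenne L))) ≡ suc L
  long = trans (cong (length ∘ inc) (binary-mersenne L)) (length-inc-ones L)

-- Every application t · u such that o is inside t has a left address of
-- length at most L.
Seen : ∀ {t₀ t} → ℕ → Occ t₀ t → Set
Seen L root     = ⊤
Seen L (body o) = Seen L o
Seen L (fun o)  = occSpace o ≤ L × Seen L o
Seen L (arg o)  = Seen L o

seen-mono : ∀ {t₀ t L L′} (o : Occ t₀ t) → L ≤ L′ → Seen L o → Seen L′ o
seen-mono root     L≤ _         = tt
seen-mono (body o) L≤ seen      = seen-mono o L≤ seen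
seen-mono (fun o)  L≤ (b , seen) = ≤-trans b L≤ , seen-mono o L≤ seen
seen-mono (arg o)  L≤ seen      = seen-mono o L≤ seen

-- Bodies and arguments end together with the term around them and have no more applications than
-- it. For a function part `t`, the address of its application is `first o + size t`, which exceeds
-- the number of applications of `t`.
continuation : ∀ {t₀ t L} (o : Occ t₀ t) → Seen L o → Continuation (mersenne L) t (after o)
continuation root seen = end
continuation (body o) seen with after o | continuation o seen
... | .[]      | end     = end
... | .(_ ∷ _) | apply b = apply b
continuation (fun {t = t} o) (short , _) =
  apply (≤-trans (applications≤size t) (≤-trans (m≤n+m (size t) (first o)) (≤-mersenne short)))
continuation (arg {t = t} {u} o) seen with after o | continuation o seen
... | .[]      | end     = end
... | .(_ ∷ _) | apply b = apply (≤-trans (≤-trans (m≤n+m _ (applications t)) (n≤1+n _)) b)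

-- Reachable states

mutual
  data GoodClosure {t₀ : Term} (L : ℕ) : Closure t₀ → Set where
    clo : ∀ {t} {o : Occ t₀ t} {e} → Seen L o → GoodEnv L o e → GoodClosure L (clo o e)

  -- The equation between `scope o x` and the address of the binder is what turns comparison of
  -- names into comparison of addresses. That names are distinct and free in `t` is what makes the
  -- environment of a variable a single entry.
  data GoodEnv {t₀ : Term} (L : ℕ) {t : Term} (o : Occ t₀ t) : Env t₀ → Set where
    []  : GoodEnv L o []
    bind : ∀ {x u} {b : Occ t₀ (ƛ x u)} {c e} → x ∈ fv t → scope o x ≡ leftAddress b →
      GoodClosure L c → All (λ n → entryVar n ≢ x) e → GoodEnv L o e → GoodEnv L o ((b ← c) ∷ e)

data GoodState {t₀ : Term} (L : ℕ) : State t₀ → Set where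
  good : ∀ {t} {o : Occ t₀ t} {e π} →
    Seen L o → GoodEnv L o e → All (GoodClosure L) π → GoodState L ⟨ o , e , π ⟩

mutual
  goodClosure-mono : ∀ {t₀ L L′} {c : Closure t₀} → L ≤ L′ → GoodClosure L c → GoodClosure L′ c
  goodClosure-mono L≤ (clo {o = o} seen g) = clo (seen-mono o L≤ seen) (goodEnv-mono L≤ g)

  goodEnv-mono : ∀ {t₀ L L′ t} {o : Occ t₀ t} {e} → L ≤ L′ → GoodEnv L o e → GoodEnv L′ o e
  goodEnv-mono L≤ []                   = []
  goodEnv-mono L≤ (bind x∈ x≡ gc ≢x g) = bind x∈ x≡ (goodClosure-mono L≤ gc) ≢x (goodEnv-mono L≤ g)

goodState-mono : ∀ {t₀ L L′} {s : State t₀} → L ≤ L′ → GoodState L s → GoodState L′ s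
goodState-mono L≤ (good {o = o} seen g gs) =
  good (seen-mono o L≤ seen) (goodEnv-mono L≤ g) (All.map (goodClosure-mono L≤) gs)

module _ {t₀ : Term} {L : ℕ} where

  restrict : ∀ {t t′} {o : Occ t₀ t} {o′ : Occ t₀ t′} {e} → (∀ y → scope o′ y ≡ scope o y) →
    GoodEnv L o e → GoodEnv L o′ (e ↾ t′)
  restrict same [] = []
  restrict {t′ = t′} same (bind {x = x} x∈ x≡ gc ≢x g) with x ∈? fv t′
  ... | yes x∈′ = bind x∈′ (trans (same x) x≡) gc (filter⁺ (λ n → entryVar n ∈? fv t′) ≢x)
      (restrict same g)
  ... | no _    = restrict same g

  -- As `x` is not free in `ƛ x t`, the environment has no entry for it yet. Names stay distinct
  -- when one is added, and the other names keep their binders in the scope of the body.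
  enter : ∀ {x t} {o : Occ t₀ (ƛ x t)} {e} → GoodEnv L o e →
      GoodEnv L (body o) e × All (λ n → entryVar n ≢ x) e
  enter [] = [] , []
  enter {x} {t} {o} (bind {x = y} y∈ y≡ gc ≢y g) with ∈-filter⁻ (λ z → ¬? (z ≟ x))
      {xs = fv t} y∈ | enter g
  ... | y∈t , y≢x | g′ , ≢x = bind y∈t
      (trans (update-other (scope o) x (first o) y≢x) y≡) gc ≢y g′ , y≢x ∷ ≢x

  -- For an argument that is a variable, this shows that restricting the environment has already
  -- found `e(x)`: the closure only has to be freed from its entry.
  lookup-unique : ∀ {t} {o : Occ t₀ t} {e x c} → GoodEnv L o e → lookup e x ≡ just c →
    GoodClosure L c × ∃ λ n → entryClosure n ≡ c × e ↾ var x ≡ n ∷ []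
  lookup-unique {e = e₀} {x = x} (bind {x = y} {b = b} {c = c} {e = e} y∈ y≡ gc ≢y g) eq with y ≟ x
  ... | yes refl with trans (sym
      (cong (Maybe.map entryClosure ∘ head)
      (filter-accept (λ n → entryVar n ≟ x) {b ← c} {e} refl))) eq
  ...   | refl = gc , (b ← c) , refl , trans
      (filter-accept (λ n → entryVar n ∈? (x ∷ [])) {b ← c} {e} (here refl))
      (cong ((b ← c) ∷_)
        (filter-none (λ n → entryVar n ∈? (x ∷ [])) (All.map (λ { ≢x (here refl) → ≢x refl }) ≢y)))
  lookup-unique {x = x} (bind {x = y} {b = b} {c = c} {e = e} y∈ y≡ gc ≢y g) eq | no y≢x
    with lookup-unique g (trans
        (sym (cong (Maybe.map entryClosure ∘ head)
        (filter-reject (λ n → entryVar n ≟ x) {b ← c} {e} y≢x))) eq)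
  ... | gc′ , n , n≡ , single = gc′ , n , n≡ ,
    trans (filter-reject (λ n → entryVar n ∈? (x ∷ [])) {b ← c} {e} λ { (here y≡x) → y≢x y≡x })
        single

  only-variable : ∀ {x} {o : Occ t₀ (var x)} {e} → GoodEnv L o e → e ↾ var x ≡ e
  only-variable {x} g = filter-all (λ n → entryVar n ∈? (x ∷ [])) (names g)
    where
    names : ∀ {o : Occ t₀ (var x)} {e} → GoodEnv L o e → All (λ n → entryVar n ∈ (x ∷ [])) e
    names []                  = []
    names (bind x∈ _ _ _ g)   = x∈ ∷ names g

  -- One scope serves both parts of an application, and `i` is where the numbering of the binders
  -- inside `t′` starts. Left addresses are positive, which excludes the value 0 of `scope` and
  -- gives injectivity.
  binds-reflects : ∀ {t} {o : Occ t₀ t} {e} t′ i → first o ≤ i → GoodEnv L o e →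
    All (λ n → Reflects (entryVar n ∈ fv t′) (binds t′ (scope o) i n)) e
  binds-reflects t′ i first≤ [] = []
  binds-reflects {o = o} t′ i first≤ (bind {x = x} {b = b} x∈ x≡ gc ≢x g) =
    subst (λ k → Reflects (x ∈ fv t′) (occurs (binary k) (scope o) i t′)) x≡
      (occurs-reflects t′ x (λ y → ≤-trans (scope-below o y) first≤)
        (scope-injective o λ x≡0 → <⇒≢ (address-positive b) (sym (trans (sym x≡) x≡0))))
    ∷ binds-reflects t′ i first≤ g

filterᵇ-↾ : ∀ {t₀ t} {φ : Entry t₀ → Bool} {e} →
  All (λ n → Reflects (entryVar n ∈ fv t) (φ n)) e → filterᵇ φ e ≡ e ↾ t
filterᵇ-↾ [] = refl
filterᵇ-↾ {t = t} {φ} {n ∷ e} (r ∷ rs) with φ n | r | entryVar n ∈? fv t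
... | true  | _      | yes _  = cong (n ∷_) (filterᵇ-↾ {t = t} rs)
... | true  | ofʸ ∈t | no ∉t  = contradiction ∈t ∉t
... | false | ofⁿ ∉t | yes ∈t = contradiction ∈t ∉t
... | false | _      | no _   = filterᵇ-↾ {t = t} rs

-- Space

occSpace-positive : ∀ {t₀ t} (o : Occ t₀ t) → 1 ≤ occSpace o
occSpace-positive o = length-binary-mono (address-positive o)

length-occString : ∀ {t₀ t} (o : Occ t₀ t) → length (occString o) ≡ occSpace o
length-occString o = length-map bitʷ (binary (leftAddress o))

thrice : ∀ m n → 3 * (m + n) ≡ 3 * m + 3 * n
thrice m n = *-distribˡ-+ 3 m n

2+m≤3m : ∀ {m} → 1 ≤ m → 2 + m ≤ 3 * m
2+m≤3m {suc m} (s≤s z≤n) = ≤-trans (≤-reflexive (+-comm 2 (suc m)))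
  (+-monoʳ-≤ (suc m) (+-mono-≤ {1} {suc m} {1} (s≤s z≤n) (s≤s z≤n)))

mutual
  -- Separators are charged to addresses, which have at least one bit. Of the three separators of an
  -- entry, two are paid by the address of the binder and one by the address of the closure. The
  -- `suc` records this last payment; on the stack it is spent on `endʷ`.
  length-closureString : ∀ {t₀} (c : Closure t₀) →
      suc (length (closureString c)) ≤ 3 * closureSpace c
  length-closureString (clo o e) = begin
    suc (length (occString o ++ envString e))           ≡⟨ cong suc (length-++ (occString o)) ⟩
    suc (length (occString o) + length (envString e))   ≡⟨ cong
        (λ l → suc (l + length (envString e))) (length-occString o) ⟩
    1 + occSpace o + length (envString e)               ≤⟨ +-mono-≤
        (≤-trans (n≤1+n _) (2+m≤3m (occSpace-positive o))) (length-envString e) ⟩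
    3 * occSpace o + 3 * envSpace e                     ≡⟨ thrice (occSpace o) _ ⟨
    3 * (occSpace o + envSpace e)                       ∎
    where open ≤-Reasoning

  length-envString : ∀ {t₀} (e : Env t₀) → length (envString e) ≤ 3 * envSpace e
  length-envString []            = z≤n
  length-envString ((b ← c) ∷ e) = begin
    suc (length (occString b ++ ←ʷ ∷ closureString c ++ ⟧ʷ ∷ envString e))
      ≡⟨ cong suc (trans (length-++ (occString b))
          (cong₂ _+_ (length-occString b) (cong suc (length-++ (closureString c))))) ⟩
    suc (occSpace b + suc (length (closureString c) + suc (length (envString e))))
      ≡⟨ solve 3 (λ x y z → con 1 :+ (x :+ (con 1 :+ (y :+ (con 1 :+ z)))) := (con 2 :+ x) :+
          (con 1 :+ y) :+ z) refl
           (occSpace b) (length (closureString c)) (length (envString e)) ⟩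
    2 + occSpace b + suc (length (closureString c)) + length (envString e)
      ≤⟨ +-mono-≤ (+-mono-≤ (2+m≤3m (occSpace-positive b)) (length-closureString c))
          (length-envString e) ⟩
    3 * occSpace b + 3 * closureSpace c + 3 * envSpace e
      ≡⟨ cong (_+ 3 * envSpace e) (thrice (occSpace b) _) ⟨
    3 * (occSpace b + closureSpace c) + 3 * envSpace e
      ≡⟨ thrice (occSpace b + closureSpace c) _ ⟨
    3 * (occSpace b + closureSpace c + envSpace e) ∎
    where
    open ≤-Reasoning
    open +-*-Solver

length-stackString : ∀ {t₀} (π : Stack t₀) → length (stackString π) ≤ 3 * stackSpace π
length-stackString []      = z≤n
length-stackString (c ∷ π) = begin
  length (closureString c ++ endʷ ∷ stackString π)         ≡⟨ length-++ (closureString c) ⟩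
  length (closureString c) + suc (length (stackString π))  ≡⟨ +-suc (length (closureString c)) _ ⟩
  suc (length (closureString c)) + length (stackString π)  ≤⟨ +-mono-≤ (length-closureString c)
      (length-stackString π) ⟩
  3 * closureSpace c + 3 * stackSpace π                    ≡⟨ thrice (closureSpace c) _ ⟨
  3 * (closureSpace c + stackSpace π)                      ∎
  where open ≤-Reasoning

length-filterᵇ : ∀ {t₀} (φ : Entry t₀ → Bool) e →
    length (envString (filterᵇ φ e)) ≤ length (envString e)
length-filterᵇ φ []      = z≤n
length-filterᵇ φ (n ∷ e) with φ n
... | false = ≤-trans (length-filterᵇ φ e)
    (subst (length (envString e) ≤_) (cong length (sym (envString-∷ n e)))
                (≤-trans (n≤1+n _) (≤-trans (length-++-≤ʳ (entryBody n)) (n≤1+n _))))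
... | true  = subst₂ (λ v w → length v ≤ length w) (sym (envString-∷ n _)) (sym (envString-∷ n e))
                (s≤s (subst₂ _≤_ (sym (length-++ (entryBody n))) (sym (length-++ (entryBody n)))
                  (+-monoʳ-≤ (length (entryBody n)) (s≤s (length-filterᵇ φ e)))))

notEnd-bits : ∀ bs → All′ notEnd (bits bs)
notEnd-bits []       = []
notEnd-bits (b ∷ bs) = refl ∷ notEnd-bits bs

mutual
  notEnd-closure : ∀ {t₀} (c : Closure t₀) → All′ notEnd (closureString c)
  notEnd-closure (clo o e) = ++⁺ (notEnd-bits (binary (leftAddress o))) (notEnd-env e)

  notEnd-env : ∀ {t₀} (e : Env t₀) → All′ notEnd (envString e)
  notEnd-env []            = []
  notEnd-env ((b ← c) ∷ e) =
    refl ∷ ++⁺ (notEnd-bits (binary (leftAddress b)))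
        (refl ∷ ++⁺ (notEnd-closure c) (refl ∷ notEnd-env e))

stateSpace-positive : ∀ {t₀} (s : State t₀) → 1 ≤ stateSpace s
stateSpace-positive ⟨ o , e , π ⟩ =
  ≤-trans (occSpace-positive o) (≤-trans (m≤m+n _ (envSpace e)) (m≤m+n _ (stackSpace π)))

-- Transitions

memory : ∀ {t₀} → ℕ → State t₀ → Memory 13
memory L ⟨ o , e , π ⟩ = rootOf o , resting (occString o) (envString e) (stackString π) (unary L)

record Within {t₀ : Term} (P : ℕ) (s : State t₀) : Set where
  constructor within
  field
    space≤ : stateSpace s ≤ P

open Within

module _ {t₀ : Term} {P : ℕ} where

  private
    -- The strings of a state take at most `3 * P`. The remaining `P` is at least 1 and pays for one
    -- additional separator; counters and addresses are no longer than `P`.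
    height = 4 * P

  module _ {t : Term} {o : Occ t₀ t} {e : Env t₀} {π : Stack t₀}
      (space : Within P ⟨ o , e , π ⟩) where

    occ≤P : occSpace o ≤ P
    occ≤P = ≤-trans (≤-trans (m≤m+n _ (envSpace e)) (m≤m+n _ (stackSpace π))) (space≤ space)

    P≤height : P ≤ height
    P≤height = m≤m+n P (3 * P)

    1≤P : 1 ≤ P
    1≤P = ≤-trans (occSpace-positive o) occ≤P

    1≤height : 1 ≤ height
    1≤height = ≤-trans 1≤P P≤height

    fits-occ : Fits height (leftAddress o)
    fits-occ = mkFits (≤-trans occ≤P P≤height)

    -- In an application step, the restricted environment of the argument lies on the stack together
    -- with a new end marker, above all that was there before.
    env+stack≤ : suc (length (envString e) + length (stackString π)) ≤ height
    env+stack≤ = +-mono-≤ 1≤P (begin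
      length (envString e) + length (stackString π)  ≤⟨ +-mono-≤ (length-envString e)
          (length-stackString π) ⟩
      3 * envSpace e + 3 * stackSpace π              ≡⟨ thrice (envSpace e) _ ⟨
      3 * (envSpace e + stackSpace π)                ≤⟨ *-monoʳ-≤ 3
          (≤-trans (m≤n+m _ (occSpace o)) (≤-reflexive (sym (+-assoc (occSpace o) _ _)))) ⟩
      3 * (occSpace o + envSpace e + stackSpace π)   ≤⟨ *-monoʳ-≤ 3 (space≤ space) ⟩
      3 * P                                          ∎)
      where open ≤-Reasoning

    env≤ : length (envString e) ≤ height
    env≤ = ≤-trans (≤-trans (m≤m+n _ _) (n≤1+n _)) env+stack≤

    stack≤ : suc (length (stackString π)) ≤ height
    stack≤ = ≤-trans (s≤s (m≤n+m _ (length (envString e)))) env+stack≤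

  fits-limit : ∀ {L} → L ≤ P → Fits height (mersenne L)
  fits-limit {L} L≤P = mkFits
      (≤-trans (≤-reflexive (length-mersenne L)) (≤-trans L≤P (m≤m+n P (3 * P))))

  -- Both ends of the step belong to the run, so `P` bounds both of them; the target pays for the
  -- address of the body and for the new entry. The two rules for abstractions are treated together,
  -- with the outcome of the scan in place of the side condition.
  body-run : ∀ {x t L} {o : Occ t₀ (ƛ x t)} {e c π} →
    Within P ⟨ o , e , c ∷ π ⟩ → L ≤ P → Seen L o →
    let j = occurs (binary (first o)) (scope (body o)) (suc (first o)) t
        e′ = if j then (o ← c) ∷ e else e
    in Within P ⟨ body o , e′ , π ⟩ →
    lamCase ⊢[ height ] memory L ⟨ o , e , c ∷ π ⟩ ⇓ memory L ⟨ body o , e′ , π ⟩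
  body-run {x} {t} {L} {o} {e} {c} {π} space L≤P seen space′ =
    subst₂ (λ m a → lamCase ⊢[ height ] rootOf o , resting a (envString e) (stackString (c ∷ π)) m
                              ⇓ rootOf (body o) , resting (occString (body o)) (envString e′)
                                  (stackString π) m)
      (num-mersenne L) (cong num (sym (+-identityʳ (first o))))
      (conv refl (cong (λ w → resting (occString (body o)) w (stackString π) (num (mersenne L)))
          (sym e′≡))
        (lamCase-spec x t (index-first o) (subst (Fits height) (+-identityʳ _) (fits-occ space))
            (fits-limit L≤P)
          (continuation (body o) seen) (notEnd-closure c) (fits-occ space′)
          (≤-trans (n≤1+n _) (stack≤ space)) (1≤height space)
          (subst (λ w → length w ≤ height) e′≡ (env≤ space′))))
    where
    j = occurs (binary (first o)) (scope (body o)) (suc (first o)) t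
    e′ = if j then (o ← c) ∷ e else e

    bound-env : ∀ j → envString (if j then (o ← c) ∷ e else e)
      ≡ (if j then ⟦ʷ ∷ num (first o) ++ ←ʷ ∷ closureString c ++ ⟧ʷ ∷ envString e else envString e)
    bound-env true  = cong (λ a → ⟦ʷ ∷ num a ++ ←ʷ ∷ closureString c ++ ⟧ʷ ∷ envString e)
        (+-identityʳ (first o))
    bound-env false = refl

    e′≡ = bound-env j

  bound-reflects : ∀ {x t} (o : Occ t₀ (ƛ x t)) →
    Reflects (x ∈ fv t) (occurs (binary (first o)) (scope (body o)) (suc (first o)) t)
  bound-reflects {x} {t} o =
    subst (λ k → Reflects (x ∈ fv t) (occurs (binary k) (scope (body o)) (suc (first o)) t)) x≡
      (occurs-reflects t x (scope-below (body o)) (scope-injective (body o)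
        (λ x≡0 → <⇒≢ (first-positive o) (sym (trans (sym x≡) x≡0)))))
    where
    x≡ : scope (body o) x ≡ first o
    x≡ = update-same (scope o) x (first o)

  Steps : ℕ → State t₀ → State t₀ → Set
  Steps L s s′ = cond (onInput isLam) lamCase (cond (onInput isVar) subCase appCase)
    ⊢[ height ] memory L s ⇓ memory L s′

  lam-∈-steps : ∀ {x t L} {o : Occ t₀ (ƛ x t)} {e c π} → x ∈ fv t →
    Within P ⟨ o , e , c ∷ π ⟩ → L ≤ P → Seen L o →
    Within P ⟨ body o , (o ← c) ∷ e , π ⟩ → Steps L ⟨ o , e , c ∷ π ⟩ ⟨ body o , (o ← c) ∷ e , π ⟩
  lam-∈-steps {x} {t} {o = o} {e} {c} {π} x∈ space L≤P seen space′
    with occurs (binary (first o)) (scope (body o)) (suc (first o)) t | bound-reflects o | body-run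
        {o = o} {e} {c} {π} space L≤P seen
  ... | true  | _      | run = ifYes refl (run space′)
  ... | false | ofⁿ x∉ | _   = contradiction x∈ x∉

  lam-∉-steps : ∀ {x t L} {o : Occ t₀ (ƛ x t)} {e c π} → x ∉ fv t →
    Within P ⟨ o , e , c ∷ π ⟩ → L ≤ P → Seen L o →
    Within P ⟨ body o , e , π ⟩ → Steps L ⟨ o , e , c ∷ π ⟩ ⟨ body o , e , π ⟩
  lam-∉-steps {x} {t} {o = o} {e} {c} {π} x∉ space L≤P seen space′
    with occurs (binary (first o)) (scope (body o)) (suc (first o)) t | bound-reflects o | body-run
        {o = o} {e} {c} {π} space L≤P seen
  ... | true  | ofʸ x∈ | _   = contradiction x∈ x∉
  ... | false | _      | run = ifYes refl (run space′)

  sub-steps : ∀ {x u L} {o : Occ t₀ (var x)} {o′ : Occ t₀ u} {e e′ π} → GoodEnv L o e →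
    lookup e x ≡ just (clo o′ e′) →
    Within P ⟨ o , e , π ⟩ → Within P ⟨ o′ , e′ , π ⟩ → Steps L ⟨ o , e , π ⟩ ⟨ o′ , e′ , π ⟩
  sub-steps {o = o} {o′} {e} {e′} {π} g eq space space′ with lookup-unique g eq
  ... | _ , (b ← .(clo o′ e′)) , refl , single with trans (sym (only-variable g)) single
  ... | refl = ifNo refl (ifYes refl (run (root-at o′)))
    where
    nonbit : ∀ (e : Env t₀) → isBit (head (envString e ++ ⟧ʷ ∷ [])) ≡ false
    nonbit []            = refl
    nonbit ((_ ← _) ∷ _) = refl

    length≤ : length (envString e′ ++ ⟧ʷ ∷ []) ≤ height
    length≤ = ≤-trans (≤-reflexive (trans (length-++ (envString e′)) (+-comm _ 1)))
                (≤-trans (s≤s (m≤m+n _ _)) (env+stack≤ space′))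

    run : ∀ {L} → AtConstructor (rootOf o′) (leftAddress o′) →
      subCase ⊢[ height ] memory L ⟨ o , e , π ⟩ ⇓ memory L ⟨ o′ , e′ , π ⟩
    run {L} (atConstructor {ls} {y} {rs} head≡ is index) =
      subst (λ h → subCase ⊢[ height ] memory L ⟨ o , e , π ⟩ ⇓ h , resting (occString o′)
          (envString e′) (stackString π) (unary L))
        (sym head≡)
        (subCase-spec (rootOf o) ls (binary (leftAddress b))
          (trans (trans (word-rootOf o) (sym (word-rootOf o′))) (cong word head≡)) is index
          (fits-occ space′) (nonbit e′) length≤)

  module _ {t u : Term} {L : ℕ} {o : Occ t₀ (t · u)} {e : Env t₀} {π : Stack t₀} (g : GoodEnv L o e)
      (seen : Seen L o) (short : occSpace o ≤ L)
           (L≤P : L ≤ P) (space : Within P ⟨ o , e , π ⟩) where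

    private
      σ = scope o
      i = first o
      i′ = first o + suc (size t)
      φ ψ : Entry t₀ → Bool
      φ = binds t σ i
      ψ = binds u σ i′

      φ≡ : filterᵇ φ e ≡ e ↾ t
      φ≡ = filterᵇ-↾ {t = t} (binds-reflects t i ≤-refl g)

      ψ≡ : filterᵇ ψ e ≡ e ↾ u
      ψ≡ = filterᵇ-↾ {t = u} (binds-reflects u i′ (m≤m+n i _) g)

      t≤p : applications t ≤ mersenne L
      t≤p = ≤-trans (applications≤size t) (≤-trans (m≤n+m (size t) i) (≤-mersenne short))

      fits : Fits height (i + size t)
      fits = fits-occ space

      cont : Continuation (mersenne L) u (after o)
      cont = continuation (arg o) seen

      lsᵤ : List CodeSymbol
      lsᵤ = appˢ ∷ (encode σ i t ʳ++ openˢ ∷ before o)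

      working : List WorkSymbol → List WorkSymbol → List WorkSymbol → Stacks 13
      working a e s = st a e s [] [] [] [] [] [] [] [] (num (mersenne L)) (num (i + size t))

    app-run : ∀ {s′ a} h → Fits height (leftAddress (fun o)) → word h ≡ word (rootOf o) →
      cond (onInput isVar) strip pushArg
        ⊢[ height ] lsᵤ ▹ encode σ i′ u ++ after o , working (num (i + size t)) (envString (e ↾ t))
            (envString (e ↾ u) ++ endʷ ∷ stackString π)
             ⇓ h , working a (envString (e ↾ t)) s′ →
      cond (onInput isLam) lamCase (cond (onInput isVar) subCase appCase)
        ⊢[ height ] memory L ⟨ o , e , π ⟩
             ⇓ rootOf (fun o) , resting (occString (fun o)) (envString (e ↾ t)) s′ (unary L)
    app-run {s′} {a} h fits′ w≡ argument = ifNo refl (ifNo refl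
      (subst₂ (λ m e₁ → appCase ⊢[ height ] rootOf o , resting (occString o) (envString e)
          (stackString π) m
                                   ⇓ rootOf (fun o) , resting (occString (fun o))
                                       (envString e₁) s′ m)
        (num-mersenne L) φ≡
        (appCase-spec t u (index-app o) fits (fits-limit L≤P) t≤p cont e h
          (env≤ space)
          (≤-trans (length-filterᵇ φ e) (env≤ space))
          (≤-trans (≤-reflexive (length-++ (envString (filterᵇ ψ e))))
            (≤-trans (≤-reflexive (+-suc _ _))
                (≤-trans (s≤s (+-monoˡ-≤ _ (length-filterᵇ ψ e))) (env+stack≤ space))))
          fits′ w≡
          (subst₂ (λ e₁ e₂ → cond (onInput isVar) strip pushArg
            ⊢[ height ] lsᵤ ▹ encode σ i′ u ++ after o , working (num (i + size t)) (envString e₁)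
                (envString e₂ ++ endʷ ∷ stackString π)
                 ⇓ h , working a (envString e₁) s′) (sym φ≡) (sym ψ≡) argument))))

    app-steps : NotVar u → Within P ⟨ fun o , e ↾ t , clo (arg o) (e ↾ u) ∷ π ⟩ →
      Steps L ⟨ o , e , π ⟩ ⟨ fun o , e ↾ t , clo (arg o) (e ↾ u) ∷ π ⟩
    app-steps notVar space′ =
      conv refl (cong (λ s → resting (occString (fun o)) (envString (e ↾ t)) s (unary L))
          (sym (++-assoc (occString (arg o)) _ _)))
        (app-run (rootOf (arg o)) (fits-occ space′)
          (trans (word-rootOf (arg o)) (sym (word-rootOf o)))
          (pushArg-spec {t₀ = t₀} t u (index-app o) fits (fits-limit L≤P) t≤p cont notVar
            (mkFits (≤-trans arg≤ (m≤m+n P (3 * P))))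
            (≤-trans (≤-reflexive (cong length
                (sym (++-assoc (occString (arg o)) (envString (e ↾ u)) _))))
              (≤-trans (n≤1+n _) (stack≤ space′)))))
      where
      arg≤ : occSpace (arg o) ≤ P
      arg≤ = ≤-trans (≤-trans (m≤m+n (occSpace (arg o)) (envSpace (e ↾ u)))
               (≤-trans (m≤m+n _ (stackSpace π)) (m≤n+m _ (occSpace (fun o) + envSpace (e ↾ t)))))
                   (space≤ space′)

  app-var-steps : ∀ {t x c L} {o : Occ t₀ (t · var x)} {e π} → lookup e x ≡ just c →
    GoodEnv L o e → Seen L o → occSpace o ≤ L → L ≤ P →
    Within P ⟨ o , e , π ⟩ → Within P ⟨ fun o , e ↾ t , c ∷ π ⟩ →
    Steps L ⟨ o , e , π ⟩ ⟨ fun o , e ↾ t , c ∷ π ⟩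
  app-var-steps {t} {x} {c} {L} {o} {e} {π} eq g seen short L≤P space space′ with lookup-unique g eq
  ... | _ , (b ← .c) , refl , single =
    app-run g seen short L≤P space (lsᵤ ▹ encode (scope o) i′ (var x) ++ after o)
      (fits-occ space′) refl
      (ifYes refl (conv (cong (λ s → working (envString (e ↾ t)) s) (sym stack≡)) refl
        (strip-spec (binary (leftAddress b)) (closureString c) (notEnd-closure c) bound)))
    where
    i′ = first o + suc (size t)
    lsᵤ : List CodeSymbol
    lsᵤ = appˢ ∷ (encode (scope o) (first o) t ʳ++ openˢ ∷ before o)

    working : List WorkSymbol → List WorkSymbol → Stacks 13
    working e s = st (num (first o + size t)) e s [] [] [] [] [] [] [] [] (num (mersenne L))
        (num (first o + size t))

    stack≡ : envString (e ↾ var x) ++ endʷ ∷ stackString π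
           ≡ ⟦ʷ ∷ occString b ++ ←ʷ ∷ closureString c ++ ⟧ʷ ∷ endʷ ∷ stackString π
    stack≡ = trans (cong (λ e → envString e ++ endʷ ∷ stackString π) single)
      (cong (⟦ʷ ∷_) (trans (++-assoc (occString b) _ _)
        (cong (λ w → occString b ++ ←ʷ ∷ w) (++-assoc (closureString c) _ _))))

    bound : length (closureString c ++ ⟧ʷ ∷ endʷ ∷ stackString π) ≤ height
    bound = ≤-trans (≤-reflexive
        (trans (length-++ (closureString c))
        (trans (+-suc _ _) (cong suc (sym (length-++ (closureString c)))))))
      (stack≤ space′)

  -- The limit is raised before the transition, so that the address of an active application is
  -- covered when `Seen` demands it for the function part. The new limit is the maximum of the old
  -- one and the length of the active address, and both are at most `P`.
  steps : ∀ {L s s′} → s ⟶ s′ → Within P s → Within P s′ → L ≤ P → GoodState L s →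
    ∃ λ L′ → L′ ≤ P × GoodState L′ s′ × transition ⊢[ height ] memory L s ⇓ memory L′ s′
  steps {L} {s} {s′} r space space′ L≤P g =
    L′ s , L′≤P s space , goodStep r g′ , (raise s space ⨾ run r g′ (occ≤L′ s) space)
    where
    L′ : State t₀ → ℕ
    L′ ⟨ o , e , π ⟩ = length (occString o) + (L ∸ length (occString o))

    L′≤P : ∀ s → Within P s → L′ s ≤ P
    L′≤P ⟨ o , e , π ⟩ space with ≤-total (length (occString o)) L
    ... | inj₁ o≤L = ≤-trans (≤-reflexive (m+[n∸m]≡n o≤L)) L≤P
    ... | inj₂ L≤o = ≤-trans (≤-reflexive
        (trans (cong (length (occString o) +_) (m≤n⇒m∸n≡0 L≤o)) (+-identityʳ _)))
                       (≤-trans (≤-reflexive (length-occString o)) (occ≤P space))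

    L≤L′ : ∀ s → L ≤ L′ s
    L≤L′ ⟨ o , e , π ⟩ = m≤n+m∸n L (length (occString o))

    g′ : GoodState (L′ s) s
    g′ = goodState-mono (L≤L′ s) g

    data Short (L : ℕ) : State t₀ → Set where
      short : ∀ {t} {o : Occ t₀ t} {e π} → occSpace o ≤ L → Short L ⟨ o , e , π ⟩

    occ≤L′ : ∀ s → Short (L′ s) s
    occ≤L′ ⟨ o , e , π ⟩ = short (≤-trans (≤-reflexive (sym (length-occString o))) (m≤m+n _ _))

    raise : ∀ s → Within P s → raiseLimit ⊢[ height ] memory L s ⇓ memory (L′ s) s
    raise ⟨ o , e , π ⟩ space = raiseLimit-spec (occString o) L
      (fits-num (fits-occ space)) (≤-trans L≤P (m≤m+n P (3 * P)))

    goodStep : ∀ {s s′} → s ⟶ s′ → GoodState (L′ s) s → GoodState (L′ s) s′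
    goodStep {⟨ o , e , π ⟩} (app-var eq) (good seen g gs) with lookup-unique g eq
    ... | gc , _ = good ((≤-trans (≤-reflexive (sym (length-occString o))) (m≤m+n _ _)) , seen)
        (restrict (λ _ → refl) g) (gc ∷ gs)
    goodStep {⟨ o , e , π ⟩} (app _) (good seen g gs) =
      good ((≤-trans (≤-reflexive (sym (length-occString o))) (m≤m+n _ _)) , seen)
          (restrict (λ _ → refl) g)
           (clo seen (restrict (λ _ → refl) g) ∷ gs)
    goodStep (lam-∉ x∉) (good seen g (gc ∷ gs)) = good seen (proj₁ (enter g)) gs
    goodStep {⟨ o , e , π ⟩} (lam-∈ {x = x} x∈) (good seen g (gc ∷ gs)) with enter g
    ... | g′ , ≢x = good seen (bind x∈
        (trans (update-same (scope o) x (first o)) (sym (+-identityʳ _))) gc ≢x g′) gs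
    goodStep (sub eq) (good seen g gs) with lookup-unique g eq
    ... | clo seen′ g′ , _ = good seen′ g′ gs

    run : ∀ {s} → s ⟶ s′ → GoodState (L′ s) s → Short (L′ s) s → Within P s → Steps (L′ s) s s′
    run {s} (app-var eq)   (good seen g _) (short o≤) space = app-var-steps eq g seen o≤
        (L′≤P s space) space space′
    run {s} (app notVar)   (good seen g _) (short o≤) space = app-steps g seen o≤ (L′≤P s space)
        space notVar space′
    run {s} (lam-∉ x∉)     (good seen g _) _ space = lam-∉-steps x∉ space (L′≤P s space) seen space′
    run {s} (lam-∈ x∈)     (good seen g _) _ space = lam-∈-steps x∈ space (L′≤P s space) seen space′
    run (sub eq)           (good seen g _) _ space = sub-steps g eq space space′

-- The implementation

looping : ∀ {K} → Cmd (suc K) → Cmd (suc K) → Cmd (suc K)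
looping c d = c ⨾ forever zero d

-- The ready position is the test of the endless loop, which is met once after the initialisation
-- and once after each transition.
ready : ∀ {K} (c d : Cmd (suc K)) → Pos (looping c d) → Bool
ready c d (inj₂ (inj₁ tt)) = true
ready c d _                = false

module Looping {K : ℕ} (c d : Cmd (suc K)) (w : List CodeSymbol) (H : ℕ) where

  open Simulation (machine (looping c d)) (ready c d) w H public

  total-map : ∀ {A B X : Set} {x : X} (f : A → B) (b : B) (m : Maybe A) →
    Maybe.map (_, x) (thenGoTo f (just b) m) ≡ just (Maybe.maybe f b m , x)
  total-map f b (just _) = refl
  total-map f b nothing  = refl

  inFirst : Maybe (Pos c) → Pos (looping c d)
  inFirst = Maybe.maybe inj₁ (inj₂ (inj₁ tt))

  inLoop : Maybe (Pos d) → Pos (looping c d)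
  inLoop = Maybe.maybe (inj₂ ∘ inj₂) (inj₂ (inj₁ tt))

  first-embedding : Embedding c inFirst
  first-embedding q = refl , λ a v → total-map inj₁ _ (proj₁ (advance c q a v))

  loop-embedding : Embedding d inLoop
  loop-embedding q = refl , λ a v → total (proj₁ (advance d q a v))
    where
    total : ∀ {X : Set} {x : X} (m : Maybe (Pos d)) →
      Maybe.map (_, x) (thenGoTo inj₂ nothing (thenGoTo inj₂ (just (inj₁ tt)) m))
      ≡ just (inLoop m , x)
    total (just _) = refl
    total nothing  = refl

  ReadyAfter : Config (machine (looping c d)) → ℕ → Vec (Tape WorkSymbol) (suc K) →
      Memory (suc K) → Set
  ReadyAfter c₀ p τs s = Simulates p τs s ×
    NextReady (machine (looping c d)) (ready c d) w c₀ (config (inj₂ (inj₁ tt)) p τs)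

  ready-first : ∀ {s} → c ⊢[ H ] [] ▹ w , Vec.replicate (suc K) [] ⇓ s →
    ∃₂ λ p τs → ReadyAfter (startConfig (machine (looping c d))) p τs s
  ready-first run with simulate c inFirst first-embedding run
                     (mkSimulates refl refl λ i →
                         subst₂ (Holdsᴴ H) (sym (lookup-replicate i blankTape))
                         (sym (lookup-replicate i [])) holdsᴴ-blank)
  ... | p , τs , S , path = p , τs , S , nextReady⁺ refl path refl

  ready-next : ∀ {p τs s s′} → d ⊢[ H ] s ⇓ s′ → Simulates p τs s →
    ∃₂ λ p′ τs′ → ReadyAfter (config (inj₂ (inj₁ tt)) p τs) p′ τs′ s′
  -- The test of the loop takes one machine step, which changes no tape.
  ready-next run S with simulate d inLoop loop-embedding run (idle-simulates stay S)
  ... | p , τs , S′ , path = p , τs , S′ , nextReady refl path refl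

first-state≤ : ∀ {t} {s q : State t} (ρ : s ⟶* q) → stateSpace s ≤ ∣ ρ ∣sp
first-state≤ ε       = ≤-refl
first-state≤ (r ◅ ρ) = m≤m⊔n _ _

initialise-run : ∀ t {P} → stateSpace (initial t) ≤ P →
  initialise ⊢[ 4 * P ] [] ▹ codeString t , Vec.replicate 13 [] ⇓ memory 0 (initial t)
initialise-run t {P} space =
  push (1≤height (within {s = initial t} space)) ⨾
  subst (λ w → toRoot ⊢[ 4 * P ] [] ▹ w , resting (num 1) [] [] [] ⇓ memory 0 (initial t))
    (++-identityʳ (codeString t))
    (toRoot-spec t refl (fits-occ (within {s = initial t} space)))

module Implementation (c d : Cmd 13)
  (c-run : ∀ t {P} → stateSpace (initial t) ≤ P →
    c ⊢[ 4 * P ] [] ▹ codeString t , Vec.replicate 13 [] ⇓ memory 0 (initial t))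
  (d-run : ∀ {t P L} {s s′ : State t} → s ⟶ s′ → Within P s → Within P s′ → L ≤ P → GoodState L s →
    ∃ λ L′ → L′ ≤ P × GoodState L′ s′ × d ⊢[ 4 * P ] memory L s ⇓ memory L′ s′) where

  M : KAMachine 10
  M = machine (looping c d)

  module _ (t : Term) {P : ℕ} (1≤P : 1 ≤ P) where

    open Looping c d (codeString t) (4 * P)

    -- Each of the 13 tapes has at most `4 * P` cells and the blank one below its stack. As `P` is
    -- positive, this is at most `5 * P`, which gives the factor 65.
    cells-bound : ∀ {p τs s q} → Simulates p τs s → cellsUsed M (config q p τs) ≤ 65 * P
    cells-bound {τs = τs} S = begin
      Vec.sum (Vec.map (λ τ → length (contents τ)) τs)  ≤⟨ sum≤ τs
          (λ i → holdsᴴ-cells (tapes S i)) ⟩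
      13 * suc (4 * P)                                  ≤⟨ *-monoʳ-≤ 13 (+-monoˡ-≤ (4 * P) 1≤P) ⟩
      13 * (5 * P)                                      ≡⟨ *-assoc 13 5 P ⟨
      65 * P                                            ∎
      where
      open ≤-Reasoning
      sum≤ : ∀ {n B} (τs : Vec (Tape WorkSymbol) n) →
          (∀ i → length (contents (Vec.lookup τs i)) ≤ B) →
             Vec.sum (Vec.map (λ τ → length (contents τ)) τs) ≤ n * B
      sum≤ []       bound = z≤n
      sum≤ (τ ∷ τs) bound = +-mono-≤ (bound zero) (sum≤ τs (bound ∘ suc))

    represents : ∀ {p τs q L} (s : State t) → Simulates p τs (memory L s) →
        Represents M (config q p τs) s
    represents {τs = τ₁ ∷ τ₂ ∷ τ₃ ∷ _} ⟨ o , e , π ⟩ S =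
      holdsᴴ⇒holds (tapes S zero) , holdsᴴ⇒holds (tapes S (suc zero)) , holdsᴴ⇒holds
          (tapes S (suc (suc zero)))

    goesThrough : ∀ {s q : State t} (ρ : s ⟶* q) {L c₀ p τs} → ∣ ρ ∣sp ≤ P → L ≤ P → GoodState L s →
      ReadyAfter c₀ p τs (memory L s) → GoesThrough M (ready c d) (65 * P) c₀ ρ
    goesThrough (ε {s}) ρ≤ L≤ g (S , nr) = last nr (represents s S)
        (cells-bound {q = inj₂ (inj₁ tt)} S)
    goesThrough (_◅_ {s} r ρ) ρ≤ L≤ g (S , nr)
      with d-run r (within (≤-trans (m≤m⊔n _ _) ρ≤))
          (within (≤-trans (first-state≤ ρ) (≤-trans (m≤n⊔m _ _) ρ≤))) L≤ g
    ... | L′ , L′≤ , g′ , run with ready-next run S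
    ...   | p′ , τs′ , after′ =
      next nr (represents s S) (cells-bound {q = inj₂ (inj₁ tt)} S)
          (goesThrough ρ (≤-trans (m≤n⊔m _ _) ρ≤) L′≤ g′ after′)

  implements : ∀ t {q : State t} (ρ : initial t ⟶* q) →
      ImplementsInSpace M (ready c d) (65 * ∣ ρ ∣sp) ρ
  implements t ρ =
    goesThrough t (≤-trans (stateSpace-positive (initial t)) (first-state≤ ρ)) ρ ≤-refl z≤n
        (good tt [] [])
      (proj₂ (proj₂ (Looping.ready-first c d (codeString t) _ (c-run t (first-state≤ ρ)))))

proposition10p2 : ∃ λ (k : ℕ) → Σ (KAMachine k) λ M → Σ (TM.Control M → Bool) λ ready → ∃ λ (C : ℕ) →
    (t : Term) → Closed t →
    {q : State t} (ρ : initial t ⟶* q) →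
    ImplementsInSpace M ready (C * ∣ ρ ∣sp) ρ
proposition10p2 = 10 , machine (looping initialise transition) , ready initialise transition , 65 ,
  λ t _ ρ → Implementation.implements initialise transition initialise-run steps t ρ
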